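{- There are only finitely many uniformly most reliable graphs of corank $5$. That is, up to isomorphism there are only finitely many simple graphs $G$ such that, for some positive integer $n$, $G$ belongs to $\mathcal{C}_{n,n+4}$ and $G$ is a uniformly most reliable graph in $\mathcal{C}_{n,n+4}$.
   Context: All graphs are finite and undirected. For positive integers $n,m$, $\mathcal{C}_{n,m}$ denotes the class of connected simple graphs on $n$ vertices and $m$ edges. The corank of a graph in $\mathcal{C}_{n,m}$ is $m-n+1$. For a simple graph $G$ and $\rho\in[0,1]$, the reliability $R_G(\rho)$ is the probability that $G$ remains connected when each edge is removed independently with probability $\rho$. A graph $G\in\mathcal{C}_{n,m}$ is a uniformly most reliable graph (UMRG) if $R_G(\rho)\ge R_H(\rho)$ for every $H\in\mathcal{C}_{n,m}$ and every $\rho\in[0,1]$. -}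

module Defs where

open import Data.Nat as ℕ using (ℕ; zero; suc; _<ᵇ_)
open import Data.Bool using (Bool; true; false; _∧_; _∨_; if_then_else_)
open import Data.Fin using (Fin; toℕ) renaming (zero to fzero)
open import Data.Fin.Properties using () renaming (_≟_ to _≟F_)
open import Data.List using (List; []; _∷_; length; map; filter; concatMap; foldr; _++_)
open import Data.Bool.ListAction using (any; all)
open import Data.List.Relation.Unary.Any using (Any)
open import Data.Vec.Functional using () renaming (Vector to Vec)
open import Data.Product using (Σ; _×_; _,_; proj₁; proj₂)
open import Data.Rational using (ℚ; 0ℚ; 1ℚ; _+_; _*_; _-_; _≤_)
open import Relation.Nullary.Decidable using (⌊_⌋)
open import Relation.Binary.PropositionalEquality using (_≡_)
open import Function.Bundles using (_↔_; Inverse)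

allFin : (n : ℕ) → List (Fin n)
allFin zero = []
allFin (suc n) = fzero ∷ map Data.Fin.suc (allFin n)

record Graph (n : ℕ) : Set where
  field
    adj   : Fin n → Fin n → Bool
    sym   : ∀ i j → adj i j ≡ adj j i
    irrefl : ∀ i → adj i i ≡ false
open Graph public

Edge : ℕ → Set
Edge n = Fin n × Fin n

edges : ∀ {n} → Graph n → List (Edge n)
edges {n} G =
  concatMap (λ i → map (λ j → (i , j))
                       (filter (λ j → Data.Bool.T? ((toℕ i <ᵇ toℕ j) ∧ adj G i j)) (allFin n)))
            (allFin n)

numEdges : ∀ {n} → Graph n → ℕ
numEdges G = length (edges G)

subsets : {A : Set} → List A → List (List A)
subsets [] = [] ∷ []
subsets (x ∷ xs) = let r = subsets xs in map (x ∷_) r ++ r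

_==_ : ∀ {n} → Fin n → Fin n → Bool
i == j = ⌊ i ≟F j ⌋

step : ∀ {n} → List (Edge n) → (Fin n → Bool) → Fin n → Bool
step K R v = R v ∨ any (λ e → (R (proj₁ e) ∧ (proj₂ e == v)) ∨ (R (proj₂ e) ∧ (proj₁ e == v))) K

iter : ∀ {n} → ℕ → List (Edge n) → (Fin n → Bool) → Fin n → Bool
iter zero K R = R
iter (suc k) K R = step K (iter k K R)

-- the spanning subgraph (Fin n, K) is connected: every vertex is joined
-- by a path (necessarily of length ≤ n) to vertex 0.  (Empty graph: connected.)
connectedᵇ : (n : ℕ) → List (Edge n) → Bool
connectedᵇ zero K = true
connectedᵇ (suc n) K = all (iter (suc n) K (λ v → v == fzero)) (allFin (suc n))

Connected : ∀ {n} → Graph n → Set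
Connected {n} G = connectedᵇ n (edges G) ≡ true

InC : (n m : ℕ) → Graph n → Set
InC n m G = Connected G × numEdges G ≡ m

_^_ : ℚ → ℕ → ℚ
x ^ zero = 1ℚ
x ^ suc k = x * (x ^ k)

sumℚ : List ℚ → ℚ
sumℚ = foldr _+_ 0ℚ

-- reliability polynomial evaluated at ρ: each edge removed independently with
-- probability ρ (kept with probability 1 - ρ); sum over kept edge sets K that
-- leave the graph connected.
Rel : ∀ {n} → Graph n → ℚ → ℚ
Rel {n} G ρ =
  sumℚ (map (λ K → if connectedᵇ n K
                     then ((1ℚ - ρ) ^ length K) * (ρ ^ (numEdges G ℕ.∸ length K))
                     else 0ℚ)
            (subsets (edges G)))

UMRG : (n m : ℕ) → Graph n → Set
UMRG n m G = InC n m G ×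
  ((H : Graph n) → InC n m H → (ρ : ℚ) → 0ℚ ≤ ρ → ρ ≤ 1ℚ → Rel H ρ ≤ Rel G ρ)

Iso : ∀ {n n'} → Graph n → Graph n' → Set
Iso {n} {n'} G H = Σ (Fin n ↔ Fin n') λ f →
  ∀ i j → adj G i j ≡ adj H (Inverse.to f i) (Inverse.to f j)

AnyGraph : Set
AnyGraph = Σ ℕ Graph

{-# OPTIONS --safe #-}

-- Write N_i for the number of i-sets of edges whose removal keeps the graph connected; the
-- reliability is Σ N_i ρ^i (1 - ρ)^(m - i), so a uniformly most reliable graph maximises N_2
-- (ρ → 0) and N_5 (ρ → 1, as N_i = 0 for i > 5). Contracting bridges and suppressing vertices of
-- degree two turns a graph of corank 5 into a weighted multigraph of minimum degree three, which
-- has at most 8 vertices and 12 edges. With m = 12 t + r edges, maximality of N_2 against the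
-- evenly subdivided Wagner graph forces a cubic multigraph on 8 vertices with all weights at most
-- t + 3. Such a multigraph has at most 392 spanning trees, whence N_5 ≤ 392 (t + 3)^5. But the
-- edges of the Wagner graph, which attains 392, are not equivalent: making its chords longer and
-- its rim shorter by a bounded amount gains order t^4 in N_5 and violates this bound for large t.

module Submission where

open import Defs using (Graph; adj; irrefl; Edge; edges; numEdges; subsets; _==_; step; iter; connectedᵇ; InC; sumℚ; Rel; UMRG; Iso; AnyGraph; allFin) renaming (sym to adj-sym; _^_ to _^ℚ_)
open import Data.Nat hiding (_/_; _%_)
open import Data.Nat.Properties
open import Data.Nat.DivMod using (_/_; _%_; m≡m%n+[m/n]*n; m%n<n; /-monoˡ-≤)
open import Data.Nat.ListAction using (sum)
open import Data.Nat.Tactic.RingSolver using (solve-∀)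
open import Data.Bool using (Bool; true; false; if_then_else_; _∧_; _∨_; T; not; T?)
open import Data.Fin using (Fin; toℕ; fromℕ<)
open import Data.List using (List; []; _∷_; _++_; length; map; filter; upTo; concatMap)
open import Data.List.Membership.Propositional using (_∈_; _∉_; find; lose)
open import Data.List.Membership.Propositional.Properties.WithK using (unique∧set⇒bag)
open import Data.List.Relation.Binary.BagAndSetEquality using (∼bag⇒↭)
open import Data.List.Relation.Binary.Permutation.Propositional using (_↭_; refl; prep; swap; trans; ↭-sym; ↭⇒↭ₛ)
open import Data.List.Relation.Binary.Pointwise using (Pointwise; []; _∷_)
open import Data.List.Relation.Unary.All using (All; []; _∷_)
open import Data.List.Relation.Unary.AllPairs using ([]; _∷_; allPairs?)
open import Data.List.Relation.Unary.Any using (Any; here; there; any?)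
open import Data.List.Relation.Unary.Unique.Propositional using (Unique)
open import Data.Product using (Σ; ∃; _×_; _,_; proj₁; proj₂)
open import Data.Sum using (_⊎_; inj₁; inj₂)
open import Data.Empty using (⊥; ⊥-elim)
open import Data.Unit using (tt)
open import Data.Rational using (ℚ; 0ℚ; 1ℚ; 1/_) renaming (_+_ to _+ℚ_; _*_ to _*ℚ_; _-_ to _-ℚ_; _≤_ to _≤ℚ_; _<_ to _<ℚ_)
open import Data.Rational.Solver using (module +-*-Solver)
open import Function using (_∘_; id; case_of_)
open import Function.Bundles using (Equivalence; mk⇔)
open import Function.Construct.Identity using (↔-id)
open import Relation.Nullary using (¬_; Dec; yes; no; does; contradiction)
open import Relation.Nullary.Decidable using (map′; ¬?; _×-dec_; _→-dec_; ⌊_⌋; toWitness; fromWitness; from-yes)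
open import Relation.Unary using (Decidable)
open import Relation.Binary.PropositionalEquality using (_≡_; _≢_; refl; sym; cong; cong₂; subst; subst₂; setoid; module ≡-Reasoning) renaming (trans to ≡-trans)
import Data.Bool.Properties as Bool
import Data.Fin as Fin
import Data.Fin.Properties as Fin
import Data.List.Membership.Propositional.Properties as ∈
import Data.List.Properties as List
import Data.List.Relation.Binary.Permutation.Propositional.Properties as ↭
import Data.List.Relation.Binary.Permutation.Setoid.Properties (setoid ℕ) as Permutation
import Data.List.Relation.Binary.Pointwise as Pointwise
import Data.List.Relation.Unary.All as All
import Data.List.Relation.Unary.All.Properties as All
import Data.List.Relation.Unary.AllPairs as AllPairs
import Data.List.Relation.Unary.AllPairs.Properties as AllPairs
import Data.List.Relation.Unary.Any as Any
import Data.List.Relation.Unary.Any.Properties as Any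
import Data.List.Relation.Unary.Unique.Propositional.Properties as Unique
import Data.Product.Properties as Product
import Data.Rational as ℚ
import Data.Rational.Properties as ℚ

-- Weighted counts of edge sets whose removal preserves a property

-- `N_2` sees the weights only through their sum s and the sum of their squares:
-- `2 N_2 ≤ s² - Σ w²`, with equality when any two links may be removed, as in the Wagner graph. For
-- twelve links, comparison with the even subdivision therefore gives `Σ (w - t)² ≤ r < 12`, so no
-- weight can reach t + 4; a missing link would act as one of weight 0 and force `t² < 12`. The
-- obstacle is that this fixes the weights only up to a bounded error: the bound `392 (t + 3)^5`
-- exceeds `392 t^5` by about `5880 t^4`, which is the same order as the gain from skewing. The gain
-- wins because the size of the skew is a free constant. Shortening the rim by s and lengthening the
-- chords by 2 s changes `N_5` in first order by `(4 · 2 · 168 - 8 · 161) s t^4 = 56 s t^4`, which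
-- exceeds `5880 t^4` once s > 105.

prev : (ℕ → ℕ) → ℕ → ℕ
prev g zero    = 0
prev g (suc i) = g i

prev-mono : ∀ {g h : ℕ → ℕ} → (∀ i → g i ≤ h i) → ∀ i → prev g i ≤ prev h i
prev-mono g≤h zero    = z≤n
prev-mono g≤h (suc i) = g≤h i

prev-cong : ∀ {g h : ℕ → ℕ} → (∀ i → g i ≡ h i) → ∀ i → prev g i ≡ prev h i
prev-cong g≡h zero    = refl
prev-cong g≡h (suc i) = g≡h i

prev-+* : ∀ (g h : ℕ → ℕ) w i → prev (λ j → g j + w * h j) i ≡ prev g i + w * prev h i
prev-+* g h w zero    = sym (*-zeroʳ w)
prev-+* g h w (suc i) = refl

prev-0 : ∀ {g : ℕ → ℕ} → (∀ i → g i ≡ 0) → ∀ i → prev g i ≡ 0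
prev-0 g≡0 zero    = refl
prev-0 g≡0 (suc i) = g≡0 i

indicator : ∀ {P : Set} → Dec P → ℕ → ℕ
indicator P? zero    = if does P? then 1 else 0
indicator P? (suc i) = 0

indicator-mono : ∀ {P Q : Set} (P? : Dec P) (Q? : Dec Q) → (P → Q) → ∀ i → indicator P? i ≤ indicator Q? i
indicator-mono P?      Q?      P⇒Q (suc i) = z≤n
indicator-mono (no _)  Q?      P⇒Q zero    = z≤n
indicator-mono (yes p) (yes _) P⇒Q zero    = ≤-refl
indicator-mono (yes p) (no ¬q) P⇒Q zero    = contradiction (P⇒Q p) ¬q

∧-true : ∀ {x y} → x ∧ y ≡ true → x ≡ true × y ≡ true
∧-true {true} {true} _ = refl , refl

Weighted : Set → Set
Weighted A = List (A × ℕ)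

-- cnt P? i E is the sum, over the i-element subfamilies R of E such that P holds of E ∖ R,
-- of the product of the weights of R.
cnt : ∀ {A : Set} {P : List A → Set} → Decidable P → ℕ → Weighted A → ℕ
cnt P? i []            = indicator (P? []) i
cnt P? i ((e , w) ∷ E) = cnt (λ K → P? (e ∷ K)) i E + w * prev (λ j → cnt P? j E) i

ones : ∀ {A : Set} → List A → Weighted A
ones = map (_, 1)

weight : ∀ {A : Set} → Weighted A → ℕ
weight []            = 0
weight ((e , w) ∷ E) = w + weight E

weight² : ∀ {A : Set} → Weighted A → ℕ
weight² []            = 0
weight² ((e , w) ∷ E) = w * w + weight² E

module _ {A B : Set} where

  cnt-mono : ∀ {P : List A → Set} {Q : List B → Set} (P? : Decidable P) (Q? : Decidable Q) {R : A → B → Set} →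
    (∀ {K K′} → Pointwise R K K′ → P K → Q K′) →
    ∀ {E E′} → Pointwise (λ e e′ → R (proj₁ e) (proj₁ e′) × proj₂ e ≤ proj₂ e′) E E′ →
    ∀ i → cnt P? i E ≤ cnt Q? i E′
  cnt-mono P? Q? P⇒Q []                i = indicator-mono (P? []) (Q? []) (P⇒Q []) i
  cnt-mono P? Q? P⇒Q ((r , w≤w′) ∷ rs) i =
    +-mono-≤ (cnt-mono _ _ (λ rs′ → P⇒Q (r ∷ rs′)) rs i)
             (*-mono-≤ w≤w′ (prev-mono (cnt-mono P? Q? P⇒Q rs) i))

  cnt-cong : ∀ {P : List A → Set} {Q : List B → Set} (P? : Decidable P) (Q? : Decidable Q) {R : A → B → Set} →
    (∀ {K K′} → Pointwise R K K′ → P K → Q K′) →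
    (∀ {K K′} → Pointwise R K K′ → Q K′ → P K) →
    ∀ {E E′} → Pointwise (λ e e′ → R (proj₁ e) (proj₁ e′) × proj₂ e ≡ proj₂ e′) E E′ →
    ∀ i → cnt P? i E ≡ cnt Q? i E′
  cnt-cong P? Q? P⇒Q Q⇒P [] i =
    ≤-antisym (indicator-mono (P? []) (Q? []) (P⇒Q []) i) (indicator-mono (Q? []) (P? []) (Q⇒P []) i)
  cnt-cong P? Q? P⇒Q Q⇒P ((r , w≡w′) ∷ rs) i =
    cong₂ _+_ (cnt-cong _ _ (λ rs′ → P⇒Q (r ∷ rs′)) (λ rs′ → Q⇒P (r ∷ rs′)) rs i)
              (cong₂ _*_ w≡w′ (prev-cong (cnt-cong P? Q? P⇒Q Q⇒P rs) i))

module _ {A : Set} where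

  pointwise-refl : ∀ {S : A → Set} {E : Weighted A} → All (S ∘ proj₁) E →
    Pointwise (λ e e′ → (proj₁ e ≡ proj₁ e′ × S (proj₁ e)) × proj₂ e ≡ proj₂ e′) E E
  pointwise-refl []       = []
  pointwise-refl (s ∷ ss) = ((refl , s) , refl) ∷ pointwise-refl ss

  pointwise-restrict : ∀ {S : A → Set} {K K′ : List A} →
    Pointwise (λ e e′ → e ≡ e′ × S e) K K′ → K ≡ K′ × All S K
  pointwise-restrict []              = refl , []
  pointwise-restrict ((refl , s) ∷ rs) with refl , ss ← pointwise-restrict rs = refl , s ∷ ss

  -- The equivalence is required only on families satisfying `S`. The reductions below take for `S`
  -- that a link avoids the vertex being eliminated.
  cnt-iff : ∀ {P Q : List A → Set} (P? : Decidable P) (Q? : Decidable Q) {S : A → Set} →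
    (∀ {K} → All S K → P K → Q K) → (∀ {K} → All S K → Q K → P K) →
    ∀ {E} → All (S ∘ proj₁) E → ∀ i → cnt P? i E ≡ cnt Q? i E
  cnt-iff {P} {Q} P? Q? {S} P⇒Q Q⇒P ss i = cnt-cong P? Q? to from (pointwise-refl ss) i
    where
    to : ∀ {K K′} → Pointwise (λ e e′ → e ≡ e′ × S e) K K′ → P K → Q K′
    to rs with refl , ss ← pointwise-restrict rs = P⇒Q ss
    from : ∀ {K K′} → Pointwise (λ e e′ → e ≡ e′ × S e) K K′ → Q K′ → P K
    from rs with refl , ss ← pointwise-restrict rs = Q⇒P ss

  cnt-empty : ∀ {P : List A → Set} (P? : Decidable P) {S : A → Set} →
    (∀ {K} → All S K → ¬ P K) → ∀ {E} → All (S ∘ proj₁) E → ∀ i → cnt P? i E ≡ 0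
  cnt-empty P? ¬P []       zero with P? []
  ... | yes p = contradiction p (¬P [])
  ... | no _  = refl
  cnt-empty P? ¬P []       (suc i) = refl
  cnt-empty P? ¬P {(e , w) ∷ E} (s ∷ ss) i =
    cong₂ _+_ (cnt-empty _ (λ ss′ → ¬P (s ∷ ss′)) ss i)
              (≡-trans (cong (w *_) (prev-0 (cnt-empty P? ¬P ss) i)) (*-zeroʳ w))

  cnt-cong-P : ∀ {P Q : List A → Set} (P? : Decidable P) (Q? : Decidable Q) →
    (∀ {K} → P K → Q K) → (∀ {K} → Q K → P K) → ∀ E i → cnt P? i E ≡ cnt Q? i E
  cnt-cong-P P? Q? P⇒Q Q⇒P E = cnt-iff P? Q? (λ _ → P⇒Q) (λ _ → Q⇒P) (All.universal (λ _ → tt) E)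

  private
    regroup-swap : ∀ x a b c v w → x + v * a + w * (b + v * c) ≡ x + w * b + v * (a + w * c)
    regroup-swap = solve-∀

  -- In the case of a swap both sides expand into four terms, according to which of the two elements
  -- are removed; removing both yields the iterated `prev`, and the two mixed terms change places.
  cnt-↭ : ∀ {P : List A → Set} (P? : Decidable P) → (∀ {K K′} → K ↭ K′ → P K → P K′) →
    ∀ {E E′} → E ↭ E′ → ∀ i → cnt P? i E ≡ cnt P? i E′
  cnt-↭ P? resp refl i = refl
  cnt-↭ P? resp (prep (e , w) p) i =
    cong₂ _+_ (cnt-↭ _ (λ p → resp (prep e p)) p i) (cong (w *_) (prev-cong (cnt-↭ P? resp p) i))
  cnt-↭ P? resp (trans p q) i = ≡-trans (cnt-↭ P? resp p i) (cnt-↭ P? resp q i)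
  cnt-↭ P? resp {_ ∷ _ ∷ E} {_ ∷ _ ∷ E′} (swap (e , v) (f , w) p) i = begin
    cnt ef i E + w * prev (λ j → cnt e∷ j E) i + v * prev (λ j → cnt f∷ j E + w * prev (λ j → cnt P? j E) j) i
      ≡⟨ cong₂ _+_ (cong₂ _+_ step₁ (cong (w *_) (prev-cong step₂ i))) (cong (v *_) (≡-trans (prev-+* _ _ w i) (cong₂ _+_ (prev-cong step₃ i) (cong (w *_) (prev-cong (prev-cong step₄) i))))) ⟩
    cnt fe i E′ + w * prev (λ j → cnt e∷ j E′) i + v * (prev (λ j → cnt f∷ j E′) i + w * prev (prev (λ j → cnt P? j E′)) i)
      ≡⟨ regroup-swap (cnt fe i E′) (prev (λ j → cnt e∷ j E′) i) (prev (λ j → cnt f∷ j E′) i) (prev (prev (λ j → cnt P? j E′)) i) w v ⟩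
    cnt fe i E′ + v * prev (λ j → cnt f∷ j E′) i + w * (prev (λ j → cnt e∷ j E′) i + v * prev (prev (λ j → cnt P? j E′)) i)
      ≡⟨ cong (λ z → cnt fe i E′ + v * prev (λ j → cnt f∷ j E′) i + w * z) (prev-+* _ _ v i) ⟨
    cnt fe i E′ + v * prev (λ j → cnt f∷ j E′) i + w * prev (λ j → cnt e∷ j E′ + v * prev (λ j → cnt P? j E′) j) i ∎
    where
    open ≡-Reasoning
    e∷ = λ K → P? (e ∷ K)
    f∷ = λ K → P? (f ∷ K)
    ef = λ K → P? (e ∷ f ∷ K)
    fe = λ K → P? (f ∷ e ∷ K)
    step₁ : cnt ef i E ≡ cnt fe i E′
    step₁ = ≡-trans (cnt-↭ ef (λ p → resp (prep e (prep f p))) p i)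
                    (cnt-cong-P ef fe (resp (swap e f refl)) (resp (swap f e refl)) E′ i)
    step₂ : ∀ j → cnt e∷ j E ≡ cnt e∷ j E′
    step₂ = cnt-↭ e∷ (λ p → resp (prep e p)) p
    step₃ : ∀ j → cnt f∷ j E ≡ cnt f∷ j E′
    step₃ = cnt-↭ f∷ (λ p → resp (prep f p)) p
    step₄ : ∀ j → cnt P? j E ≡ cnt P? j E′
    step₄ = cnt-↭ P? resp p

  -- Bounds on the counts by power sums of the weights

  cnt₀-≤ : ∀ {P : List A → Set} (P? : Decidable P) E → cnt P? 0 E ≤ 1
  cnt₀-≤ P? [] with does (P? [])
  ... | true  = ≤-refl
  ... | false = z≤n
  cnt₀-≤ P? ((e , w) ∷ E) rewrite *-zeroʳ w | +-identityʳ (cnt (λ K → P? (e ∷ K)) 0 E) = cnt₀-≤ _ E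

  cnt₁-≤ : ∀ {P : List A → Set} (P? : Decidable P) E → cnt P? 1 E ≤ weight E
  cnt₁-≤ P? []            = z≤n
  cnt₁-≤ P? ((e , w) ∷ E) = begin
    cnt _ 1 E + w * cnt P? 0 E ≤⟨ +-mono-≤ (cnt₁-≤ _ E) (*-monoʳ-≤ w (cnt₀-≤ P? E)) ⟩
    weight E + w * 1           ≡⟨ cong (weight E +_) (*-identityʳ w) ⟩
    weight E + w               ≡⟨ +-comm (weight E) w ⟩
    w + weight E               ∎
    where open ≤-Reasoning

  private
    expand-square : ∀ c d q w → 2 * (c + w * d) + (w * w + q) ≡ (2 * c + q) + (w * w + 2 * w * d)
    expand-square = solve-∀
    collect-square : ∀ s w → s * s + (w * w + 2 * w * s) ≡ (w + s) * (w + s)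
    collect-square = solve-∀

  -- The second elementary symmetric polynomial of the weights is half of the squared sum minus the
  -- sum of squares, and requiring `P` can only drop terms. It is stated without subtraction or
  -- division.
  cnt₂-≤ : ∀ {P : List A → Set} (P? : Decidable P) E → 2 * cnt P? 2 E + weight² E ≤ weight E * weight E
  cnt₂-≤ P? []            = z≤n
  cnt₂-≤ P? ((e , w) ∷ E) = begin
    2 * (cnt e∷ 2 E + w * cnt P? 1 E) + (w * w + weight² E)
      ≡⟨ expand-square (cnt e∷ 2 E) (cnt P? 1 E) (weight² E) w ⟩
    (2 * cnt e∷ 2 E + weight² E) + (w * w + 2 * w * cnt P? 1 E)
      ≤⟨ +-mono-≤ (cnt₂-≤ _ E) (+-monoʳ-≤ (w * w) (*-monoʳ-≤ (2 * w) (cnt₁-≤ P? E))) ⟩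
    weight E * weight E + (w * w + 2 * w * weight E)
      ≡⟨ collect-square (weight E) w ⟩
    (w + weight E) * (w + weight E) ∎
    where
    open ≤-Reasoning
    e∷ = λ K → P? (e ∷ K)

  -- Weights are absent and the result is Boolean, so that for a concrete list of links it is
  -- settled by evaluation, whatever weights are attached later.
  survives : ∀ {P : List A → Set} → Decidable P → ℕ → List A → Bool
  survives P? zero    []      = does (P? [])
  survives P? (suc i) []      = true
  survives P? zero    (e ∷ E) = survives (λ K → P? (e ∷ K)) zero E
  survives P? (suc i) (e ∷ E) = survives (λ K → P? (e ∷ K)) (suc i) E ∧ survives P? i E

  survives₀ : ∀ {P : List A → Set} (P? : Decidable P) E → survives P? 0 (map proj₁ E) ≡ true → 1 ≤ cnt P? 0 E
  survives₀ P? [] ok with does (P? [])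
  ... | true = ≤-refl
  survives₀ P? ((e , w) ∷ E) ok = ≤-trans (survives₀ _ E ok) (m≤m+n _ _)

  survives₁ : ∀ {P : List A → Set} (P? : Decidable P) E → survives P? 1 (map proj₁ E) ≡ true → weight E ≤ cnt P? 1 E
  survives₁ P? []            ok = z≤n
  survives₁ P? ((e , w) ∷ E) ok with ok₁ , ok₀ ← ∧-true ok = begin
    w + weight E               ≡⟨ +-comm w (weight E) ⟩
    weight E + w               ≡⟨ cong (weight E +_) (*-identityʳ w) ⟨
    weight E + w * 1           ≤⟨ +-mono-≤ (survives₁ _ E ok₁) (*-monoʳ-≤ w (survives₀ P? E ok₀)) ⟩
    cnt _ 1 E + w * cnt P? 0 E ∎
    where open ≤-Reasoning

  -- The converse of `cnt₂-≤`: if every pair may be removed, no term of the symmetric polynomial is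
  -- lost.
  survives₂ : ∀ {P : List A → Set} (P? : Decidable P) E → survives P? 2 (map proj₁ E) ≡ true →
    weight E * weight E ≤ 2 * cnt P? 2 E + weight² E
  survives₂ P? []            ok = z≤n
  survives₂ P? ((e , w) ∷ E) ok with ok₂ , ok₁ ← ∧-true ok = begin
    (w + weight E) * (w + weight E)
      ≡⟨ collect-square (weight E) w ⟨
    weight E * weight E + (w * w + 2 * w * weight E)
      ≤⟨ +-mono-≤ (survives₂ _ E ok₂) (+-monoʳ-≤ (w * w) (*-monoʳ-≤ (2 * w) (survives₁ P? E ok₁))) ⟩
    (2 * cnt e∷ 2 E + weight² E) + (w * w + 2 * w * cnt P? 1 E)
      ≡⟨ expand-square (cnt e∷ 2 E) (cnt P? 1 E) (weight² E) w ⟨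
    2 * (cnt e∷ 2 E + w * cnt P? 1 E) + (w * w + weight² E) ∎
    where
    open ≤-Reasoning
    e∷ = λ K → P? (e ∷ K)

  weight-ones : (E : List A) → weight (ones E) ≡ length E
  weight-ones []      = refl
  weight-ones (_ ∷ E) = cong suc (weight-ones E)

  -- Each counted subfamily contributes a product of i weights, hence at most `c ^ i`; what remains
  -- is the unweighted count.
  cnt-bounded : ∀ {P : List A → Set} (P? : Decidable P) {c} {E : Weighted A} → All (λ e → proj₂ e ≤ c) E →
    ∀ i → cnt P? i E ≤ c ^ i * cnt P? i (ones (map proj₁ E))
  cnt-bounded P? {c} [] zero    = ≤-reflexive (sym (+-identityʳ _))
  cnt-bounded P? {c} [] (suc i) = z≤n
  cnt-bounded P? {c} {(e , w) ∷ E} (w≤c ∷ ws) zero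
    rewrite *-zeroʳ w | +-identityʳ (cnt (λ K → P? (e ∷ K)) 0 E) =
    ≤-trans (cnt-bounded _ ws 0) (+-monoˡ-≤ 0 (m≤m+n _ _))
  cnt-bounded P? {c} {(e , w) ∷ E} (w≤c ∷ ws) (suc i) = begin
    cnt e∷ (suc i) E + w * cnt P? i E         ≤⟨ +-mono-≤ (cnt-bounded e∷ ws (suc i)) (*-mono-≤ w≤c (cnt-bounded P? ws i)) ⟩
    c ^ suc i * x + c * (c ^ i * y)           ≡⟨ distribute c (c ^ i) x y ⟩
    c ^ suc i * (x + 1 * y)                   ∎
    where
    open ≤-Reasoning
    e∷ = λ K → P? (e ∷ K)
    x = cnt e∷ (suc i) (ones (map proj₁ E))
    y = cnt P? i (ones (map proj₁ E))
    distribute : ∀ c d x y → c * d * x + c * (d * y) ≡ c * d * (x + 1 * y)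
    distribute = solve-∀

-- Connectivity

Link : Set
Link = ℕ × ℕ

Mono : (ℕ → Bool) → Link → Set
Mono f (x , y) = f x ≡ f y

-- The graph obtained from (V , K) by identifying vertices with equal ρ-image is connected,
-- expressed by the absence of empty cuts.
ConnVia : (ℕ → ℕ) → List ℕ → List Link → Set
ConnVia ρ V K = (f : ℕ → Bool) → All (Mono (f ∘ ρ)) K → ∀ {u v} → u ∈ V → v ∈ V → f (ρ u) ≡ f (ρ v)

Conn : List ℕ → List Link → Set
Conn = ConnVia id

merge : ℕ → ℕ → ℕ → ℕ
merge a b x = if x ≡ᵇ b then a else x

≡ᵇ-refl : ∀ x → (x ≡ᵇ x) ≡ true
≡ᵇ-refl zero    = refl
≡ᵇ-refl (suc x) = ≡ᵇ-refl x

≢⇒≡ᵇ-false : ∀ {x y} → x ≢ y → (x ≡ᵇ y) ≡ false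
≢⇒≡ᵇ-false {x} {y} x≢y with x ≡ᵇ y | ≡ᵇ⇒≡ x y
... | true  | eq = contradiction (eq _) x≢y
... | false | _  = refl

merge-target : ∀ a b → merge a b b ≡ a
merge-target a b rewrite ≡ᵇ-refl b = refl

merge-other : ∀ a {b x} → x ≢ b → merge a b x ≡ x
merge-other a x≢b rewrite ≢⇒≡ᵇ-false x≢b = refl

merge-source : ∀ a b → merge a b a ≡ a
merge-source a b with a ≟ b
... | yes refl = merge-target a a
... | no a≢b   = merge-other a a≢b

absorb-merge : ∀ (f : ℕ → Bool) {a b} → f a ≡ f b → ∀ x → f (merge a b x) ≡ f x
absorb-merge f {a} {b} fa≡fb x with x ≟ b
... | yes refl = ≡-trans (cong f (merge-target a x)) fa≡fb
... | no x≢b   = cong f (merge-other a x≢b)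

-- Cuts that do not separate the ends of a kept link are exactly those that factor through its
-- contraction. Together with `conn-uncontract` this removes the links one at a time.
conn-contract : ∀ {ρ V a b K} → ConnVia ρ V ((a , b) ∷ K) → ConnVia (merge (ρ a) (ρ b) ∘ ρ) V K
conn-contract {ρ} {V} {a} {b} conn f mono =
  conn (f ∘ merge (ρ a) (ρ b)) (cong f (≡-trans (merge-source (ρ a) (ρ b)) (sym (merge-target (ρ a) (ρ b)))) ∷ mono)

conn-uncontract : ∀ {ρ V a b K} → ConnVia (merge (ρ a) (ρ b) ∘ ρ) V K → ConnVia ρ V ((a , b) ∷ K)
conn-uncontract {ρ} {V} {a} {b} conn f (eq ∷ mono) {u} {v} u∈V v∈V = begin
  f (ρ u)                       ≡⟨ absorb (ρ u) ⟨
  f (merge (ρ a) (ρ b) (ρ u))   ≡⟨ conn f (All.map (λ {(x , y)} fx≡fy → ≡-trans (absorb (ρ x)) (≡-trans fx≡fy (sym (absorb (ρ y))))) mono) u∈V v∈V ⟩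
  f (merge (ρ a) (ρ b) (ρ v))   ≡⟨ absorb (ρ v) ⟩
  f (ρ v)                       ∎
  where
  open ≡-Reasoning
  absorb = absorb-merge f eq

-- The hypothesis says that the indicator of the point `x`, used as a test cut throughout, does not
-- tell `x` and `y` apart.
separate : ∀ {x y} → (x ≡ᵇ x) ≡ (y ≡ᵇ x) → x ≡ y
separate {x} {y} eq with y ≟ x
... | yes refl = refl
... | no y≢x   = contradiction (≡-trans (sym (≡ᵇ-refl x)) (≡-trans eq (≢⇒≡ᵇ-false y≢x))) λ ()

-- The quantifier over all cuts disappears once every link has been contracted: what is left to
-- decide is whether all vertices have the same image.
connVia? : ∀ ρ V K → Dec (ConnVia ρ V K)
connVia? ρ []      [] = yes λ f _ ()
connVia? ρ (x ∷ V) [] = map′ to from (All.all? (λ y → ρ x ≟ ρ y) V)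
  where
  to : All (λ y → ρ x ≡ ρ y) V → ConnVia ρ (x ∷ V) []
  to eqs f _ u∈ v∈ = ≡-trans (toHead u∈) (sym (toHead v∈))
    where
    toHead : ∀ {u} → u ∈ x ∷ V → f (ρ u) ≡ f (ρ x)
    toHead (here refl) = refl
    toHead (there u∈)  = cong f (sym (All.lookup eqs u∈))
  from : ConnVia ρ (x ∷ V) [] → All (λ y → ρ x ≡ ρ y) V
  from conn = All.tabulate λ y∈V → separate (conn (_≡ᵇ ρ x) [] (here refl) (there y∈V))
connVia? ρ V ((a , b) ∷ K) = map′ conn-uncontract conn-contract (connVia? (merge (ρ a) (ρ b) ∘ ρ) V K)

conn? : ∀ V K → Dec (Conn V K)
conn? = connVia? id

conn-↭ : ∀ {V K K′} → K ↭ K′ → Conn V K → Conn V K′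
conn-↭ p conn f mono = conn f (↭.All-resp-↭ (↭-sym p) mono)

conn-⊆ : ∀ {V V′ K} → (∀ {v} → v ∈ V′ → v ∈ V) → Conn V K → Conn V′ K
conn-⊆ V′⊆V conn f mono u∈ v∈ = conn f mono (V′⊆V u∈) (V′⊆V v∈)

without : ℕ → List ℕ → List ℕ
without b = filter (λ x → ¬? (x ≟ b))

length-without : ∀ b {U} → Unique U → length U ≤ suc (length (without b U))
length-without b [] = z≤n
length-without b {x ∷ U} (x∉U ∷ uniq) with x ≡ᵇ b | ≡ᵇ⇒≡ x b
... | false | _  = s≤s (length-without b uniq)
... | true  | eq with refl ← eq _ = s≤s (≤-reflexive (cong length (sym (List.filter-all _ (All.map (λ x≢y y≡x → x≢y (sym y≡x)) x∉U)))))

Image : (ℕ → ℕ) → List ℕ → ℕ → Set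
Image ρ V u = ∃ λ v → v ∈ V × ρ v ≡ u

image-without : ∀ {ρ V} a b {U} → All (Image ρ V) U → All (Image (merge a b ∘ ρ) V) (without b U)
image-without {ρ} {V} a b {U} im = All.tabulate λ u∈ →
  let u∈U , u≢b = ∈.∈-filter⁻ (λ x → ¬? (x ≟ b)) u∈
      v , v∈V , ρv≡u = All.lookup im u∈U
  in v , v∈V , ≡-trans (cong (merge a b) ρv≡u) (merge-other a u≢b)

-- `U` lists distinct contracted vertices. Contracting a link removes at most one of them, and at
-- the end at most one may remain.
spanning-size : ∀ {ρ V} K {U} → Unique U → All (Image ρ V) U → ConnVia ρ V K → length U ≤ suc (length K)
spanning-size [] {[]} _ _ _ = z≤n
spanning-size [] {u ∷ []} _ _ _ = ≤-refl
spanning-size {ρ} [] {u₁ ∷ u₂ ∷ U} ((u₁≢u₂ ∷ _) ∷ _) ((v₁ , v₁∈ , refl) ∷ (v₂ , v₂∈ , refl) ∷ _) conn =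
  contradiction (separate (conn (_≡ᵇ ρ v₁) [] v₁∈ v₂∈)) u₁≢u₂
spanning-size {ρ} ((a , b) ∷ K) {U} uniq im conn = begin
  length U                           ≤⟨ length-without (ρ b) uniq ⟩
  suc (length (without (ρ b) U))     ≤⟨ s≤s (spanning-size K (Unique.filter⁺ _ uniq) (image-without (ρ a) (ρ b) im) (conn-contract conn)) ⟩
  suc (suc (length K))               ∎
  where open ≤-Reasoning

cnt-size-0 : ∀ {A : Set} {P : List A → Set} (P? : Decidable P) E i →
  (∀ K → length K + i ≡ length E → ¬ P K) → cnt P? i E ≡ 0
cnt-size-0 P? [] (suc i) ¬P = refl
cnt-size-0 P? [] zero    ¬P with P? []
... | yes p = contradiction p (¬P [] refl)
... | no _  = refl
cnt-size-0 P? ((e , w) ∷ E) i ¬P = cong₂ _+_ (cnt-size-0 _ E i λ K eq → ¬P (e ∷ K) (cong suc eq)) (deleted i ¬P)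
  where
  deleted : ∀ i → (∀ K → length K + i ≡ suc (length E) → _) → w * prev (λ j → cnt P? j E) i ≡ 0
  deleted zero    ¬P = *-zeroʳ w
  deleted (suc i) ¬P = ≡-trans (cong (w *_) (cnt-size-0 P? E i λ K eq → ¬P K (≡-trans (+-suc _ i) (cong suc eq)))) (*-zeroʳ w)

N : List ℕ → ℕ → Weighted Link → ℕ
N V = cnt (conn? V)

N-↭ : ∀ {V E E′} → E ↭ E′ → ∀ i → N V i E ≡ N V i E′
N-↭ {V} = cnt-↭ (conn? V) conn-↭

-- A connected remainder has at least `length V - 1` links; in corank 5 this makes the counts vanish
-- from index 6 on.
N-large : ∀ {V E i} → Unique V → suc (length E) < length V + i → N V i E ≡ 0
N-large {V} {E} {i} uniq lt = cnt-size-0 (conn? V) E i λ K eq conn → <-irrefl refl (begin-strict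
  suc (length E)       <⟨ lt ⟩
  length V + i         ≤⟨ +-monoˡ-≤ i (spanning-size K uniq (All.tabulate λ v∈ → _ , v∈ , refl) conn) ⟩
  suc (length K + i)   ≡⟨ cong suc eq ⟩
  suc (length E)       ∎)
  where open ≤-Reasoning

-- Spanning trees by contraction and deletion

-- Kept loops are discarded, so only removals down to a spanning tree are counted.
trees : (ℕ → ℕ) → ℕ → List Link → ℕ
keep  : (ℕ → ℕ) → ℕ → ℕ → ℕ → List Link → ℕ
trees ρ zero    []            = 1
trees ρ (suc i) []            = 0
trees ρ zero    ((a , b) ∷ E) = keep ρ (ρ a) (ρ b) zero E
trees ρ (suc i) ((a , b) ∷ E) = keep ρ (ρ a) (ρ b) (suc i) E + trees ρ i E
keep ρ a b i E = if a ≡ᵇ b then 0 else trees (λ x → merge a b (ρ x)) i E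

-- The size hypothesis says that after i removals at most `length U - 1` links are kept. By
-- `spanning-size` a kept loop would then leave too few other links to connect, so counting it as 0
-- loses nothing. `P` is general because it absorbs the links already kept, while `ρ` records their
-- contraction.
cnt-≤-trees : ∀ {P : List Link → Set} (P? : Decidable P) {ρ V} → (∀ K → P K → ConnVia ρ V K) →
  ∀ {U} → Unique U → All (Image ρ V) U → ∀ E i → suc (length E) ≤ length U + i →
  cnt P? i (ones E) ≤ trees ρ i E
keep-bound : ∀ {P : List Link → Set} (P? : Decidable P) {ρ V} a b → (∀ K → P K → ConnVia ρ V ((a , b) ∷ K)) →
  ∀ {U} → Unique U → All (Image ρ V) U → ∀ E i → suc (suc (length E)) ≤ length U + i →
  cnt P? i (ones E) ≤ keep ρ (ρ a) (ρ b) i E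
cnt-≤-trees P? P⇒ uniq im [] zero _ with does (P? [])
... | true  = ≤-refl
... | false = z≤n
cnt-≤-trees P? P⇒ uniq im [] (suc i) _ = z≤n
cnt-≤-trees P? P⇒ uniq im ((a , b) ∷ E) zero size
  rewrite +-identityʳ (cnt (λ K → P? ((a , b) ∷ K)) 0 (ones E)) =
  keep-bound (λ K → P? ((a , b) ∷ K)) a b (λ K → P⇒ ((a , b) ∷ K)) uniq im E zero size
cnt-≤-trees P? P⇒ {U} uniq im ((a , b) ∷ E) (suc i) size =
  +-mono-≤ (keep-bound (λ K → P? ((a , b) ∷ K)) a b (λ K → P⇒ ((a , b) ∷ K)) uniq im E (suc i) size)
           (≤-trans (≤-reflexive (*-identityˡ _))
                    (cnt-≤-trees P? P⇒ uniq im E i (≤-pred (subst (suc (suc (length E)) ≤_) (+-suc (length U) i) size))))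
keep-bound P? {ρ} a b P⇒ {U} uniq im E i size with ρ a ≡ᵇ ρ b | ≡ᵇ⇒≡ (ρ a) (ρ b)
... | true | eq = ≤-reflexive (cnt-size-0 P? (ones E) i λ K len PK → <-irrefl refl (begin-strict
  suc (length E)           <⟨ size ⟩
  length U + i             ≤⟨ +-monoˡ-≤ i (spanning-size K uniq im λ f mono → P⇒ K PK f (cong f (eq _) ∷ mono)) ⟩
  suc (length K + i)       ≡⟨ cong suc (≡-trans len (List.length-map (_, 1) E)) ⟩
  suc (length E)           ∎))
  where open ≤-Reasoning
... | false | _ = cnt-≤-trees P? (λ K PK → conn-contract (P⇒ K PK)) (Unique.filter⁺ _ uniq) (image-without (ρ a) (ρ b) im) E i
  (≤-pred (≤-trans size (+-monoˡ-≤ i (length-without (ρ b) uniq))))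

-- Bridge and series reductions

Avoids : ℕ → Link → Set
Avoids v (x , y) = x ≢ v × y ≢ v

module _ {v : ℕ} {V : List ℕ} (v∉V : v ∉ V) where

  ∈⇒≢ : ∀ {x} → x ∈ V → x ≢ v
  ∈⇒≢ x∈V refl = v∉V x∈V

  isolated : ∀ {a K} → a ∈ V → All (Avoids v) K → ¬ Conn (v ∷ V) K
  isolated a∈V avoid conn =
    ∈⇒≢ a∈V (sym (separate (conn (_≡ᵇ v) (All.map (λ (x≢ , y≢) → ≡-trans (≢⇒≡ᵇ-false x≢) (sym (≢⇒≡ᵇ-false y≢))) avoid) (here refl) (there a∈V))))

  mono-merge : ∀ (f : ℕ → Bool) a {K} → All (Avoids v) K → All (Mono f) K → All (Mono (f ∘ merge a v)) K
  mono-merge f a []                  []          = []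
  mono-merge f a ((x≢ , y≢) ∷ avoid) (eq ∷ mono) =
    ≡-trans (cong f (merge-other a x≢)) (≡-trans eq (cong f (sym (merge-other a y≢)))) ∷ mono-merge f a avoid mono

  -- A cut `f` of `V` becomes a cut of `v ∷ V` by giving `v` the value of its neighbour `a`, which
  -- is what composing with `merge a v` does.
  restrict : ∀ {a K K′} → (∀ f → All (Mono f) K′ → All (Mono (f ∘ merge a v)) K) → Conn (v ∷ V) K → Conn V K′
  restrict {a} lift conn f mono {x} {y} x∈ y∈ = begin
    f x              ≡⟨ cong f (merge-other a (∈⇒≢ x∈)) ⟨
    f (merge a v x)  ≡⟨ conn (f ∘ merge a v) (lift f mono) (there x∈) (there y∈) ⟩
    f (merge a v y)  ≡⟨ cong f (merge-other a (∈⇒≢ y∈)) ⟩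
    f y              ∎
    where open ≡-Reasoning

  -- In the other direction the links at `v` force its value to be that of `a`, so a cut of `v ∷ V`
  -- is determined by its restriction to `V`.
  extend : ∀ {a K K′} → a ∈ V → (∀ f → All (Mono f) K → f v ≡ f a × All (Mono f) K′) → Conn V K′ → Conn (v ∷ V) K
  extend {a} a∈ lower conn f mono = λ x∈ y∈ → ≡-trans (root x∈) (sym (root y∈))
    where
    root : ∀ {x} → x ∈ v ∷ V → f x ≡ f a
    root (here refl) = proj₁ (lower f mono)
    root (there x∈)  = conn f (proj₂ (lower f mono)) x∈ a∈

  mono-pendant : ∀ (f : ℕ → Bool) {a} → a ∈ V → Mono (f ∘ merge a v) (v , a)
  mono-pendant f {a} a∈ = cong f (≡-trans (merge-target a v) (sym (merge-other a (∈⇒≢ a∈))))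

  pendant⇒ : ∀ {a K} → a ∈ V → All (Avoids v) K → Conn (v ∷ V) ((v , a) ∷ K) → Conn V K
  pendant⇒ {a} a∈ avoid = restrict {a} λ f mono → mono-pendant f a∈ ∷ mono-merge f a avoid mono

  pendant⇐ : ∀ {a K} → a ∈ V → Conn V K → Conn (v ∷ V) ((v , a) ∷ K)
  pendant⇐ a∈ = extend a∈ λ { f (eq ∷ mono) → eq , mono }

  series⇒ : ∀ {a b K} → a ∈ V → b ∈ V → All (Avoids v) K → Conn (v ∷ V) ((v , a) ∷ (v , b) ∷ K) → Conn V ((a , b) ∷ K)
  series⇒ {a} {b} a∈ b∈ avoid = restrict {a} λ { f (eq ∷ mono) →
    mono-pendant f a∈ ∷ ≡-trans (cong f (merge-target a v)) (≡-trans eq (cong f (sym (merge-other a (∈⇒≢ b∈))))) ∷ mono-merge f a avoid mono }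

  series⇐ : ∀ {a b K} → a ∈ V → Conn V ((a , b) ∷ K) → Conn (v ∷ V) ((v , a) ∷ (v , b) ∷ K)
  series⇐ a∈ = extend a∈ λ { f (eq₁ ∷ eq₂ ∷ mono) → eq₁ , ≡-trans (sym eq₁) eq₂ ∷ mono }

  N-isolated : ∀ {a E} → a ∈ V → All (Avoids v ∘ proj₁) E → ∀ i → N (v ∷ V) i E ≡ 0
  N-isolated a∈ = cnt-empty (conn? (v ∷ V)) (isolated a∈)

  N-pendant : ∀ {a w E} → a ∈ V → All (Avoids v ∘ proj₁) E → ∀ i → N (v ∷ V) i (((v , a) , w) ∷ E) ≡ N V i E
  N-pendant {a} {w} {E} a∈ avoid i = begin
    cnt va i E + w * prev (λ j → N (v ∷ V) j E) i
      ≡⟨ cong₂ _+_ (cnt-iff va (conn? V) (pendant⇒ a∈) (λ _ → pendant⇐ a∈) avoid i) (cong (w *_) (prev-0 (N-isolated a∈ avoid) i)) ⟩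
    N V i E + w * 0
      ≡⟨ cong (N V i E +_) (*-zeroʳ w) ⟩
    N V i E + 0
      ≡⟨ +-identityʳ _ ⟩
    N V i E ∎
    where
    open ≡-Reasoning
    va = λ K → conn? (v ∷ V) ((v , a) ∷ K)

  -- With both links kept, they act as one link from `a` to `b`. With one removed, `v` is pendant
  -- and the merged link is gone; there are `w + w′` weighted ways to do this. With both removed,
  -- `v` is isolated and nothing is counted.
  N-series : ∀ {a b w w′ E} → a ∈ V → b ∈ V → All (Avoids v ∘ proj₁) E →
    ∀ i → N (v ∷ V) i (((v , a) , w) ∷ ((v , b) , w′) ∷ E) ≡ N V i (((a , b) , w + w′) ∷ E)
  N-series {a} {b} {w} {w′} {E} a∈ b∈ avoid i = begin
    cnt vab i E + w′ * prev (λ j → cnt va j E) i + w * prev (λ j → N (v ∷ V) j (((v , b) , w′) ∷ E)) i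
      ≡⟨ cong₂ _+_ (cong₂ _+_ (cnt-iff vab (λ K → conn? V ((a , b) ∷ K)) (series⇒ a∈ b∈) (λ _ → series⇐ a∈) avoid i)
                              (cong (w′ *_) (prev-cong (cnt-iff va (conn? V) (pendant⇒ a∈) (λ _ → pendant⇐ a∈) avoid) i)))
                   (cong (w *_) (prev-cong (N-pendant {w = w′} b∈ avoid) i)) ⟩
    x + w′ * y + w * y
      ≡⟨ regroup x y w w′ ⟩
    x + (w + w′) * y ∎
    where
    open ≡-Reasoning
    vab = λ K → conn? (v ∷ V) ((v , a) ∷ (v , b) ∷ K)
    va = λ K → conn? (v ∷ V) ((v , a) ∷ K)
    x = cnt (λ K → conn? V ((a , b) ∷ K)) i E
    y = prev (λ j → N V j E) i
    regroup : ∀ x y w w′ → x + w′ * y + w * y ≡ x + (w + w′) * y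
    regroup = solve-∀

-- Reduction to a graph of minimum degree three

links : Weighted Link → List Link
links = map proj₁

links-ones : ∀ K → links (ones K) ≡ K
links-ones []      = refl
links-ones (e ∷ K) = cong (e ∷_) (links-ones K)

infix 4 _≈_
-- Links are ordered pairs, so equality of undirected weighted multigraphs must allow reordering and
-- reversal.
data _≈_ : Weighted Link → Weighted Link → Set where
  perm  : ∀ {E E′} → E ↭ E′ → E ≈ E′
  flip  : ∀ {x y w E} → ((x , y) , w) ∷ E ≈ ((y , x) , w) ∷ E
  trans : ∀ {E F G} → E ≈ F → F ≈ G → E ≈ G

≈-prep : ∀ e {E F} → E ≈ F → e ∷ E ≈ e ∷ F
≈-prep e (perm p)    = perm (prep e p)
≈-prep e flip        = trans (perm (swap _ _ refl)) (trans flip (perm (swap _ _ refl)))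
≈-prep e (trans p q) = trans (≈-prep e p) (≈-prep e q)

occ : ℕ → ℕ → ℕ
occ x v = if x ≡ᵇ v then 1 else 0

-- A loop at `v` counts twice, in accordance with the handshake identity.
deg : ℕ → List Link → ℕ
deg v []            = 0
deg v ((x , y) ∷ K) = occ x v + (occ y v + deg v K)

private
  exchange : ∀ a b c d e → a + (b + (c + (d + e))) ≡ c + (d + (a + (b + e)))
  exchange = solve-∀
  exchange′ : ∀ a b e → a + (b + e) ≡ b + (a + e)
  exchange′ = solve-∀

deg-↭ : ∀ v {K K′} → K ↭ K′ → deg v K ≡ deg v K′
deg-↭ v refl             = refl
deg-↭ v (prep (x , y) p) = cong (λ d → occ x v + (occ y v + d)) (deg-↭ v p)
deg-↭ v (swap (x , y) (x′ , y′) p) =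
  ≡-trans (cong (λ d → occ x v + (occ y v + (occ x′ v + (occ y′ v + d)))) (deg-↭ v p))
          (exchange (occ x v) (occ y v) (occ x′ v) (occ y′ v) _)
deg-↭ v (trans p q)      = ≡-trans (deg-↭ v p) (deg-↭ v q)

deg-≈ : ∀ v {E E′} → E ≈ E′ → deg v (links E) ≡ deg v (links E′)
deg-≈ v (perm p)           = deg-↭ v (↭.map⁺ proj₁ p)
deg-≈ v (flip {x} {y})     = exchange′ (occ x v) (occ y v) _
deg-≈ v (trans p q)        = ≡-trans (deg-≈ v p) (deg-≈ v q)

occ-refl : ∀ v → occ v v ≡ 1
occ-refl v rewrite ≡ᵇ-refl v = refl

occ-≢ : ∀ {x v} → x ≢ v → occ x v ≡ 0
occ-≢ x≢v rewrite ≢⇒≡ᵇ-false x≢v = refl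

weight-↭ : ∀ {E E′ : Weighted Link} → E ↭ E′ → weight E ≡ weight E′
weight-↭ refl                       = refl
weight-↭ (prep (_ , w) p)           = cong (w +_) (weight-↭ p)
weight-↭ (swap (_ , w) (_ , w′) p)  = ≡-trans (cong (λ s → w + (w′ + s)) (weight-↭ p)) (exchange′ w w′ _)
weight-↭ (trans p q)                = ≡-trans (weight-↭ p) (weight-↭ q)

weight-≈ : ∀ {E E′} → E ≈ E′ → weight E ≡ weight E′
weight-≈ (perm p)    = weight-↭ p
weight-≈ flip        = refl
weight-≈ (trans p q) = ≡-trans (weight-≈ p) (weight-≈ q)

length-≈ : ∀ {E E′} → E ≈ E′ → length E ≡ length E′
length-≈ (perm p)    = ↭.↭-length p
length-≈ flip        = refl
length-≈ (trans p q) = ≡-trans (length-≈ p) (length-≈ q)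

conn-flip : ∀ {V x y K} → Conn V ((x , y) ∷ K) → Conn V ((y , x) ∷ K)
conn-flip conn f (eq ∷ mono) = conn f (sym eq ∷ mono)

conn-≈ : ∀ {V E E′} → E ≈ E′ → Conn V (links E) → Conn V (links E′)
conn-≈ (perm p)    conn = conn-↭ (↭.map⁺ proj₁ p) conn
conn-≈ flip        conn = conn-flip conn
conn-≈ (trans p q) conn = conn-≈ q (conn-≈ p conn)

N-≈ : ∀ {V E E′} → E ≈ E′ → ∀ i → N V i E ≡ N V i E′
N-≈ (perm p)    i = N-↭ p i
N-≈ {V} (flip {x} {y} {w} {E}) i =
  cong (_+ w * prev (λ j → N V j E) i)
       (cnt-cong-P (λ K → conn? V ((x , y) ∷ K)) (λ K → conn? V ((y , x) ∷ K)) conn-flip conn-flip E i)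
N-≈ (trans p q) i = ≡-trans (N-≈ p i) (N-≈ q i)

Within : List ℕ → Link → Set
Within V (x , y) = x ∈ V × y ∈ V

within-≈ : ∀ {V E E′} → E ≈ E′ → All (Within V) (links E) → All (Within V) (links E′)
within-≈ (perm p)    ws              = ↭.All-resp-↭ (↭.map⁺ proj₁ p) ws
within-≈ flip        ((x∈ , y∈) ∷ ws) = (y∈ , x∈) ∷ ws
within-≈ (trans p q) ws              = within-≈ q (within-≈ p ws)

star : ℕ → Weighted ℕ → Weighted Link
star v = map λ (a , w) → (v , a) , w

-- A loop at `v` appears as a spoke ending in `v` itself, so the case analysis on spokes has to
-- treat it.
record Star (v : ℕ) (E : Weighted Link) : Set where
  constructor mkStar
  field
    spokes : Weighted ℕ
    others : Weighted Link
    splits : E ≈ star v spokes ++ others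
    avoids : All (Avoids v) (links others)

starAt : ∀ v E → Star v E
starAt v [] = mkStar [] [] (perm refl) []
starAt v (((x , y) , w) ∷ E) with starAt v E | x ≟ v | y ≟ v
... | mkStar I O p av | yes refl | _        = mkStar ((y , w) ∷ I) O (≈-prep _ p) av
... | mkStar I O p av | no _     | yes refl = mkStar ((x , w) ∷ I) O (trans flip (≈-prep _ p)) av
... | mkStar I O p av | no x≢v   | no y≢v   =
  mkStar I (((x , y) , w) ∷ O) (trans (≈-prep _ p) (perm (↭-sym (↭.shift _ (star v I) O)))) ((x≢v , y≢v) ∷ av)

-- The invariants of the reduction. Every reduction step deletes one vertex and lowers the number of
-- links by one, which preserves corank 5.
record Frame (V : List ℕ) (E : Weighted Link) : Set where
  field
    unique    : Unique V
    connected : Conn V (links E)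
    within    : All (Within V) (links E)
    corank    : length E ≡ length V + 4

frame-≈ : ∀ {V E E′} → E ≈ E′ → Frame V E → Frame V E′
frame-≈ p fr = record
  { unique    = Frame.unique fr
  ; connected = conn-≈ p (Frame.connected fr)
  ; within    = within-≈ p (Frame.within fr)
  ; corank    = ≡-trans (sym (length-≈ p)) (Frame.corank fr)
  }

frame-↭ : ∀ {V V′ E} → V ↭ V′ → Frame V E → Frame V′ E
frame-↭ p fr = record
  { unique    = Permutation.Unique-resp-↭ (↭⇒↭ₛ p) (Frame.unique fr)
  ; connected = conn-⊆ (↭.∈-resp-↭ (↭-sym p)) (Frame.connected fr)
  ; within    = All.map (λ (x∈ , y∈) → ↭.∈-resp-↭ p x∈ , ↭.∈-resp-↭ p y∈) (Frame.within fr)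
  ; corank    = ≡-trans (Frame.corank fr) (cong (_+ 4) (↭.↭-length p))
  }

N-V↭ : ∀ {V V′} → V ↭ V′ → ∀ i E → N V i E ≡ N V′ i E
N-V↭ p i E = cnt-cong-P (conn? _) (conn? _) (conn-⊆ (↭.∈-resp-↭ (↭-sym p))) (conn-⊆ (↭.∈-resp-↭ p)) E i

-- Counts may grow: the weight of a suppressed bridge is shifted to another link to keep the total
-- fixed. Upper bounds on the reduced counts therefore carry over to the original graph.
record Dominates (V : List ℕ) (E : Weighted Link) (V′ : List ℕ) (E′ : Weighted Link) : Set where
  field
    weights : weight E′ ≡ weight E
    counts  : ∀ i → N V i E ≤ N V′ i E′

dominates-trans : ∀ {V E V′ E′ V″ E″} → Dominates V E V′ E′ → Dominates V′ E′ V″ E″ → Dominates V E V″ E″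
dominates-trans d d′ = record
  { weights = ≡-trans (Dominates.weights d′) (Dominates.weights d)
  ; counts  = λ i → ≤-trans (Dominates.counts d i) (Dominates.counts d′ i)
  }

within-tail : ∀ {v V K} → All (Avoids v) K → All (Within (v ∷ V)) K → All (Within V) K
within-tail [] [] = []
within-tail ((x≢v , y≢v) ∷ av) ((x∈ , y∈) ∷ ws) = (drop x≢v x∈ , drop y≢v y∈) ∷ within-tail av ws
  where
  drop : ∀ {x v V} → x ≢ v → x ∈ v ∷ V → x ∈ V
  drop x≢v (here x≡v) = contradiction x≡v x≢v
  drop x≢v (there x∈) = x∈

private
  regroup-weights : ∀ w w′ s → (w + w′) + s ≡ w + (w′ + s)
  regroup-weights = solve-∀

  thrice : ∀ {v a b} d → ¬ (occ v v + (a + (occ v v + (b + (occ v v + d)))) < 3)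
  thrice {v} {a} {b} d lt rewrite occ-refl v | +-suc a (b + suc d) | +-suc b d | +-suc a (b + d) = contradiction lt λ { (s≤s (s≤s (s≤s ()))) }

-- The cases are by the number of spokes. No spoke, or a single loop, cuts `v` off from the rest;
-- one proper spoke is a bridge; two proper spokes are joined in series. A loop together with a
-- further spoke, or three spokes, already contradicts degree below three.
reduceAt : ∀ {v V E} → Frame (v ∷ V) E → deg v (links E) < 3 →
  ∃ λ E′ → Frame V E′ × Dominates (v ∷ V) E V E′
reduceAt {v} {V} {E} fr₀ low₀ with starAt v E
... | mkStar I O p av = go I (frame-≈ p fr₀) (subst (_< 3) (deg-≈ v p) low₀)
                             (record { weights = sym (weight-≈ p) ; counts = λ i → ≤-reflexive (N-≈ p i) })
  where
  v∉V : v ∉ V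
  v∉V = Unique.Unique[x∷xs]⇒x∉xs (Frame.unique fr₀)

  uniqV : Unique V
  uniqV with _ ∷ u ← Frame.unique fr₀ = u

  -- `isolated` needs a vertex other than `v`. An end of a link away from `v` serves, and the corank
  -- guarantees that such a link exists.
  notIsolated : ∀ O {K} → All (Avoids v) (links O) → All (Within (v ∷ V)) (links O) → 1 ≤ length O →
    (∀ f → All (Mono f) (links O) → All (Mono f) K) → ¬ Conn (v ∷ V) K
  notIsolated (e ∷ O) av ws _ lift conn with (x∈ , _) ∷ _ ← within-tail av ws =
    isolated v∉V x∈ av λ f mono → conn f (lift f mono)

  go : ∀ I → Frame (v ∷ V) (star v I ++ O) → deg v (links (star v I ++ O)) < 3 →
    Dominates (v ∷ V) E (v ∷ V) (star v I ++ O) → ∃ λ E′ → Frame V E′ × Dominates (v ∷ V) E V E′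
  go [] fr low dom = ⊥-elim (notIsolated O av (Frame.within fr)
    (≤-trans (s≤s z≤n) (≤-reflexive (sym (Frame.corank fr)))) (λ f mono → mono) (Frame.connected fr))
  go ((a , w) ∷ []) fr low dom with Frame.within fr
  ... | (_ , here refl) ∷ ws = ⊥-elim (notIsolated O av ws
    (≤-trans (s≤s z≤n) (≤-trans (m≤n+m 4 (length V)) (≤-reflexive (suc-injective (sym (Frame.corank fr)))))) (λ f mono → refl ∷ mono) (Frame.connected fr))
  ... | (_ , there a∈) ∷ ws = bridge O av ws (Frame.connected fr) (Frame.corank fr) dom
    where
    -- A bridge is never removed, so its weight may be moved to another link to keep the total.
    bridge : ∀ O → All (Avoids v) (links O) → All (Within (v ∷ V)) (links O) → Conn (v ∷ V) ((v , a) ∷ links O) →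
      suc (length O) ≡ suc (length V + 4) → Dominates (v ∷ V) E (v ∷ V) (((v , a) , w) ∷ O) →
      ∃ λ E′ → Frame V E′ × Dominates (v ∷ V) E V E′
    bridge [] _ _ _ cr _ = contradiction (suc-injective cr) λ eq → contradiction (≤-trans (m≤n+m 4 (length V)) (≤-reflexive (sym eq))) λ ()
    bridge ((e , w′) ∷ O′) av ws conn cr dom = ((e , w + w′) ∷ O′) ,
      record { unique = uniqV ; connected = pendant⇒ v∉V a∈ av conn ; within = within-tail av ws ; corank = suc-injective cr } ,
      dominates-trans dom (record
        { weights = regroup-weights w w′ (weight O′)
        ; counts  = λ i → ≤-trans (≤-reflexive (N-pendant v∉V {w = w} {E = (e , w′) ∷ O′} a∈ (All.map⁻ av) i))
                                  (+-monoʳ-≤ (cnt (λ K → conn? V (e ∷ K)) i O′) (*-monoˡ-≤ (prev (λ j → N V j O′) i) (m≤n+m w′ w)))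
        })
  go ((a , w) ∷ (b , w′) ∷ []) fr low dom with Frame.within fr
  ... | (_ , here refl) ∷ _ ∷ _ = contradiction low (thrice {v} {0} {0} (occ b v + deg v (links O)))
  ... | (_ , there a∈) ∷ (_ , here refl) ∷ _ = contradiction low (thrice {v} {occ a v} {0} (deg v (links O)))
  ... | (_ , there a∈) ∷ (_ , there b∈) ∷ ws = (((a , b) , w + w′) ∷ O) ,
      record { unique = uniqV ; connected = series⇒ v∉V a∈ b∈ av (Frame.connected fr)
             ; within = (a∈ , b∈) ∷ within-tail av ws ; corank = suc-injective (Frame.corank fr) } ,
      dominates-trans dom (record
        { weights = regroup-weights w w′ (weight O)
        ; counts  = λ i → ≤-reflexive (N-series v∉V {w = w} {w′ = w′} {E = O} a∈ b∈ (All.map⁻ av) i)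
        })
  go ((a , w) ∷ (b , w′) ∷ (c , w″) ∷ I) fr low dom = contradiction low (thrice {v} {occ a v} {occ b v} _)

Cubic≥ : List ℕ → Weighted Link → Set
Cubic≥ V E = All (λ v → 3 ≤ deg v (links E)) V

reduce : ∀ n {V E} → length V ≡ n → Frame V E →
  ∃ λ V′ → ∃ λ E′ → Frame V′ E′ × Cubic≥ V′ E′ × Dominates V E V′ E′
reduce n {V} {E} len fr with All.all? (λ v → 3 ≤? deg v (links E)) V
... | yes all≥ = V , E , fr , all≥ , record { weights = refl ; counts = λ _ → ≤-refl }
... | no ¬all with v , v∈ , low ← find (All.¬All⇒Any¬ (λ v → 3 ≤? deg v (links E)) V ¬all) 
              with ys , zs , refl ← ∈.∈-∃++ v∈ = descend n len
  where
  p : ys ++ v ∷ zs ↭ v ∷ ys ++ zs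
  p = ↭.shift v ys zs
  descend : ∀ n → length V ≡ n → ∃ λ V′ → ∃ λ E′ → Frame V′ E′ × Cubic≥ V′ E′ × Dominates V E V′ E′
  descend zero    len = contradiction (≡-trans (sym (↭.↭-length p)) len) λ ()
  descend (suc n) len with E₁ , fr₁ , dom₁ ← reduceAt (frame-↭ p fr) (≰⇒> low)
                   with V₂ , E₂ , fr₂ , cub , dom₂ ← reduce n (suc-injective (≡-trans (sym (↭.↭-length p)) len)) fr₁ =
    V₂ , E₂ , fr₂ , cub , dominates-trans (record { weights = refl ; counts = λ i → ≤-reflexive (N-V↭ p i E) }) (dominates-trans dom₁ dom₂)

-- Degree sums and the bound of eight vertices

degSum : List ℕ → List Link → ℕ
degSum V K = sum (map (λ v → deg v K) V)

private
  occSum : ℕ → List ℕ → ℕ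
  occSum x V = sum (map (occ x) V)

  occSum-∉ : ∀ {x V} → All (x ≢_) V → occSum x V ≡ 0
  occSum-∉ []         = refl
  occSum-∉ (x≢ ∷ x∉) = cong₂ _+_ (occ-≢ x≢) (occSum-∉ x∉)

  occSum-∈ : ∀ {x V} → Unique V → x ∈ V → occSum x V ≡ 1
  occSum-∈ {x} (x∉ ∷ _) (here refl) = cong₂ _+_ (occ-refl x) (occSum-∉ x∉)
  occSum-∈ {x} {y ∷ _} (y∉ ∷ u) (there x∈) = cong₂ _+_ (occ-≢ {x} {y} λ { refl → All.lookup y∉ x∈ refl }) (occSum-∈ u x∈)

  degSum-∷ : ∀ x y V K → degSum V ((x , y) ∷ K) ≡ occSum x V + (occSum y V + degSum V K)
  degSum-∷ x y []      K = refl
  degSum-∷ x y (v ∷ V) K = ≡-trans (cong ((occ x v + (occ y v + deg v K)) +_) (degSum-∷ x y V K))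
    (interchange (occ x v) (occ y v) (deg v K) (occSum x V) (occSum y V) (degSum V K))
    where
    interchange : ∀ a b c d e f → a + (b + c) + (d + (e + f)) ≡ a + d + (b + e + (c + f))
    interchange = solve-∀

handshake : ∀ {V K} → Unique V → All (Within V) K → degSum V K ≡ 2 * length K
handshake {V} {[]} u [] = degSum-[] V
  where
  degSum-[] : ∀ V → degSum V [] ≡ 0
  degSum-[] []      = refl
  degSum-[] (v ∷ V) = degSum-[] V
handshake {V} {(x , y) ∷ K} u ((x∈ , y∈) ∷ ws) = begin
  degSum V ((x , y) ∷ K)                  ≡⟨ degSum-∷ x y V K ⟩
  occSum x V + (occSum y V + degSum V K)  ≡⟨ cong₂ _+_ (occSum-∈ u x∈) (cong₂ _+_ (occSum-∈ u y∈) (handshake u ws)) ⟩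
  2 + 2 * length K                        ≡⟨ *-suc 2 (length K) ⟨
  2 * suc (length K)                      ∎
  where open ≡-Reasoning

module _ {f : ℕ → ℕ} {c : ℕ} where

  sum-≥ : ∀ {V} → All (λ v → c ≤ f v) V → length V * c ≤ sum (map f V)
  sum-≥ []         = z≤n
  sum-≥ (c≤ ∷ cs) = +-mono-≤ c≤ (sum-≥ cs)

  sum-tight : ∀ {V} → All (λ v → c ≤ f v) V → sum (map f V) ≤ length V * c → All (λ v → f v ≡ c) V
  sum-tight []         _ = []
  sum-tight {v ∷ V} (c≤ ∷ cs) le =
    ≤-antisym (+-cancelʳ-≤ (length V * c) (f v) c (≤-trans (+-monoʳ-≤ (f v) (sum-≥ cs)) le)) c≤
    ∷ sum-tight cs (+-cancelˡ-≤ c _ _ (≤-trans (+-monoˡ-≤ _ c≤) le))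

frame-handshake : ∀ {V E} → Frame V E → degSum V (links E) ≡ 2 * (length V + 4)
frame-handshake {V} {E} fr = ≡-trans (handshake (Frame.unique fr) (Frame.within fr))
  (cong (2 *_) (≡-trans (List.length-map proj₁ E) (Frame.corank fr)))

order≤8 : ∀ {V E} → Frame V E → Cubic≥ V E → length V ≤ 8
order≤8 {V} {E} fr cub = +-cancelʳ-≤ (2 * length V) (length V) 8 (begin
  length V + 2 * length V  ≡⟨ *-comm 3 (length V) ⟩
  length V * 3             ≤⟨ sum-≥ cub ⟩
  degSum V (links E)       ≡⟨ frame-handshake fr ⟩
  2 * (length V + 4)       ≡⟨ *-distribˡ-+ 2 (length V) 4 ⟩
  2 * length V + 8         ≡⟨ +-comm (2 * length V) 8 ⟩
  8 + 2 * length V         ∎)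
  where open ≤-Reasoning

-- Eight vertices make the degree sum 24, so the lower bound 3 is attained at every vertex.
order8⇒cubic : ∀ {V E} → Frame V E → Cubic≥ V E → length V ≡ 8 → All (λ v → deg v (links E) ≡ 3) V
order8⇒cubic {V} {E} fr cub eq = sum-tight cub (≤-reflexive (≡-trans (frame-handshake fr)
  (≡-trans (cong (λ k → 2 * (k + 4)) eq) (cong (_* 3) (sym eq)))))

-- Exhaustion of the cubic multigraphs on eight vertices

-- Vertices are labelled in order of discovery: the next link always leaves the first label of
-- degree below three, and ends in an already used label or in the first unused one.
check : ℕ → List Link → ℕ → Bool
row   : ℕ → List Link → ℕ → ℕ → ℕ → Bool
cols  : ℕ → List Link → ℕ → ℕ → ℕ → ℕ → Bool
check zero    D k = (8 ≤ᵇ k) ∧ (trees id 5 D ≤ᵇ 392)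
check (suc r) D k = row r D k k 0
row r D k zero    i = true
row r D k (suc f) i =
  if deg i D <ᵇ 3
  then cols r D k i k 0 ∧ (if k <ᵇ 8 then check r ((i , k) ∷ D) (suc k) else true)
  else row r D k f (suc i)
cols r D k i zero    j = true
cols r D k i (suc f) j =
  (if deg j ((i , j) ∷ D) <ᵇ 4 then check r ((i , j) ∷ D) k else true) ∧ cols r D k i f (suc j)

-- Settled by evaluation. With twelve links and all degrees at most three at least eight labels are
-- in use, so the test `8 ≤ᵇ k` at the leaves succeeds. Branches in which all used labels are
-- saturated too early are accepted unseen; `saturated⇒complete` shows that no connected multigraph
-- leads there.
exhaustion : check 12 [] 1 ≡ true
exhaustion = refl

≤ᵇ-true : ∀ {m n} → (m ≤ᵇ n) ≡ true → m ≤ n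
≤ᵇ-true {m} {n} eq = ≤ᵇ⇒≤ m n (subst T (sym eq) tt)

<ᵇ-true : ∀ {m n} → (m <ᵇ n) ≡ true → m < n
<ᵇ-true {m} {n} eq = <ᵇ⇒< m n (subst T (sym eq) tt)

<⇒<ᵇ-true : ∀ {m n} → m < n → (m <ᵇ n) ≡ true
<⇒<ᵇ-true {m} {n} lt with m <ᵇ n | <⇒<ᵇ lt
... | true | _ = refl

<ᵇ-false : ∀ {m n} → (m <ᵇ n) ≡ false → n ≤ m
<ᵇ-false {m} {n} eq = ≮⇒≥ λ lt → contradiction (≡-trans (sym eq) (<⇒<ᵇ-true lt)) λ ()

unique-length : ∀ {xs ys : List ℕ} → Unique xs → All (_∈ ys) xs → length xs ≤ length ys
unique-length [] [] = z≤n
unique-length {x ∷ xs} (x∉ ∷ uniq) (x∈ ∷ xs⊆) with us , vs , refl ← ∈.∈-∃++ x∈ = begin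
  suc (length xs)              ≤⟨ s≤s (unique-length uniq (All.tabulate λ y∈ → drop (All.lookup x∉ y∈) (↭.∈-resp-↭ (↭.shift x us vs) (All.lookup xs⊆ y∈)))) ⟩
  suc (length (us ++ vs))      ≡⟨ ↭.↭-length (↭.shift x us vs) ⟨
  length (us ++ x ∷ vs)        ∎
  where
  open ≤-Reasoning
  drop : ∀ {y zs} → x ≢ y → y ∈ x ∷ zs → y ∈ zs
  drop x≢y (here y≡x) = contradiction (sym y≡x) x≢y
  drop x≢y (there y∈) = y∈

deg-++ : ∀ v K K′ → deg v (K ++ K′) ≡ deg v K + deg v K′
deg-++ v []            K′ = refl
deg-++ v ((x , y) ∷ K) K′ = ≡-trans (cong (λ d → occ x v + (occ y v + d)) (deg-++ v K K′)) (assoc (occ x v) (occ y v) _ _)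
  where
  assoc : ∀ a b c d → a + (b + (c + d)) ≡ a + (b + c) + d
  assoc = solve-∀

pick : ∀ x K → 0 < deg x K → ∃ λ y → ∃ λ K′ → ones K ≈ ones ((x , y) ∷ K′)
pick x ((a , b) ∷ K) pos with a ≟ x | b ≟ x
... | yes refl | _        = b , K , perm refl
... | no _     | yes refl = a , K , flip
... | no a≢x   | no b≢x
  with y , K′ , p ← pick x K (subst (0 <_) (cong₂ _+_ (occ-≢ a≢x) (cong (_+ deg x K) (occ-≢ b≢x))) pos) =
  y , (a , b) ∷ K′ , trans (≈-prep _ p) (perm (swap _ _ refl))

deg-∈ˡ : ∀ {x y K} → (x , y) ∈ K → 0 < deg x K
deg-∈ˡ {x} (here refl) rewrite occ-refl x = s≤s z≤n
deg-∈ˡ {x} {K = (a , b) ∷ K} (there e∈) = ≤-trans (deg-∈ˡ e∈) (≤-trans (m≤n+m _ (occ b x)) (m≤n+m _ (occ a x)))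

deg-∈ʳ : ∀ {x y K} → (x , y) ∈ K → 0 < deg y K
deg-∈ʳ {x} {y} (here refl) rewrite occ-refl y = ≤-trans (s≤s z≤n) (m≤n+m _ (occ x y))
deg-∈ʳ {y = y} {K = (a , b) ∷ K} (there e∈) = ≤-trans (deg-∈ʳ e∈) (≤-trans (m≤n+m _ (occ b y)) (m≤n+m _ (occ a y)))

≈-++ˡ : ∀ F {E E′} → E ≈ E′ → F ++ E ≈ F ++ E′
≈-++ˡ []      p = p
≈-++ˡ (e ∷ F) p = ≈-prep e (≈-++ˡ F p)

-- Following a given cubic multigraph through the search

relabel : (ℕ → ℕ) → Link → Link
relabel ρ (x , y) = ρ x , ρ y

Below : ℕ → Link → Set
Below k (x , y) = x < k × y < k

record Cubic (V : List ℕ) (K : List Link) : Set where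
  field
    frame  : Frame V (ones K)
    degree : All (λ v → deg v K ≡ 3) V

cubic-≈ : ∀ {V K K′} → ones K ≈ ones K′ → Cubic V K → Cubic V K′
cubic-≈ {K = K} {K′} p c = record
  { frame  = frame-≈ p (Cubic.frame c)
  ; degree = All.map (λ {v} eq → ≡-trans (sym (≡-trans (cong (deg v) (sym (links-ones K))) (≡-trans (deg-≈ v p) (cong (deg v) (links-ones K′))))) eq) (Cubic.degree c)
  }

module _ {V : List ℕ} (order : length V ≡ 8) where

  -- A state of the search matched with a given multigraph: `D` holds the links already discovered,
  -- written in labels, and `K` those still to come, written in vertices. `lab` sends the labels
  -- below `k` to vertices, and `idx` inverts it there.
  record Partial (D : List Link) (k : ℕ) (lab idx : ℕ → ℕ) (K : List Link) : Set where
    field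
      below   : All (Below k) D
      inverse : ∀ {i} → i < k → idx (lab i) ≡ i
      labels  : ∀ {i} → i < k → lab i ∈ V
      start   : 0 < k
      cubic   : Cubic V (map (relabel lab) D ++ K)

  module _ {D : List Link} {k : ℕ} {lab idx : ℕ → ℕ} {K : List Link} (part : Partial D k lab idx K) where
    open Partial part

    occ-lab : ∀ {a i} → a < k → i < k → occ (lab a) (lab i) ≡ occ a i
    occ-lab {a} {i} a<k i<k with a ≟ i
    ... | yes refl = ≡-trans (occ-refl (lab a)) (sym (occ-refl a))
    ... | no a≢i   = ≡-trans (occ-≢ λ eq → a≢i (≡-trans (sym (inverse a<k)) (≡-trans (cong idx eq) (inverse i<k)))) (sym (occ-≢ a≢i))

    deg-lab : ∀ {i} → i < k → ∀ {D} → All (Below k) D → deg (lab i) (map (relabel lab) D) ≡ deg i D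
    deg-lab i<k []                = refl
    deg-lab i<k ((a<k , b<k) ∷ bs) = cong₂ _+_ (occ-lab a<k i<k) (cong₂ _+_ (occ-lab b<k i<k) (deg-lab i<k bs))

    deg-total : ∀ {i} → i < k → deg i D + deg (lab i) K ≡ 3
    deg-total {i} i<k = begin
      deg i D + deg (lab i) K                          ≡⟨ cong (_+ deg (lab i) K) (deg-lab i<k below) ⟨
      deg (lab i) (map (relabel lab) D) + deg (lab i) K ≡⟨ deg-++ (lab i) (map (relabel lab) D) K ⟨
      deg (lab i) (map (relabel lab) D ++ K)           ≡⟨ All.lookup (Cubic.degree cubic) (labels i<k) ⟩
      3                                                ∎
      where open ≡-Reasoning

    -- `idx` is meaningful only at labelled vertices; these are recognised by the round trip through
    -- `lab`. Being Boolean, `used` also serves as a cut.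
    used : ℕ → Bool
    used v = (idx v <ᵇ k) ∧ (lab (idx v) ≡ᵇ v)

    used-lab : ∀ {i} → i < k → used (lab i) ≡ true
    used-lab {i} i<k rewrite inverse i<k | <⇒<ᵇ-true i<k | ≡ᵇ-refl (lab i) = refl

    used⇒lab : ∀ {v} → used v ≡ true → idx v < k × lab (idx v) ≡ v
    used⇒lab {v} eq with lt , eq′ ← ∧-true eq = <ᵇ-true lt , ≡ᵇ⇒≡ _ _ (subst T (sym eq′) tt)

    saturated⇒unused : (∀ {i} → i < k → 3 ≤ deg i D) → ∀ {x} → 0 < deg x K → used x ≡ false
    saturated⇒unused sat {x} pos with used x in eq
    ... | false = refl
    ... | true with i<k , lab≡x ← used⇒lab eq =
      contradiction (≤-trans (+-mono-≤ (sat i<k) (subst (λ v → 0 < deg v K) (sym lab≡x) pos)) (≤-reflexive (deg-total i<k))) λ { (s≤s (s≤s (s≤s ()))) }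

    -- If all labels are saturated, the remaining links touch only unlabelled vertices, so `used` is
    -- an empty cut. A leftover link would put a vertex on its other side, against connectedness.
    saturated⇒complete : (∀ {i} → i < k → 3 ≤ deg i D) → ∀ {e} → e ∉ K
    saturated⇒complete sat {x , y} e∈K = contradiction (≡-trans (sym (used-lab start)) (≡-trans
        (Frame.connected (Cubic.frame cubic) used (subst (All (Mono used)) (sym (links-ones _)) (All.++⁺ (inD below) inK)) (labels start) x∈)
        (unused (deg-∈ˡ e∈K)))) λ ()
      where
      unused : ∀ {x} → 0 < deg x K → used x ≡ false
      unused = saturated⇒unused sat
      inD : ∀ {D} → All (Below k) D → All (Mono used) (map (relabel lab) D)
      inD []                 = []
      inD ((a<k , b<k) ∷ bs) = ≡-trans (used-lab a<k) (sym (used-lab b<k)) ∷ inD bs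
      inK : All (Mono used) K
      inK = All.tabulate λ e∈ → ≡-trans (unused (deg-∈ˡ e∈)) (sym (unused (deg-∈ʳ e∈)))
      x∈ : x ∈ V
      x∈ = proj₁ (All.lookup (subst (All (Within V)) (links-ones _) (Frame.within (Cubic.frame cubic)))
                   (∈.∈-++⁺ʳ (map (relabel lab) D) e∈K))

    module _ {i y K′} (i<k : i < k) (p : ones K ≈ ones ((lab i , y) ∷ K′)) where

      moved : ones (map (relabel lab) D ++ K) ≈ ones ((lab i , y) ∷ map (relabel lab) D ++ K′)
      moved = subst₂ _≈_ (sym (List.map-++ (_, 1) (map (relabel lab) D) K)) (cong (_ ∷_) (sym (List.map-++ (_, 1) (map (relabel lab) D) K′)))
        (trans (≈-++ˡ (ones (map (relabel lab) D)) p) (perm (↭.shift _ (ones (map (relabel lab) D)) (ones K′))))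

      y∈V : y ∈ V
      y∈V with (_ , y∈) ∷ _ ← subst (All (Within V)) (links-ones _) (within-≈ moved (Frame.within (Cubic.frame cubic))) = y∈

      attach-used : used y ≡ true → Partial ((i , idx y) ∷ D) k lab idx K′
      attach-used eq with j<k , laby ← used⇒lab eq = record
        { below   = (i<k , j<k) ∷ below
        ; inverse = inverse
        ; labels  = labels
        ; start   = start
        ; cubic   = subst (λ z → Cubic V ((lab i , z) ∷ map (relabel lab) D ++ K′)) (sym laby) (cubic-≈ moved cubic)
        }

      lab′ idx′ : ℕ → ℕ
      lab′ j = if j ≡ᵇ k then y else lab j
      idx′ v = if v ≡ᵇ y then k else idx v

      lab′-old : ∀ {j} → j < k → lab′ j ≡ lab j
      lab′-old j<k rewrite ≢⇒≡ᵇ-false (<⇒≢ j<k) = refl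

      lab′-new : lab′ k ≡ y
      lab′-new rewrite ≡ᵇ-refl k = refl

      relabel-old : ∀ {D} → All (Below k) D → map (relabel lab′) D ≡ map (relabel lab) D
      relabel-old []                 = refl
      relabel-old ((a<k , b<k) ∷ bs) = cong₂ _∷_ (cong₂ _,_ (lab′-old a<k) (lab′-old b<k)) (relabel-old bs)

      module _ (fresh : used y ≡ false) where

        lab≢y : ∀ {j} → j < k → lab j ≢ y
        lab≢y j<k refl = contradiction (≡-trans (sym (used-lab j<k)) fresh) λ ()

        cases : ∀ {j} {P : ℕ → Set} → j < suc k → (j < k → P j) → P k → P j
        cases {j} j<1+k old new with m≤n⇒m<n∨m≡n (≤-pred j<1+k)
        ... | inj₁ j<k  = old j<k
        ... | inj₂ refl = new

        attach-fresh : Partial ((i , k) ∷ D) (suc k) lab′ idx′ K′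
        attach-fresh = record
          { below   = (m<n⇒m<1+n i<k , n<1+n k) ∷ All.map (λ (a<k , b<k) → m<n⇒m<1+n a<k , m<n⇒m<1+n b<k) below
          ; inverse = λ {j} j<1+k → cases {P = λ j → idx′ (lab′ j) ≡ j} j<1+k inverse-old inverse-new
          ; labels  = λ {j} j<1+k → cases {P = λ j → lab′ j ∈ V} j<1+k (λ j<k → subst (_∈ V) (sym (lab′-old j<k)) (labels j<k)) (subst (_∈ V) (sym lab′-new) y∈V)
          ; start   = s≤s z≤n
          ; cubic   = subst (Cubic V) (cong₂ _∷_ (cong₂ _,_ (sym (lab′-old i<k)) (sym lab′-new)) (cong (_++ K′) (sym (relabel-old below)))) (cubic-≈ moved cubic)
          }
          where
          inverse-old : ∀ {j} → j < k → idx′ (lab′ j) ≡ j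
          inverse-old {j} j<k rewrite lab′-old j<k | ≢⇒≡ᵇ-false (lab≢y j<k) = inverse j<k
          inverse-new : idx′ (lab′ k) ≡ k
          inverse-new rewrite lab′-new | ≡ᵇ-refl y = refl

        -- Pigeonhole: the new vertex and the `k` labelled ones are distinct members of a list of
        -- length eight.
        room : k < 8
        room = subst₂ _≤_ (cong suc (≡-trans (List.length-map lab (upTo k)) (List.length-upTo k))) order
          (unique-length {xs = y ∷ map lab (upTo k)}
            (All.map⁺ (All.tabulate λ j∈ y≡ → lab≢y (∈.∈-upTo⁻ j∈) (sym y≡)) ∷ uniqueLabels (Unique.upTo⁺ k) (All.all-upTo k))
            (y∈V ∷ All.map⁺ (All.tabulate λ j∈ → labels (∈.∈-upTo⁻ j∈))))
          where
          uniqueLabels : ∀ {js} → Unique js → All (_< k) js → Unique (map lab js)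
          uniqueLabels []       []        = []
          uniqueLabels (j∉ ∷ u) (j<k ∷ js<k) = All.map⁺ (All.tabulate λ i∈ eq →
            All.lookup j∉ i∈ (≡-trans (sym (inverse j<k)) (≡-trans (cong idx eq) (inverse (All.lookup js<k i∈))))) ∷ uniqueLabels u js<k

    -- A cut on the labels pulls back along `idx` to a cut of `V`, so connectedness passes from `V`
    -- to the labels and the count can only increase. Eight vertices and twelve links meet the size
    -- condition of `cnt-≤-trees` with five removals.
    complete-bound : K ≡ [] → 8 ≤ k → trees id 5 D ≤ 392 → N V 5 (ones (map (relabel lab) D ++ K)) ≤ 392
    complete-bound refl 8≤k bound = begin
      N V 5 (ones (map (relabel lab) D ++ [])) ≡⟨ cong (N V 5 ∘ ones) (List.++-identityʳ (map (relabel lab) D)) ⟩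
      N V 5 (ones (map (relabel lab) D))       ≤⟨ cnt-mono (conn? V) (conn? (upTo 8)) pull (related below) 5 ⟩
      N (upTo 8) 5 (ones D)                    ≤⟨ cnt-≤-trees (conn? (upTo 8)) {id} {upTo 8} (λ _ c → c) (Unique.upTo⁺ 8) (All.tabulate λ v∈ → _ , v∈ , refl) D 5 (s≤s (≤-reflexive size)) ⟩
      trees id 5 D                             ≤⟨ bound ⟩
      392                                      ∎
      where
      open ≤-Reasoning
      R : Link → Link → Set
      R e e′ = e ≡ relabel lab e′ × Below k e′
      related : ∀ {D} → All (Below k) D → Pointwise (λ e e′ → R (proj₁ e) (proj₁ e′) × proj₂ e ≤ proj₂ e′) (ones (map (relabel lab) D)) (ones D)
      related []       = []
      related (b ∷ bs) = ((refl , b) , ≤-refl) ∷ related bs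
      push : ∀ (f : ℕ → Bool) {L L′} → Pointwise R L L′ → All (Mono f) L′ → All (Mono (f ∘ idx)) L
      push f []                            []          = []
      push f ((refl , (a<k , b<k)) ∷ rs) (eq ∷ mono) =
        ≡-trans (cong f (inverse a<k)) (≡-trans eq (cong f (sym (inverse b<k)))) ∷ push f rs mono
      pull : ∀ {L L′} → Pointwise R L L′ → Conn V L → Conn (upTo 8) L′
      pull rs conn f mono {u} {v} u∈ v∈ = ≡-trans (cong f (sym (inverse (lt u∈)))) (≡-trans
        (conn (f ∘ idx) (push f rs mono) (labels (lt u∈)) (labels (lt v∈))) (cong f (inverse (lt v∈))))
        where
        lt : ∀ {u} → u ∈ upTo 8 → u < k
        lt u∈ = ≤-trans (∈.∈-upTo⁻ u∈) 8≤k
      size : length D ≡ 12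
      size = ≡-trans (sym (List.length-map (relabel lab) D)) (≡-trans (cong length (sym (List.++-identityʳ (map (relabel lab) D))))
        (≡-trans (sym (List.length-map (_, 1) (map (relabel lab) D ++ []))) (≡-trans (Frame.corank (Cubic.frame cubic)) (cong (_+ 4) order))))

  if-true : ∀ {b c} → b ≡ true → (if b then c else true) ≡ true → c ≡ true
  if-true refl eq = eq

  cols-lookup : ∀ r D k i f j {l} → cols r D k i f j ≡ true → j ≤ l → l < j + f → deg l ((i , l) ∷ D) < 4 →
    check r ((i , l) ∷ D) k ≡ true
  cols-lookup r D k i zero j ok j≤l l< _ = contradiction (≤-trans l< (≤-trans (≤-reflexive (+-identityʳ j)) j≤l)) (<-irrefl refl)
  cols-lookup r D k i (suc f) j {l} ok j≤l l< low with ok₁ , ok₂ ← ∧-true ok with m≤n⇒m<n∨m≡n j≤l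
  ... | inj₁ j<l  = cols-lookup r D k i f (suc j) ok₂ j<l (subst (l <_) (+-suc j f) l<) low
  ... | inj₂ refl = if-true (<⇒<ᵇ-true low) ok₁

  length-≈-ones : ∀ {K K′} → ones K ≈ ones K′ → length K ≡ length K′
  length-≈-ones {K} {K′} p = ≡-trans (sym (List.length-map (_, 1) K)) (≡-trans (length-≈ p) (List.length-map (_, 1) K′))

  -- Recursion along the one branch of the search that the given multigraph dictates. In `row-sound`
  -- all labels below `i` are saturated and `f` labels remain to be inspected.
  check-sound : ∀ r {D k lab idx K} → Partial D k lab idx K → length K ≡ r → check r D k ≡ true →
    N V 5 (ones (map (relabel lab) D ++ K)) ≤ 392
  row-sound : ∀ r f i {D k lab idx K} → Partial D k lab idx K → length K ≡ suc r → i + f ≡ k →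
    (∀ {j} → j < i → 3 ≤ deg j D) → row r D k f i ≡ true →
    N V 5 (ones (map (relabel lab) D ++ K)) ≤ 392
  check-sound zero {K = []} part len ok with ok₁ , ok₂ ← ∧-true ok =
    complete-bound part refl (≤ᵇ-true ok₁) (≤ᵇ-true ok₂)
  check-sound (suc r) {k = k} part len ok = row-sound r k 0 part len refl (λ ()) ok
  row-sound r zero i {K = e ∷ _} part len refl sat ok =
    ⊥-elim (saturated⇒complete part (λ j<k → sat (subst (_ <_) (+-identityʳ i) j<k)) {e} (here refl))
  row-sound r (suc f) i {D} {k} {lab} {idx} {K} part len i+f≡k sat ok with deg i D <ᵇ 3 in eq
  ... | false = row-sound r f (suc i) part len (≡-trans (sym (+-suc i f)) i+f≡k) sat′ ok
    where
    sat′ : ∀ {j} → j < suc i → 3 ≤ deg j D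
    sat′ j<1+i with m≤n⇒m<n∨m≡n (≤-pred j<1+i)
    ... | inj₁ j<i  = sat j<i
    ... | inj₂ refl = <ᵇ-false eq
  ... | true = attach (pick (lab i) K positive)
    where
    i<k : i < k
    i<k = subst (i <_) i+f≡k (subst (i <_) (sym (+-suc i f)) (s≤s (m≤m+n i f)))
    -- Label `i` has degree below three in `D` but three in total, so a link at its vertex is still
    -- undiscovered.
    positive : 0 < deg (lab i) K
    positive = n≢0⇒n>0 λ zero-deg → <-irrefl (≡-trans (sym (+-identityʳ _)) (≡-trans (cong (deg i D +_) (sym zero-deg)) (deg-total part i<k))) (<ᵇ-true eq)
    ok₁ = proj₁ (∧-true ok)
    ok₂ = proj₂ (∧-true {cols r D k i k 0} ok)
    attach : (∃ λ y → ∃ λ K′ → ones K ≈ ones ((lab i , y) ∷ K′)) → N V 5 (ones (map (relabel lab) D ++ K)) ≤ 392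
    attach (y , K′ , p) = extended (used part y) refl
      where
      len′ : length K′ ≡ r
      len′ = suc-injective (≡-trans (sym (length-≈-ones p)) len)
      same : N V 5 (ones (map (relabel lab) D ++ K)) ≡ N V 5 (ones ((lab i , y) ∷ map (relabel lab) D ++ K′))
      same = N-≈ (moved part i<k p) 5
      extended : ∀ b → used part y ≡ b → N V 5 (ones (map (relabel lab) D ++ K)) ≤ 392
      extended true isUsed = begin
        N V 5 (ones (map (relabel lab) D ++ K))                       ≡⟨ same ⟩
        N V 5 (ones ((lab i , y) ∷ map (relabel lab) D ++ K′))        ≡⟨ cong (λ z → N V 5 (ones ((lab i , z) ∷ map (relabel lab) D ++ K′))) (sym (proj₂ (used⇒lab part isUsed))) ⟩
        N V 5 (ones (map (relabel lab) ((i , idx y) ∷ D) ++ K′))      ≤⟨ check-sound r part′ len′ (cols-lookup r D k i k 0 ok₁ z≤n j<k (s≤s (≤-trans (m≤m+n _ _) (≤-reflexive (deg-total part′ j<k))))) ⟩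
        392                                                           ∎
        where
        open ≤-Reasoning
        part′ = attach-used part i<k p isUsed
        j<k = proj₁ (used⇒lab part isUsed)
      extended false isFresh = begin
        N V 5 (ones (map (relabel lab) D ++ K))                       ≡⟨ same ⟩
        N V 5 (ones ((lab i , y) ∷ map (relabel lab) D ++ K′))        ≡⟨ cong (λ L → N V 5 (ones L)) (cong₂ _∷_ (cong₂ _,_ (sym (lab′-old part i<k p i<k)) (sym (lab′-new part i<k p))) (cong (_++ K′) (sym (relabel-old part i<k p (Partial.below part))))) ⟩
        N V 5 (ones (map (relabel (lab′ part i<k p)) ((i , k) ∷ D) ++ K′)) ≤⟨ check-sound r (attach-fresh part i<k p isFresh) len′ (if-true (<⇒<ᵇ-true (room part i<k p isFresh)) ok₂) ⟩
        392                                                           ∎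
        where open ≤-Reasoning

  cubic-trees : ∀ {K} → Cubic V K → N V 5 (ones K) ≤ 392
  cubic-trees {K} cubic = check-sound 12 {[]} {1} {λ _ → root} {λ _ → 0} (record
    { below   = []
    ; inverse = λ { {zero} _ → refl ; {suc _} (s≤s ()) }
    ; labels  = λ _ → root∈
    ; start   = s≤s z≤n
    ; cubic   = cubic
    }) (≡-trans (sym (List.length-map (_, 1) K)) (≡-trans (Frame.corank (Cubic.frame cubic)) (cong (_+ 4) order))) exhaustion
    where
    nonempty : ∀ V → length V ≡ 8 → ∃ (_∈ V)
    nonempty (v ∷ V) _ = v , here refl
    root = proj₁ (nonempty V order)
    root∈ = proj₂ (nonempty V order)

-- Breadth-first search decides connectivity

toLink : ∀ {n} → Edge n → Link
toLink (i , j) = toℕ i , toℕ j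

T⇒≡ : ∀ {b} → T b → b ≡ true
T⇒≡ {true} _ = refl

≡⇒T : ∀ {b} → b ≡ true → T b
≡⇒T refl = tt

∈-allFin : ∀ {n} (i : Fin n) → i ∈ allFin n
∈-allFin Fin.zero    = here refl
∈-allFin (Fin.suc i) = there (∈.∈-map⁺ Fin.suc (∈-allFin i))

module _ {n : ℕ} (K : List (Edge n)) where

  Adjacent : Fin n → Fin n → Set
  Adjacent u v = (u , v) ∈ K ⊎ (v , u) ∈ K

  step⁻ : ∀ R v → T (step K R v) → T (R v) ⊎ ∃ λ u → T (R u) × Adjacent u v
  step⁻ R v t with Equivalence.to Bool.T-∨ t
  ... | inj₁ Rv = inj₁ Rv
  ... | inj₂ ex with (a , b) , e∈ , t′ ← find (Any.any⁻ _ K ex) with Equivalence.to Bool.T-∨ t′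
  ...   | inj₁ t″ with Ra , b=v ← Equivalence.to Bool.T-∧ t″ with refl ← toWitness {a? = b Fin.≟ v} b=v = inj₂ (a , Ra , inj₁ e∈)
  ...   | inj₂ t″ with Rb , a=v ← Equivalence.to Bool.T-∧ t″ with refl ← toWitness {a? = a Fin.≟ v} a=v = inj₂ (b , Rb , inj₂ e∈)

  step-⊇ : ∀ R v → T (R v) → T (step K R v)
  step-⊇ R v Rv = Equivalence.from Bool.T-∨ (inj₁ Rv)

  step-adjacent : ∀ R {u v} → Adjacent u v → T (R u) → T (step K R v)
  step-adjacent R {u} {v} (inj₁ e∈) Ru = Equivalence.from (Bool.T-∨ {R v}) (inj₂ (Any.any⁺ _ (lose e∈
    (Equivalence.from Bool.T-∨ (inj₁ (Equivalence.from Bool.T-∧ (Ru , fromWitness {a? = v Fin.≟ v} refl)))))))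
  step-adjacent R {u} {v} (inj₂ e∈) Ru = Equivalence.from (Bool.T-∨ {R v}) (inj₂ (Any.any⁺ _ (lose e∈
    (Equivalence.from (Bool.T-∨ {R v ∧ (u == v)}) (inj₂ (Equivalence.from Bool.T-∧ (Ru , fromWitness {a? = v Fin.≟ v} refl)))))))

  mono-adjacent : ∀ {f u v} → All (Mono f) (map toLink K) → Adjacent u v → f (toℕ v) ≡ f (toℕ u)
  mono-adjacent mono (inj₁ e∈) = sym (All.lookup mono (∈.∈-map⁺ toLink e∈))
  mono-adjacent mono (inj₂ e∈) = All.lookup mono (∈.∈-map⁺ toLink e∈)

  iter-mono : ∀ {f c} k R → All (Mono f) (map toLink K) → (∀ v → T (R v) → f (toℕ v) ≡ c) →
    ∀ v → T (iter k K R v) → f (toℕ v) ≡ c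
  iter-mono zero    R mono base v t = base v t
  iter-mono (suc k) R mono base v t with step⁻ (iter k K R) v t
  ... | inj₁ t′            = iter-mono k R mono base v t′
  ... | inj₂ (u , t′ , adj) = ≡-trans (mono-adjacent mono adj) (iter-mono k R mono base u t′)

  Closed : (Fin n → Bool) → Set
  Closed R = ∀ v → T (step K R v) → T (R v)

  bit : Bool → ℕ
  bit b = if b then 1 else 0

  size : (Fin n → Bool) → List (Fin n) → ℕ
  size R vs = sum (map (bit ∘ R) vs)

  bit-mono : ∀ {b c} → (T b → T c) → bit b ≤ bit c
  bit-mono {false} b⇒c = z≤n
  bit-mono {true} {true}  b⇒c = ≤-refl
  bit-mono {true} {false} b⇒c = ⊥-elim (b⇒c tt)

  size-mono : ∀ {R S : Fin n → Bool} → (∀ v → T (R v) → T (S v)) → ∀ vs → size R vs ≤ size S vs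
  size-mono R⊆S []       = z≤n
  size-mono R⊆S (v ∷ vs) = +-mono-≤ (bit-mono (R⊆S v)) (size-mono R⊆S vs)

  size-strict : ∀ {R S : Fin n → Bool} → (∀ v → T (R v) → T (S v)) → ∀ {v vs} → v ∈ vs → T (S v) → ¬ T (R v) → size R vs < size S vs
  size-strict {R} {S} R⊆S {v} {_ ∷ vs} (here refl) Sv ¬Rv with R v | S v
  ... | false | true = s≤s (size-mono R⊆S vs)
  ... | true  | _    = contradiction tt ¬Rv
  size-strict {R} {S} R⊆S {vs = u ∷ vs} (there v∈) Sv ¬Rv =
    +-mono-≤-< (bit-mono {R u} {S u} (R⊆S u)) (size-strict R⊆S v∈ Sv ¬Rv)

  size-≤ : ∀ R vs → size R vs ≤ length vs
  size-≤ R []       = z≤n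
  size-≤ R (v ∷ vs) with R v
  ... | true  = s≤s (size-≤ R vs)
  ... | false = m≤n⇒m≤1+n (size-≤ R vs)

  closed? : ∀ R → Closed R ⊎ ∃ λ v → T (step K R v) × ¬ T (R v)
  closed? R with Fin.all? (λ v → T? (step K R v) →-dec T? (R v))
  ... | yes closed = inj₁ closed
  ... | no ¬closed with v , ¬imp ← Fin.¬∀⟶∃¬ n _ (λ v → T? (step K R v) →-dec T? (R v)) ¬closed = inj₂ (v , stepped v ¬imp , λ Rv → ¬imp λ _ → Rv)
    where
    stepped : ∀ v → ¬ (T (step K R v) → T (R v)) → T (step K R v)
    stepped v ¬imp with T? (step K R v)
    ... | yes t = t
    ... | no ¬t = contradiction (λ t → contradiction t ¬t) ¬imp

  closed-step : ∀ {R} → Closed R → Closed (step K R)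
  closed-step {R} closed v t with step⁻ (step K R) v t
  ... | inj₁ t′            = t′
  ... | inj₂ (u , t′ , adj) = step-adjacent R adj (closed u t′)

  -- Until it is closed, the reached set gains a vertex in every round.
  iter-grows : ∀ R k → Closed (iter k K R) ⊎ k ≤ size (iter k K R) (allFin n)
  iter-grows R zero    = inj₂ z≤n
  iter-grows R (suc k) with iter-grows R k
  ... | inj₁ closed = inj₁ (closed-step closed)
  ... | inj₂ large with closed? (iter k K R)
  ...   | inj₁ closed            = inj₁ (closed-step closed)
  ...   | inj₂ (v , gained , new) = inj₂ (≤-trans (s≤s large) (size-strict (step-⊇ (iter k K R)) (∈-allFin v) gained new))

  length-allFin : ∀ n → length (allFin n) ≡ n
  length-allFin zero    = refl
  length-allFin (suc n) = cong suc (≡-trans (List.length-map Fin.suc (allFin n)) (length-allFin n))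

  -- If the search has not become stationary within `n` rounds, it has reached at least `n`
  -- vertices, so none is left to be gained.
  iter-closed : ∀ R → Closed (iter n K R)
  iter-closed R v t with iter-grows R n
  ... | inj₁ closed = closed v t
  ... | inj₂ large with T? (iter n K R v)
  ...   | yes t′ = t′
  ...   | no ¬t  = contradiction (begin-strict
    n                                ≤⟨ large ⟩
    size (iter n K R) (allFin n)     <⟨ size-strict (λ _ _ → tt) (∈-allFin v) tt ¬t ⟩
    size (λ _ → true) (allFin n)     ≤⟨ size-≤ (λ _ → true) (allFin n) ⟩
    length (allFin n)                ≡⟨ length-allFin n ⟩
    n                                ∎) (<-irrefl refl)
    where open ≤-Reasoning

  iter-⊇ : ∀ k R v → T (R v) → T (iter k K R v)
  iter-⊇ zero    R v t = t
  iter-⊇ (suc k) R v t = step-⊇ (iter k K R) v (iter-⊇ k R v t)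

-- Cuts in `Conn` are functions on ℕ. The default outside the range is never consulted, since all
-- vertices and links stay below `n`.
extendFin : ∀ {n} → (Fin n → Bool) → ℕ → Bool
extendFin {n} R x with x <? n
... | yes x<n = R (fromℕ< x<n)
... | no _    = false

extendFin-toℕ : ∀ {n} (R : Fin n → Bool) i → extendFin R (toℕ i) ≡ R i
extendFin-toℕ {n} R i with toℕ i <? n
... | yes lt = cong R (Fin.fromℕ<-toℕ i lt)
... | no ¬lt = contradiction (Fin.toℕ<n i) ¬lt

connectedᵇ⇒Conn : ∀ n (K : List (Edge n)) → T (connectedᵇ n K) → Conn (upTo n) (map toLink K)
connectedᵇ⇒Conn zero    K t f mono ()
connectedᵇ⇒Conn (suc n) K t f mono u∈ v∈ = ≡-trans (rooted u∈) (sym (rooted v∈))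
  where
  rooted : ∀ {u} → u ∈ upTo (suc n) → f u ≡ f 0
  rooted {u} u∈ = subst (λ x → f x ≡ f 0) (Fin.toℕ-fromℕ< u<)
    (iter-mono K (suc n) (_== Fin.zero) mono (λ v t → cong (f ∘ toℕ) (toWitness {a? = v Fin.≟ Fin.zero} t)) (fromℕ< u<)
      (All.lookup (All.all⁺ (iter (suc n) K (_== Fin.zero)) (allFin (suc n)) t) (∈-allFin (fromℕ< u<))))
    where u< = ∈.∈-upTo⁻ u∈

-- The reached set is itself the cut to test: `iter-closed` shows that no link leaves it, and it
-- contains vertex 0.
Conn⇒connectedᵇ : ∀ n (K : List (Edge n)) → Conn (upTo n) (map toLink K) → T (connectedᵇ n K)
Conn⇒connectedᵇ zero    K conn = tt
Conn⇒connectedᵇ (suc n) K conn = All.all⁻ R reached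
  where
  R = iter (suc n) K (_== Fin.zero)
  closed : ∀ {u v} → Adjacent K u v → T (R u) → T (R v)
  closed adj Ru = iter-closed K (_== Fin.zero) _ (step-adjacent K R adj Ru)
  T-≡ : ∀ {b c} → (T b → T c) → (T c → T b) → b ≡ c
  T-≡ {false} {false} _ _ = refl
  T-≡ {true}  {true}  _ _ = refl
  T-≡ {true}  {false} f _ = ⊥-elim (f tt)
  T-≡ {false} {true}  _ g = ⊥-elim (g tt)
  mono : All (Mono (extendFin R)) (map toLink K)
  mono = All.map⁺ (All.tabulate λ {(a , b)} e∈ → ≡-trans (extendFin-toℕ R a)
    (≡-trans (T-≡ (closed (inj₁ e∈)) (closed (inj₂ e∈))) (sym (extendFin-toℕ R b))))
  reached : All (T ∘ R) (allFin (suc n))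
  reached = All.tabulate λ {v} _ → ≡⇒T (≡-trans (sym (extendFin-toℕ R v))
    (≡-trans (conn (extendFin R) mono (∈.∈-upTo⁺ (Fin.toℕ<n v)) (∈.∈-upTo⁺ {i = 0} (s≤s z≤n)))
             (≡-trans (extendFin-toℕ R Fin.zero) (T⇒≡ (iter-⊇ K (suc n) (_== Fin.zero) Fin.zero tt)))))

-- Comparison of the coefficients of homogeneous generating polynomials

-- The form `Σ a i · p ^ i · q ^ (m - i)` over `i ≤ m`, in Horner shape with respect to p.
hom : (ℕ → ℕ) → ℕ → ℕ → ℕ → ℕ
hom a zero    p q = a 0
hom a (suc m) p q = a 0 * q ^ suc m + p * hom (a ∘ suc) m p q

hom-cong : ∀ {a b : ℕ → ℕ} → (∀ i → a i ≡ b i) → ∀ m p q → hom a m p q ≡ hom b m p q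
hom-cong a≡b zero    p q = a≡b 0
hom-cong a≡b (suc m) p q = cong₂ _+_ (cong (_* q ^ suc m) (a≡b 0)) (cong (p *_) (hom-cong (a≡b ∘ suc) m p q))

hom-+ : ∀ (a b : ℕ → ℕ) m p q → hom (λ i → a i + b i) m p q ≡ hom a m p q + hom b m p q
hom-+ a b zero    p q = refl
hom-+ a b (suc m) p q = ≡-trans (cong (λ h → (a 0 + b 0) * q ^ suc m + p * h) (hom-+ (a ∘ suc) (b ∘ suc) m p q))
  (regroup (a 0) (b 0) (q ^ suc m) p _ _)
  where
  regroup : ∀ x y z p g h → (x + y) * z + p * (g + h) ≡ x * z + p * g + (y * z + p * h)
  regroup = solve-∀

hom-raise : ∀ (a : ℕ → ℕ) m p q → a (suc m) ≡ 0 → q * hom a m p q ≡ hom a (suc m) p q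
hom-raise a zero    p q a≡0 rewrite a≡0 | *-identityʳ q | *-zeroʳ p | +-identityʳ (a 0 * q) = *-comm q (a 0)
hom-raise a (suc m) p q a≡0 = begin
  q * (a 0 * q ^ suc m + p * hom (a ∘ suc) m p q)        ≡⟨ regroup q (a 0) (q ^ suc m) p _ ⟩
  a 0 * q ^ suc (suc m) + p * (q * hom (a ∘ suc) m p q)  ≡⟨ cong (λ h → a 0 * q ^ suc (suc m) + p * h) (hom-raise (a ∘ suc) m p q a≡0) ⟩
  hom a (suc (suc m)) p q                                ∎
  where
  open ≡-Reasoning
  regroup : ∀ q a s p h → q * (a * s + p * h) ≡ a * (q * s) + p * (q * h)
  regroup = solve-∀

-- The reliability before normalisation, with a factor q for each kept and p for each removed
-- element; its recursion is that of `cnt`.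
gen : ∀ {A : Set} {P : List A → Set} → Decidable P → ℕ → ℕ → List A → ℕ
gen P? p q []      = indicator (P? []) 0
gen P? p q (e ∷ E) = q * gen (λ K → P? (e ∷ K)) p q E + p * gen P? p q E

gen≡hom : ∀ {A : Set} {P : List A → Set} (P? : Decidable P) p q E →
  gen P? p q E ≡ hom (λ i → cnt P? i (ones E)) (length E) p q
gen≡hom P? p q []      = refl
gen≡hom P? p q (e ∷ E) = begin
  q * gen e∷ p q E + p * gen P? p q E
    ≡⟨ cong₂ (λ g h → q * g + p * h) (gen≡hom e∷ p q E) (gen≡hom P? p q E) ⟩
  q * hom a m p q + p * hom b m p q
    ≡⟨ cong (_+ p * hom b m p q) (hom-raise a m p q (cnt-size-0 e∷ (ones E) (suc m) tooLong)) ⟩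
  a 0 * q ^ suc m + p * hom (a ∘ suc) m p q + p * hom b m p q
    ≡⟨ regroup (a 0) (q ^ suc m) p _ _ ⟩
  (a 0 + 1 * 0) * q ^ suc m + p * (hom (a ∘ suc) m p q + hom b m p q)
    ≡⟨ cong (λ h → (a 0 + 1 * 0) * q ^ suc m + p * h) (hom-+ (a ∘ suc) b m p q) ⟨
  (a 0 + 1 * 0) * q ^ suc m + p * hom (λ i → a (suc i) + b i) m p q
    ≡⟨ cong (λ h → (a 0 + 1 * 0) * q ^ suc m + p * h) (hom-cong (λ i → cong (a (suc i) +_) (sym (*-identityˡ (b i)))) m p q) ⟩
  hom (λ i → cnt P? i (ones (e ∷ E))) (suc m) p q ∎
  where
  open ≡-Reasoning
  e∷ = λ K → P? (e ∷ K)
  m = length E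
  a b : ℕ → ℕ
  a i = cnt e∷ i (ones E)
  b i = cnt P? i (ones E)
  tooLong : ∀ K → length K + suc m ≡ length (ones E) → _
  tooLong K eq _ = <-irrefl (≡-trans (sym (List.length-map (_, 1) E)) (sym eq)) (m≤n+m (suc m) (length K))
  regroup : ∀ a s p g h → a * s + p * g + p * h ≡ (a + 1 * 0) * s + p * (g + h)
  regroup = solve-∀

hom-bound : ∀ (a : ℕ → ℕ) m {q} → 1 ≤ q → hom a m 1 q ≤ q ^ m * hom a m 1 1
hom-bound a zero    1≤q = ≤-reflexive (sym (*-identityˡ (a 0)))
hom-bound a (suc m) {q} 1≤q = begin
  a 0 * q ^ suc m + 1 * hom (a ∘ suc) m 1 q                  ≤⟨ +-monoʳ-≤ (a 0 * q ^ suc m) (*-monoʳ-≤ 1 (≤-trans (hom-bound (a ∘ suc) m 1≤q) (*-monoˡ-≤ h (≤-trans (≤-reflexive (sym (*-identityˡ (q ^ m)))) (*-monoˡ-≤ (q ^ m) 1≤q))))) ⟩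
  a 0 * q ^ suc m + 1 * (q ^ suc m * h)                      ≡⟨ regroup (a 0) (q ^ suc m) h ⟩
  q ^ suc m * (a 0 * 1 + 1 * h)                              ≡⟨ cong (λ z → q ^ suc m * (a 0 * z + 1 * h)) (^-zeroˡ (suc m)) ⟨
  q ^ suc m * (a 0 * 1 ^ suc m + 1 * h)                      ∎
  where
  open ≤-Reasoning
  h = hom (a ∘ suc) m 1 1
  regroup : ∀ a s h → a * s + 1 * (s * h) ≡ s * (a * 1 + 1 * h)
  regroup = solve-∀

-- Letting q → ∞ compares the coefficients lexicographically from below.
compare-low : ∀ (a b : ℕ → ℕ) m → (∀ p q → 0 < p + q → hom b (3 + m) p q ≤ hom a (3 + m) p q) →
  a 0 ≤ b 0 → a 1 ≤ b 1 → b 2 ≤ a 2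
compare-low a b m b≤a a₀≤b₀ a₁≤b₁ = ≮⇒≥ λ a₂<b₂ → <-irrefl refl (begin-strict
  a 0 * q ^ (3 + m) + 1 * (a 1 * q ^ (2 + m) + 1 * (a 2 * q ^ (1 + m) + 1 * hom (a ∘ (3 +_)) m 1 q))
    ≤⟨ +-mono-≤ (*-monoˡ-≤ (q ^ (3 + m)) a₀≤b₀) (*-monoʳ-≤ 1 (+-monoˡ-≤ _ (*-monoˡ-≤ (q ^ (2 + m)) a₁≤b₁))) ⟩
  b 0 * q ^ (3 + m) + 1 * (b 1 * q ^ (2 + m) + 1 * (a 2 * q ^ (1 + m) + 1 * hom (a ∘ (3 +_)) m 1 q))
    <⟨ +-monoʳ-< (b 0 * q ^ (3 + m)) (*-monoʳ-< 1 (+-monoʳ-< (b 1 * q ^ (2 + m)) (*-monoʳ-< 1 (dominated a₂<b₂)))) ⟩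
  b 0 * q ^ (3 + m) + 1 * (b 1 * q ^ (2 + m) + 1 * (b 2 * q ^ (1 + m) + 1 * hom (b ∘ (3 +_)) m 1 q))
    ≤⟨ b≤a 1 q (s≤s z≤n) ⟩
  a 0 * q ^ (3 + m) + 1 * (a 1 * q ^ (2 + m) + 1 * (a 2 * q ^ (1 + m) + 1 * hom (a ∘ (3 +_)) m 1 q)) ∎)
  where
  open ≤-Reasoning
  t = hom (a ∘ (3 +_)) m 1 1
  -- The limit is replaced by one explicit value: `t` is the sum of the coefficients of `a` from
  -- index 3 on, and q exceeds it, so together they stay below one unit of the coefficient of index
  -- 2.
  q = suc t
  dominated : a 2 < b 2 → a 2 * q ^ (1 + m) + 1 * hom (a ∘ (3 +_)) m 1 q < b 2 * q ^ (1 + m) + 1 * hom (b ∘ (3 +_)) m 1 q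
  dominated a₂<b₂ = begin-strict
    a 2 * q ^ (1 + m) + 1 * hom (a ∘ (3 +_)) m 1 q   ≤⟨ +-monoʳ-≤ (a 2 * q ^ (1 + m)) (≤-trans (≤-reflexive (*-identityˡ _)) (hom-bound (a ∘ (3 +_)) m (s≤s z≤n))) ⟩
    a 2 * q ^ (1 + m) + q ^ m * t                    <⟨ +-monoʳ-< (a 2 * q ^ (1 + m)) (*-monoʳ-< (q ^ m) {{m^n≢0 q m}} (n<1+n t)) ⟩
    a 2 * q ^ (1 + m) + q ^ m * q                    ≡⟨ regroup (a 2) q (q ^ m) ⟩
    suc (a 2) * q ^ (1 + m)                          ≤⟨ *-monoˡ-≤ (q ^ (1 + m)) a₂<b₂ ⟩
    b 2 * q ^ (1 + m)                                ≤⟨ m≤m+n _ _ ⟩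
    b 2 * q ^ (1 + m) + 1 * hom (b ∘ (3 +_)) m 1 q   ∎
    where
    regroup : ∀ a q s → a * (q * s) + s * q ≡ (1 + a) * (q * s)
    regroup = solve-∀

hom-0 : ∀ {a : ℕ → ℕ} → (∀ i → a i ≡ 0) → ∀ m p q → hom a m p q ≡ 0
hom-0 a≡0 zero    p q = a≡0 0
hom-0 a≡0 (suc m) p q rewrite a≡0 0 | hom-0 (a≡0 ∘ suc) m p q = *-zeroʳ p

-- Letting p → ∞ compares the top coefficients.
compare-high : ∀ (a b : ℕ → ℕ) m → (∀ p q → 0 < p + q → hom b (6 + m) p q ≤ hom a (6 + m) p q) →
  (∀ i → a (6 + i) ≡ 0) → b 5 ≤ a 5
compare-high a b m b≤a a≡0 = ≮⇒≥ λ a₅<b₅ → <-irrefl refl (begin-strict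
  hom a (6 + m) p 1                             ≡⟨ top ⟩
  low + p ^ 5 * a 5                             <⟨ +-monoˡ-< (p ^ 5 * a 5) low< ⟩
  p ^ 5 + p ^ 5 * a 5                           ≡⟨ *-suc (p ^ 5) (a 5) ⟨
  p ^ 5 * suc (a 5)                             ≤⟨ *-monoʳ-≤ (p ^ 5) a₅<b₅ ⟩
  p ^ 5 * b 5                                   ≤⟨ below ⟩
  hom b (6 + m) p 1                             ≤⟨ b≤a p 1 (s≤s z≤n) ⟩
  hom a (6 + m) p 1                             ∎)
  where
  open ≤-Reasoning
  s = a 0 + (a 1 + (a 2 + (a 3 + a 4)))
  -- Here p exceeds the sum of the coefficients of `a` below index 5, whose joint contribution is
  -- thus less than `p ^ 5`.
  p = suc s
  low = a 0 + p * (a 1 + p * (a 2 + p * (a 3 + p * a 4)))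
  one : ∀ (x : ℕ) k → x * 1 ^ k ≡ x
  one x k = ≡-trans (cong (x *_) (^-zeroˡ k)) (*-identityʳ x)
  expand : ∀ (c : ℕ → ℕ) → hom c (6 + m) p 1 ≡
    c 0 + p * (c 1 + p * (c 2 + p * (c 3 + p * (c 4 + p * (c 5 + p * hom (c ∘ (6 +_)) m p 1)))))
  expand c = cong₂ (λ x y → x + p * y) (one (c 0) (6 + m)) (cong₂ (λ x y → x + p * y) (one (c 1) (5 + m))
    (cong₂ (λ x y → x + p * y) (one (c 2) (4 + m)) (cong₂ (λ x y → x + p * y) (one (c 3) (3 + m))
    (cong₂ (λ x y → x + p * y) (one (c 4) (2 + m)) (cong (_+ p * hom (c ∘ (6 +_)) m p 1) (one (c 5) (1 + m)))))))
  collect : ∀ a₀ a₁ a₂ a₃ a₄ a₅ p → a₀ + p * (a₁ + p * (a₂ + p * (a₃ + p * (a₄ + p * (a₅ + p * 0)))))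
    ≡ a₀ + p * (a₁ + p * (a₂ + p * (a₃ + p * a₄))) + p * (p * (p * (p * (p * 1)))) * a₅
  collect = solve-∀
  top : hom a (6 + m) p 1 ≡ low + p ^ 5 * a 5
  top = ≡-trans (expand a) (≡-trans (cong (λ h → a 0 + p * (a 1 + p * (a 2 + p * (a 3 + p * (a 4 + p * (a 5 + p * h)))))) (hom-0 a≡0 m p 1))
    (collect (a 0) (a 1) (a 2) (a 3) (a 4) (a 5) p))
  collect′ : ∀ a₀ a₁ a₂ a₃ a₄ a₅ p h → a₀ + p * (a₁ + p * (a₂ + p * (a₃ + p * (a₄ + p * (a₅ + p * h)))))
    ≡ p * (p * (p * (p * (p * 1)))) * a₅ + (a₀ + p * (a₁ + p * (a₂ + p * (a₃ + p * (a₄ + p * (p * h))))))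
  collect′ = solve-∀
  below : p ^ 5 * b 5 ≤ hom b (6 + m) p 1
  below = ≤-trans (m≤m+n _ _) (≤-reflexive (sym (≡-trans (expand b) (collect′ (b 0) (b 1) (b 2) (b 3) (b 4) (b 5) p _))))
  scale : ∀ k (x : ℕ) → x ≤ p ^ k * x
  scale k x = ≤-trans (≤-reflexive (sym (*-identityˡ x))) (*-monoˡ-≤ x (m^n>0 p k))
  low< : low < p ^ 5
  low< = begin-strict
    low                    ≡⟨ regroup (a 0) (a 1) (a 2) (a 3) (a 4) p ⟩
    a 0 + (p ^ 1 * a 1 + (p ^ 2 * a 2 + (p ^ 3 * a 3 + p ^ 4 * a 4)))
      ≤⟨ +-mono-≤ (scale 4 (a 0)) (+-mono-≤ (up 1 3 (a 1)) (+-mono-≤ (up 2 2 (a 2)) (+-monoˡ-≤ (p ^ 4 * a 4) (up 3 1 (a 3))))) ⟩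
    p ^ 4 * a 0 + (p ^ 4 * a 1 + (p ^ 4 * a 2 + (p ^ 4 * a 3 + p ^ 4 * a 4)))
      ≡⟨ factor (p ^ 4) (a 0) (a 1) (a 2) (a 3) (a 4) ⟩
    p ^ 4 * s              <⟨ *-monoʳ-< (p ^ 4) {{m^n≢0 p 4}} (n<1+n s) ⟩
    p ^ 4 * p              ≡⟨ *-comm (p ^ 4) p ⟩
    p ^ 5                  ∎
    where
    regroup : ∀ a b c d e p → a + p * (b + p * (c + p * (d + p * e))) ≡
      a + (p * 1 * b + (p * (p * 1) * c + (p * (p * (p * 1)) * d + p * (p * (p * (p * 1))) * e)))
    regroup = solve-∀
    factor : ∀ x a b c d e → x * a + (x * b + (x * c + (x * d + x * e))) ≡ x * (a + (b + (c + (d + e))))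
    factor = solve-∀
    up : ∀ j k x → p ^ j * x ≤ p ^ (j + k) * x
    up j k x = *-monoˡ-≤ x (^-monoʳ-≤ p (m≤m+n j k))

-- Reliability in terms of the counts

sumℚ-++ : ∀ xs ys → sumℚ (xs ++ ys) ≡ sumℚ xs +ℚ sumℚ ys
sumℚ-++ []       ys = sym (ℚ.+-identityˡ (sumℚ ys))
sumℚ-++ (x ∷ xs) ys = ≡-trans (cong (x +ℚ_) (sumℚ-++ xs ys)) (sym (ℚ.+-assoc x (sumℚ xs) (sumℚ ys)))

sumℚ-scale : ∀ {A : Set} (c : ℚ) {f g : A → ℚ} {xs} → All (λ x → f x ≡ c *ℚ g x) xs → sumℚ (map f xs) ≡ c *ℚ sumℚ (map g xs)
sumℚ-scale c []                 = sym (ℚ.*-zeroʳ c)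
sumℚ-scale c (_∷_ {x} fx fxs) = ≡-trans (cong₂ _+ℚ_ fx (sumℚ-scale c fxs)) (sym (ℚ.*-distribˡ-+ c _ _))

length-subsets : ∀ {A : Set} (E : List A) → All (λ K → length K ≤ length E) (subsets E)
length-subsets []      = z≤n ∷ []
length-subsets (e ∷ E) = All.++⁺ (All.map⁺ (All.map s≤s (length-subsets E))) (All.map m≤n⇒m≤1+n (length-subsets E))

module _ (σ ρ : ℚ) where

  ℚgen : ∀ {A : Set} → (List A → Bool) → List A → ℚ
  ℚgen P []      = if P [] then 1ℚ else 0ℚ
  ℚgen P (e ∷ E) = σ *ℚ ℚgen (λ K → P (e ∷ K)) E +ℚ ρ *ℚ ℚgen P E

  term : ∀ {A : Set} → (List A → Bool) → ℕ → List A → ℚ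
  term P m K = if P K then (σ ^ℚ length K) *ℚ (ρ ^ℚ (m ∸ length K)) else 0ℚ

  term-keep : ∀ {A : Set} (P : List A → Bool) e m K → term P (suc m) (e ∷ K) ≡ σ *ℚ term (λ K → P (e ∷ K)) m K
  term-keep P e m K with P (e ∷ K)
  ... | true  = ℚ.*-assoc σ _ _
  ... | false = sym (ℚ.*-zeroʳ σ)

  -- The bound on `length K` makes the truncated subtraction in the exponent exact.
  term-delete : ∀ {A : Set} (P : List A → Bool) m K → length K ≤ m → term P (suc m) K ≡ ρ *ℚ term P m K
  term-delete P m K K≤m with P K
  ... | false = sym (ℚ.*-zeroʳ ρ)
  ... | true rewrite +-∸-assoc 1 K≤m = begin
    s *ℚ (ρ *ℚ r)   ≡⟨ ℚ.*-assoc s ρ r ⟨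
    s *ℚ ρ *ℚ r     ≡⟨ cong (_*ℚ r) (ℚ.*-comm s ρ) ⟩
    ρ *ℚ s *ℚ r     ≡⟨ ℚ.*-assoc ρ s r ⟩
    ρ *ℚ (s *ℚ r)   ∎
    where
    open ≡-Reasoning
    s = σ ^ℚ length K
    r = ρ ^ℚ (m ∸ length K)

  sum-subsets : ∀ {A : Set} (P : List A → Bool) E → sumℚ (map (term P (length E)) (subsets E)) ≡ ℚgen P E
  sum-subsets P [] with P []
  ... | true  = refl
  ... | false = refl
  sum-subsets P (e ∷ E) = begin
    sumℚ (map t (map (e ∷_) (subsets E) ++ subsets E))
      ≡⟨ cong sumℚ (List.map-++ t (map (e ∷_) (subsets E)) (subsets E)) ⟩
    sumℚ (map t (map (e ∷_) (subsets E)) ++ map t (subsets E))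
      ≡⟨ sumℚ-++ (map t (map (e ∷_) (subsets E))) (map t (subsets E)) ⟩
    sumℚ (map t (map (e ∷_) (subsets E))) +ℚ sumℚ (map t (subsets E))
      ≡⟨ cong₂ _+ℚ_ (cong sumℚ (sym (List.map-∘ (subsets E)))) refl ⟩
    sumℚ (map (λ K → t (e ∷ K)) (subsets E)) +ℚ sumℚ (map t (subsets E))
      ≡⟨ cong₂ _+ℚ_ (sumℚ-scale σ (All.universal (term-keep P e (length E)) (subsets E)))
                    (sumℚ-scale ρ (All.map (λ {K} → term-delete P (length E) K) (length-subsets E))) ⟩
    σ *ℚ sumℚ (map (term (λ K → P (e ∷ K)) (length E)) (subsets E)) +ℚ ρ *ℚ sumℚ (map (term P (length E)) (subsets E))
      ≡⟨ cong₂ (λ x y → σ *ℚ x +ℚ ρ *ℚ y) (sum-subsets (λ K → P (e ∷ K)) E) (sum-subsets P E) ⟩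
    ℚgen P (e ∷ E) ∎
    where
    open ≡-Reasoning
    t = term P (suc (length E))

-- A unary embedding of ℕ into ℚ, for which the homomorphism laws are plain inductions that never
-- normalise a fraction.
ι : ℕ → ℚ
ι zero    = 0ℚ
ι (suc n) = 1ℚ +ℚ ι n

ι-+ : ∀ m n → ι (m + n) ≡ ι m +ℚ ι n
ι-+ zero    n = sym (ℚ.+-identityˡ (ι n))
ι-+ (suc m) n = ≡-trans (cong (1ℚ +ℚ_) (ι-+ m n)) (sym (ℚ.+-assoc 1ℚ (ι m) (ι n)))

ι-* : ∀ m n → ι (m * n) ≡ ι m *ℚ ι n
ι-* zero    n = sym (ℚ.*-zeroˡ (ι n))
ι-* (suc m) n = begin
  ι (n + m * n)               ≡⟨ ι-+ n (m * n) ⟩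
  ι n +ℚ ι (m * n)            ≡⟨ cong₂ _+ℚ_ (sym (ℚ.*-identityˡ (ι n))) (ι-* m n) ⟩
  1ℚ *ℚ ι n +ℚ ι m *ℚ ι n     ≡⟨ ℚ.*-distribʳ-+ (ι n) 1ℚ (ι m) ⟨
  (1ℚ +ℚ ι m) *ℚ ι n          ∎
  where open ≡-Reasoning

0≤ι : ∀ n → 0ℚ ≤ℚ ι n
0≤ι zero    = ℚ.≤-refl
0≤ι (suc n) = ℚ.+-mono-≤ (ℚ.nonNegative⁻¹ 1ℚ) (0≤ι n)

ι-mono-< : ∀ {m n} → m < n → ι m <ℚ ι n
ι-mono-< {zero}  {suc n} _         = ℚ.+-mono-<-≤ (ℚ.positive⁻¹ 1ℚ) (0≤ι n)
ι-mono-< {suc m} {suc n} (s≤s m<n) = ℚ.+-monoʳ-< 1ℚ (ι-mono-< m<n)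

ι-cancel-≤ : ∀ {m n} → ι m ≤ℚ ι n → m ≤ n
ι-cancel-≤ {m} {n} le = ≮⇒≥ λ n<m → ℚ.<-irrefl refl (ℚ.<-≤-trans (ι-mono-< n<m) le)

-- Clearing denominators: each element takes one factor `D`, which turns its rational factor `σ` or
-- `ρ` into a natural number.
scaled-ℚgen : ∀ {σ ρ D : ℚ} {p q} → D *ℚ σ ≡ ι q → D *ℚ ρ ≡ ι p → ∀ {A : Set} (P : List A → Bool) E →
  (D ^ℚ length E) *ℚ ℚgen σ ρ P E ≡ ι (gen (λ K → T? (P K)) p q E)
scaled-ℚgen Dσ Dρ P [] with P []
... | true  = refl
... | false = refl
scaled-ℚgen {σ} {ρ} {D} {p} {q} Dσ Dρ P (e ∷ E) = begin
  (D *ℚ d) *ℚ (σ *ℚ x +ℚ ρ *ℚ y)             ≡⟨ solve 6 (λ D d σ ρ x y → (D :* d) :* (σ :* x :+ ρ :* y) := (D :* σ) :* (d :* x) :+ (D :* ρ) :* (d :* y)) refl D d σ ρ x y ⟩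
  (D *ℚ σ) *ℚ (d *ℚ x) +ℚ (D *ℚ ρ) *ℚ (d *ℚ y) ≡⟨ cong₂ _+ℚ_ (cong₂ _*ℚ_ Dσ (scaled-ℚgen Dσ Dρ (λ K → P (e ∷ K)) E)) (cong₂ _*ℚ_ Dρ (scaled-ℚgen Dσ Dρ P E)) ⟩
  ι q *ℚ ι g +ℚ ι p *ℚ ι h                   ≡⟨ cong₂ _+ℚ_ (ι-* q g) (ι-* p h) ⟨
  ι (q * g) +ℚ ι (p * h)                     ≡⟨ ι-+ (q * g) (p * h) ⟨
  ι (q * g + p * h)                          ∎
  where
  open ≡-Reasoning
  open +-*-Solver
  d = D ^ℚ length E
  x = ℚgen σ ρ (λ K → P (e ∷ K)) E
  y = ℚgen σ ρ P E
  g = gen (λ K → T? (P (e ∷ K))) p q E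
  h = gen (λ K → T? (P K)) p q E

^ℚ-nonNeg : ∀ {x} → 0ℚ ≤ℚ x → ∀ k → 0ℚ ≤ℚ x ^ℚ k
^ℚ-nonNeg 0≤x zero    = ℚ.nonNegative⁻¹ 1ℚ
^ℚ-nonNeg {x} 0≤x (suc k) = ℚ.nonNegative⁻¹ (x *ℚ (x ^ℚ k))
  {{ℚ.nonNeg*nonNeg⇒nonNeg x {{ℚ.nonNegative 0≤x}} (x ^ℚ k) {{ℚ.nonNegative (^ℚ-nonNeg 0≤x k)}}}}

coefficients : ∀ {n} → Graph n → ℕ → ℕ
coefficients {n} G i = N (upTo n) i (ones (map toLink (edges G)))

genᵇ≡hom : ∀ {n} (G : Graph n) p q →
  gen (λ K → T? (connectedᵇ n K)) p q (edges G) ≡ hom (coefficients G) (numEdges G) p q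
genᵇ≡hom {n} G p q = ≡-trans (gen≡hom (λ K → T? (connectedᵇ n K)) p q (edges G))
  (hom-cong (cnt-cong (λ K → T? (connectedᵇ n K)) (conn? (upTo n)) {R = λ e e′ → toLink e ≡ e′} to from (related (edges G))) (numEdges G) p q)
  where
  related : ∀ E → Pointwise (λ e e′ → toLink (proj₁ e) ≡ proj₁ e′ × proj₂ e ≡ proj₂ e′) (ones E) (ones (map toLink E))
  related []      = []
  related (e ∷ E) = (refl , refl) ∷ related E
  mapped : ∀ {K : List (Edge n)} {K′} → Pointwise (λ e e′ → toLink e ≡ e′) K K′ → map toLink K ≡ K′
  mapped []          = refl
  mapped (refl ∷ rs) = cong (_ ∷_) (mapped rs)
  to : ∀ {K : List (Edge n)} {K′} → Pointwise (λ e e′ → toLink e ≡ e′) K K′ → T (connectedᵇ n K) → Conn (upTo n) K′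
  to {K} rs t = subst (Conn (upTo n)) (mapped rs) (connectedᵇ⇒Conn n K t)
  from : ∀ {K : List (Edge n)} {K′} → Pointwise (λ e e′ → toLink e ≡ e′) K K′ → Conn (upTo n) K′ → T (connectedᵇ n K)
  from {K} rs conn = Conn⇒connectedᵇ n K (subst (Conn (upTo n)) (sym (mapped rs)) conn)

-- At ρ = p / (p + q) the reliability is a homogeneous polynomial in p and q divided by (p + q)ᵐ.
umrg-hom : ∀ {n m} {G H : Graph n} → UMRG n m G → InC n m H →
  ∀ p q → 0 < p + q → hom (coefficients H) m p q ≤ hom (coefficients G) m p q
umrg-hom {n} {m} {G} {H} ((_ , G≡m) , best) inC@(_ , H≡m) p q 0<p+q = ι-cancel-≤ (begin
  ι (hom (coefficients H) m p q)    ≡⟨ scaled H H≡m ⟨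
  (D ^ℚ m) *ℚ Rel H ρ               ≤⟨ ℚ.*-monoˡ-≤-nonNeg (D ^ℚ m) {{ℚ.nonNegative (^ℚ-nonNeg (0≤ι (p + q)) m)}} (best H inC ρ 0≤ρ ρ≤1) ⟩
  (D ^ℚ m) *ℚ Rel G ρ               ≡⟨ scaled G G≡m ⟩
  ι (hom (coefficients G) m p q)    ∎)
  where
  open ℚ.≤-Reasoning
  D = ι (p + q)
  instance
    D-pos : ℚ.Positive D
    D-pos = ℚ.positive (ι-mono-< 0<p+q)
    D≢0 : ℚ.NonZero D
    D≢0 = ℚ.pos⇒nonZero D
    r-pos : ℚ.Positive (1/ D)
    r-pos = ℚ.1/pos⇒pos D
  r = 1/ D
  ρ = ι p *ℚ r
  scale : ∀ x → D *ℚ (x *ℚ r) ≡ x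
  scale x = begin-equality
    D *ℚ (x *ℚ r)   ≡⟨ solve 3 (λ D x r → D :* (x :* r) := x :* (D :* r)) refl D x r ⟩
    x *ℚ (D *ℚ r)   ≡⟨ cong (x *ℚ_) (ℚ.*-inverseʳ D) ⟩
    x *ℚ 1ℚ         ≡⟨ ℚ.*-identityʳ x ⟩
    x               ∎
    where open +-*-Solver
  complement : 1ℚ -ℚ ρ ≡ ι q *ℚ r
  complement = begin-equality
    1ℚ -ℚ ρ                            ≡⟨ cong (_-ℚ ρ) (ℚ.*-inverseʳ D) ⟨
    D *ℚ r -ℚ ρ                        ≡⟨ cong (λ d → d *ℚ r -ℚ ρ) (ι-+ p q) ⟩
    (ι p +ℚ ι q) *ℚ r -ℚ ι p *ℚ r      ≡⟨ solve 3 (λ p q r → (p :+ q) :* r :- p :* r := q :* r) refl (ι p) (ι q) r ⟩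
    ι q *ℚ r                           ∎
    where open +-*-Solver
  nonneg : ∀ k → 0ℚ ≤ℚ ι k *ℚ r
  nonneg k = ℚ.nonNegative⁻¹ (ι k *ℚ r) {{ℚ.nonNeg*nonNeg⇒nonNeg (ι k) {{ℚ.nonNegative (0≤ι k)}} r {{ℚ.pos⇒nonNeg r}}}}
  0≤ρ : 0ℚ ≤ℚ ρ
  0≤ρ = nonneg p
  ρ≤1 : ρ ≤ℚ 1ℚ
  ρ≤1 = begin
    ρ                    ≡⟨ ℚ.+-identityʳ ρ ⟨
    ρ +ℚ 0ℚ              ≤⟨ ℚ.+-monoʳ-≤ ρ (nonneg q) ⟩
    ρ +ℚ ι q *ℚ r        ≡⟨ cong (ρ +ℚ_) complement ⟨
    ρ +ℚ (1ℚ -ℚ ρ)       ≡⟨ solve 2 (λ ρ o → ρ :+ (o :- ρ) := o) refl ρ 1ℚ ⟩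
    1ℚ                   ∎
    where open +-*-Solver
  scaled : ∀ (J : Graph n) → numEdges J ≡ m → (D ^ℚ m) *ℚ Rel J ρ ≡ ι (hom (coefficients J) m p q)
  scaled J refl = begin-equality
    (D ^ℚ m) *ℚ Rel J ρ
      ≡⟨ cong ((D ^ℚ m) *ℚ_) (sum-subsets (1ℚ -ℚ ρ) ρ (connectedᵇ n) (edges J)) ⟩
    (D ^ℚ m) *ℚ ℚgen (1ℚ -ℚ ρ) ρ (connectedᵇ n) (edges J)
      ≡⟨ scaled-ℚgen {p = p} {q} (≡-trans (cong (D *ℚ_) complement) (scale (ι q))) (scale (ι p)) (connectedᵇ n) (edges J) ⟩
    ι (gen (λ K → T? (connectedᵇ n K)) p q (edges J))
      ≡⟨ cong ι (genᵇ≡hom J p q) ⟩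
    ι (hom (coefficients J) m p q) ∎

-- Subdivisions

-- The l inner vertices n, n + 1, … exceed all earlier ones, so the links remain ascending.
path : ℕ → ℕ → ℕ → ℕ → List Link
path n a b zero    = (a , b) ∷ []
path n a b (suc l) = (b , n) ∷ path (suc n) a n l

-- Labels passed to `expand` count inner vertices. A path with l of them has l + 1 edges, and this
-- is the weight that `N` must see.
lengthen : Weighted Link → Weighted Link
lengthen = map λ (e , l) → e , suc l

expand : ℕ → Weighted Link → List Link
expand n []                  = []
expand n (((a , b) , l) ∷ E) = path n a b l ++ expand (n + l) E

below-weaken : ∀ {m n} → m ≤ n → ∀ {K} → All (Below m) K → All (Below n) K
below-weaken m≤n = All.map λ (x< , y<) → <-≤-trans x< m≤n , <-≤-trans y< m≤n

path-below : ∀ n {a b} l → a < n → b < n → All (Below (n + l)) (path n a b l)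
path-below n zero    a<n b<n rewrite +-identityʳ n = (a<n , b<n) ∷ []
path-below n (suc l) a<n b<n rewrite +-suc n l =
  (≤-trans b<n (m≤n⇒m≤1+n (m≤m+n n l)) , s≤s (m≤m+n n l)) ∷ path-below (suc n) l (m<n⇒m<1+n a<n) ≤-refl

upTo-suc-↭ : ∀ n → upTo (suc n) ↭ n ∷ upTo n
upTo-suc-↭ n rewrite sym (List.upTo-∷ʳ n) = ↭-sym (↭.∷↭∷ʳ n (upTo n))

below-avoids : ∀ {n K} → All (Below n) K → All (Avoids n) K
below-avoids = All.map λ (x< , y<) → <⇒≢ x< , <⇒≢ y<

-- By induction the part of the path beyond its first inner vertex `n` collapses to one link. Then
-- `n` has degree two, and `N-series` absorbs the remaining link from `b` to `n`.
N-path : ∀ n l {a b E} → a < n → b < n → All (Below n) (links E) → ∀ i →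
  N (upTo (n + l)) i (ones (path n a b l) ++ E) ≡ N (upTo n) i (((a , b) , suc l) ∷ E)
N-path n zero    a<n b<n below i rewrite +-identityʳ n = refl
N-path n (suc l) {a} {b} {E} a<n b<n below i rewrite +-suc n l = begin
  N (upTo (suc n + l)) i (((b , n) , 1) ∷ ones P ++ E)
    ≡⟨ N-↭ (↭-sym (↭.shift ((b , n) , 1) (ones P) E)) i ⟩
  N (upTo (suc n + l)) i (ones P ++ ((b , n) , 1) ∷ E)
    ≡⟨ N-path (suc n) l (m<n⇒m<1+n a<n) ≤-refl ((m<n⇒m<1+n b<n , ≤-refl) ∷ below-weaken (n≤1+n n) below) i ⟩
  N (upTo (suc n)) i (((a , n) , suc l) ∷ ((b , n) , 1) ∷ E)
    ≡⟨ N-≈ {upTo (suc n)} (trans flip (≈-prep ((n , a) , suc l) (flip {b} {n} {1} {E}))) i ⟩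
  N (upTo (suc n)) i (((n , a) , suc l) ∷ ((n , b) , 1) ∷ E)
    ≡⟨ N-V↭ (upTo-suc-↭ n) i (((n , a) , suc l) ∷ ((n , b) , 1) ∷ E) ⟩
  N (n ∷ upTo n) i (((n , a) , suc l) ∷ ((n , b) , 1) ∷ E)
    ≡⟨ N-series (λ n∈ → <-irrefl refl (∈.∈-upTo⁻ n∈)) {w = suc l} {w′ = 1} {E = E} (∈.∈-upTo⁺ a<n) (∈.∈-upTo⁺ b<n) (All.map⁻ (below-avoids below)) i ⟩
  N (upTo n) i (((a , b) , suc l + 1) ∷ E)
    ≡⟨ cong (λ w → N (upTo n) i (((a , b) , w) ∷ E)) (+-comm (suc l) 1) ⟩
  N (upTo n) i (((a , b) , suc (suc l)) ∷ E) ∎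
  where
  open ≡-Reasoning
  P = path (suc n) a n l

-- `F` is a reservoir for links outside the current expansion: the path of the first link waits
-- there while the later ones collapse.
N-expand : ∀ n E {F} → All (Below n) (links E) → All (Below n) (links F) → ∀ i →
  N (upTo (n + weight E)) i (ones (expand n E) ++ F) ≡ N (upTo n) i (lengthen E ++ F)
N-expand n [] below belowF i rewrite +-identityʳ n = refl
N-expand n (((a , b) , l) ∷ E) {F} ((a<n , b<n) ∷ below) belowF i rewrite sym (+-assoc n l (weight E)) = begin
  N V i (ones (P ++ X) ++ F)
    ≡⟨ cong (λ L → N V i (L ++ F)) (List.map-++ (_, 1) P X) ⟩
  N V i ((ones P ++ ones X) ++ F)
    ≡⟨ N-↭ (↭.++⁺ʳ F (↭.++-comm (ones P) (ones X))) i ⟩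
  N V i ((ones X ++ ones P) ++ F)
    ≡⟨ cong (N V i) (List.++-assoc (ones X) (ones P) F) ⟩
  N V i (ones X ++ (ones P ++ F))
    ≡⟨ N-expand (n + l) E (below-weaken (m≤m+n n l) below) belowPF i ⟩
  N (upTo (n + l)) i (lengthen E ++ (ones P ++ F))
    ≡⟨ N-↭ (↭.shifts (lengthen E) (ones P)) i ⟩
  N (upTo (n + l)) i (ones P ++ (lengthen E ++ F))
    ≡⟨ N-path n l a<n b<n belowEF i ⟩
  N (upTo n) i (((a , b) , suc l) ∷ lengthen E ++ F) ∎
  where
  open ≡-Reasoning
  P = path n a b l
  X = expand (n + l) E
  V = upTo (n + l + weight E)
  belowPF : All (Below (n + l)) (links (ones P ++ F))
  belowPF rewrite List.map-++ proj₁ (ones P) F | links-ones P =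
    All.++⁺ (path-below n l a<n b<n) (below-weaken (m≤m+n n l) belowF)
  belowEF : All (Below n) (links (lengthen E ++ F))
  belowEF rewrite List.map-++ proj₁ (lengthen E) F | sym (List.map-∘ {g = proj₁} {f = λ (e , l) → e , suc l} E) =
    All.++⁺ below belowF

expand-below : ∀ n E → All (Below n) (links E) → All (Below (n + weight E)) (expand n E)
expand-below n [] [] = []
expand-below n (((a , b) , l) ∷ E) ((a<n , b<n) ∷ below) rewrite sym (+-assoc n l (weight E)) =
  All.++⁺ (below-weaken (m≤m+n (n + l) (weight E)) (path-below n l a<n b<n))
          (expand-below (n + l) E (below-weaken (m≤m+n n l) below))

length-path : ∀ n a b l → length (path n a b l) ≡ suc l
length-path n a b zero    = refl
length-path n a b (suc l) = cong suc (length-path (suc n) a n l)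

length-expand : ∀ n E → length (expand n E) ≡ weight E + length E
length-expand n [] = refl
length-expand n (((a , b) , l) ∷ E) = begin
  length (path n a b l ++ expand (n + l) E)        ≡⟨ List.length-++ (path n a b l) ⟩
  length (path n a b l) + length (expand (n + l) E) ≡⟨ cong₂ _+_ (length-path n a b l) (length-expand (n + l) E) ⟩
  suc l + (weight E + length E)                    ≡⟨ regroup l (weight E) (length E) ⟩
  l + weight E + suc (length E)                    ∎
  where
  open ≡-Reasoning
  regroup : ∀ l w k → suc l + (w + k) ≡ l + w + suc k
  regroup = solve-∀

Ascending : Link → Set
Ascending (x , y) = x < y

path-ascending : ∀ n {a b} l → a < b → b < n → All Ascending (path n a b l)
path-ascending n zero    a<b b<n = a<b ∷ []
path-ascending n (suc l) a<b b<n = b<n ∷ path-ascending (suc n) l (<-trans a<b b<n) ≤-refl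

expand-ascending : ∀ n E → All Ascending (links E) → All (Below n) (links E) → All Ascending (expand n E)
expand-ascending n [] [] [] = []
expand-ascending n (((a , b) , l) ∷ E) (a<b ∷ asc) ((a<n , b<n) ∷ below) =
  All.++⁺ (path-ascending n l a<b b<n) (expand-ascending (n + l) E asc (below-weaken (m≤m+n n l) below))

path-links : ∀ n {a b} l {e} → e ∈ path n a b l → e ≡ (a , b) ⊎ n ≤ proj₂ e
path-links n zero    (here refl) = inj₁ refl
path-links n (suc l) (here refl) = inj₂ ≤-refl
path-links n (suc l) (there e∈) with path-links (suc n) l e∈
... | inj₁ refl = inj₂ ≤-refl
... | inj₂ le   = inj₂ (<⇒≤ le)

-- A link of the subdivision is an original one left undivided, or its upper end is a new vertex.
-- This dichotomy keeps the paths of different links disjoint and the graph simple.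
expand-links : ∀ n E {e} → e ∈ expand n E → e ∈ links E ⊎ n ≤ proj₂ e
expand-links n (((a , b) , l) ∷ E) e∈ with ∈.∈-++⁻ (path n a b l) e∈
... | inj₁ e∈P with path-links n l e∈P
...   | inj₁ refl = inj₁ (here refl)
...   | inj₂ le   = inj₂ le
expand-links n (((a , b) , l) ∷ E) e∈ | inj₂ e∈X with expand-links (n + l) E e∈X
...   | inj₁ e∈E  = inj₁ (there e∈E)
...   | inj₂ le   = inj₂ (m+n≤o⇒m≤o n le)

path-unique : ∀ n {a b} l → a < b → b < n → Unique (path n a b l)
path-unique n zero    a<b b<n = [] ∷ []
path-unique n {a} {b} (suc l) a<b b<n = All.tabulate new ∷ path-unique (suc n) l (<-trans a<b b<n) ≤-refl
  where
  new : ∀ {e} → e ∈ path (suc n) a n l → (b , n) ≢ e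
  new e∈ refl with path-links (suc n) l e∈
  ... | inj₁ refl = <-irrefl refl a<b
  ... | inj₂ le   = <-irrefl refl le

expand-unique : ∀ n E → Unique (links E) → All Ascending (links E) → All (Below n) (links E) → Unique (expand n E)
expand-unique n [] _ _ _ = []
expand-unique n (((a , b) , l) ∷ E) (ab∉ ∷ uniq) (a<b ∷ asc) ((a<n , b<n) ∷ below) =
  Unique.++⁺ (path-unique n l a<b b<n) (expand-unique (n + l) E uniq asc (below-weaken (m≤m+n n l) below)) disjoint
  where
  disjoint : ∀ {e} → e ∈ path n a b l × e ∈ expand (n + l) E → ⊥
  disjoint (e∈P , e∈X) with path-links n l e∈P | expand-links (n + l) E e∈X
  ... | inj₁ refl | inj₁ e∈E = All.lookup ab∉ e∈E refl
  ... | inj₁ refl | inj₂ le  = <-irrefl refl (<-≤-trans b<n (m+n≤o⇒m≤o n le))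
  ... | inj₂ le   | inj₁ e∈E = <-irrefl refl (<-≤-trans (proj₂ (All.lookup below e∈E)) le)
  ... | inj₂ _    | inj₂ le  = <-irrefl refl (<-≤-trans (proj₂ (All.lookup (path-below n l a<n b<n) e∈P)) le)

-- The simple graph with a given set of links

module _ {n : ℕ} (K : List Link) (ascending : All Ascending K) where

  link∈? : ∀ e → Dec (e ∈ K)
  link∈? e = any? (Product.≡-dec _≟_ _≟_ e) K

  fromLinks : Graph n
  fromLinks = record
    { adj    = λ i j → ⌊ link∈? (toLink (i , j)) ⌋ ∨ ⌊ link∈? (toLink (j , i)) ⌋
    ; sym    = λ i j → Bool.∨-comm ⌊ link∈? (toLink (i , j)) ⌋ ⌊ link∈? (toLink (j , i)) ⌋
    ; irrefl = λ i → noLoop i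
    }
    where
    noLoop : ∀ (i : Fin n) → (⌊ link∈? (toLink (i , i)) ⌋ ∨ ⌊ link∈? (toLink (i , i)) ⌋) ≡ false
    noLoop i with link∈? (toLink (i , i))
    ... | yes e∈ = contradiction (All.lookup ascending e∈) (<-irrefl refl)
    ... | no _   = refl

  edges⁻ : ∀ {e} → e ∈ map toLink (edges fromLinks) → e ∈ K
  edges⁻ e∈ with (i , j) , ij∈ , refl ← ∈.∈-map⁻ toLink e∈
    with i′ , _ , ij∈′ ← find (∈.∈-concatMap⁻ (λ i → map (i ,_) (filter (λ j → T? ((toℕ i <ᵇ toℕ j) ∧ adj fromLinks i j)) (allFin n))) {xs = allFin n} ij∈)
    with j′ , j∈ , refl ← ∈.∈-map⁻ (i′ ,_) ij∈′
    with _ , t ← ∈.∈-filter⁻ (λ j → T? ((toℕ i <ᵇ toℕ j) ∧ adj fromLinks i j)) {xs = allFin n} j∈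
    with lt , t′ ← Equivalence.to Bool.T-∧ t
    with Equivalence.to (Bool.T-∨ {⌊ link∈? (toLink (i , j)) ⌋}) t′
  ... | inj₁ w = toWitness w
  ... | inj₂ w = contradiction (All.lookup ascending (toWitness w)) (<-asym (<ᵇ⇒< (toℕ i) (toℕ j) lt))

  edges⁺ : All (Below n) K → ∀ {e} → e ∈ K → e ∈ map toLink (edges fromLinks)
  edges⁺ below {x , y} e∈ = subst (_∈ map toLink (edges fromLinks)) eq (∈.∈-map⁺ toLink
    (∈.∈-concatMap⁺ (λ i → map (i ,_) (filter (λ j → T? ((toℕ i <ᵇ toℕ j) ∧ adj fromLinks i j)) (allFin n)))
      (lose (∈-allFin i) (∈.∈-map⁺ (i ,_) (∈.∈-filter⁺ (λ j → T? ((toℕ i <ᵇ toℕ j) ∧ adj fromLinks i j)) (∈-allFin j)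
        (Equivalence.from Bool.T-∧ (<⇒<ᵇ (All.lookup ascending e∈′) , Equivalence.from (Bool.T-∨ {⌊ link∈? (toLink (i , j)) ⌋}) (inj₁ (fromWitness {a? = link∈? (toLink (i , j))} e∈′)))))))))
    where
    i = fromℕ< (proj₁ (All.lookup below e∈))
    j = fromℕ< (proj₂ (All.lookup below e∈))
    eq : toLink (i , j) ≡ (x , y)
    eq = cong₂ _,_ (Fin.toℕ-fromℕ< _) (Fin.toℕ-fromℕ< _)
    e∈′ : toLink (i , j) ∈ K
    e∈′ = subst (_∈ K) (sym eq) e∈

allFin-unique : ∀ n → Unique (allFin n)
allFin-unique zero    = []
allFin-unique (suc n) = All.map⁺ (All.universal (λ _ ()) (allFin n)) ∷ Unique.map⁺ Fin.suc-injective (allFin-unique n)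

edges-unique : ∀ {n} (G : Graph n) → Unique (edges G)
edges-unique {n} G = Unique.concat⁺
  (All.map⁺ (All.universal (λ i → Unique.map⁺ (λ { refl → refl }) (Unique.filter⁺ _ (allFin-unique n))) (allFin n)))
  (AllPairs.map⁺ (AllPairs.map (λ i≢i′ {e} → disjoint i≢i′ {e = e}) (allFin-unique n)))
  where
  disjoint : ∀ {i i′ : Fin n} → i ≢ i′ → ∀ {js js′ : List (Fin n)} {e} → e ∈ map (i ,_) js × e ∈ map (i′ ,_) js′ → ⊥
  disjoint {i} {i′} i≢i′ (p , q) with _ , _ , refl ← ∈.∈-map⁻ (i ,_) p with _ , _ , refl ← ∈.∈-map⁻ (i′ ,_) q = i≢i′ refl

-- Both lists are free of duplicates and have the same members, hence agree up to order.
edges-fromLinks : ∀ {n K} (asc : All Ascending K) → All (Below n) K → Unique K → map toLink (edges {n} (fromLinks K asc)) ↭ K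
edges-fromLinks {n} {K} asc below uniq = ∼bag⇒↭ (unique∧set⇒bag
  (Unique.map⁺ (λ {e} {e′} → toLink-injective {e} {e′}) (edges-unique (fromLinks K asc))) uniq
  (mk⇔ (edges⁻ K asc) (edges⁺ K asc below)))
  where
  toLink-injective : ∀ {e e′ : Edge n} → toLink e ≡ toLink e′ → e ≡ e′
  toLink-injective eq with eq₁ , eq₂ ← Product.,-injective eq = cong₂ _,_ (Fin.toℕ-injective eq₁) (Fin.toℕ-injective eq₂)

cnt₀⇒ : ∀ {A : Set} {P : List A → Set} (P? : Decidable P) E → 1 ≤ cnt P? 0 E → P (map proj₁ E)
cnt₀⇒ P? [] pos with P? []
... | yes p = p
cnt₀⇒ P? ((e , w) ∷ E) pos rewrite *-zeroʳ w | +-identityʳ (cnt (λ K → P? (e ∷ K)) 0 E) = cnt₀⇒ (λ K → P? (e ∷ K)) E pos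

-- Connectedness of the subdivision is read off from the count of index 0, which `N-expand`
-- transfers from the small multigraph.
realise : ∀ k E → Unique (links E) → All Ascending (links E) → All (Below k) (links E) → 1 ≤ N (upTo k) 0 (lengthen E) →
  let n = k + weight E in
  ∃ λ (H : Graph n) → InC n (weight E + length E) H × ∀ i → coefficients H i ≡ N (upTo k) i (lengthen E)
realise k E uniq asc below conn₀ = H , (connected , edgeCount) , counts
  where
  K = expand k E
  n = k + weight E
  ascK = expand-ascending k E asc below
  H = fromLinks {n} K ascK
  same : map toLink (edges H) ↭ K
  same = edges-fromLinks ascK (expand-below k E below) (expand-unique k E uniq asc below)
  edgeCount : numEdges H ≡ weight E + length E
  edgeCount = ≡-trans (sym (List.length-map toLink (edges H))) (≡-trans (↭.↭-length same) (length-expand k E))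
  counts : ∀ i → coefficients H i ≡ N (upTo k) i (lengthen E)
  counts i = begin
    N (upTo n) i (ones (map toLink (edges H))) ≡⟨ N-↭ (↭.map⁺ (_, 1) same) i ⟩
    N (upTo n) i (ones K)                      ≡⟨ cong (N (upTo n) i) (List.++-identityʳ (ones K)) ⟨
    N (upTo n) i (ones K ++ [])                ≡⟨ N-expand k E below [] i ⟩
    N (upTo k) i (lengthen E ++ [])            ≡⟨ cong (N (upTo k) i) (List.++-identityʳ (lengthen E)) ⟩
    N (upTo k) i (lengthen E)                  ∎
    where open ≡-Reasoning
  connected : connectedᵇ n (edges H) ≡ true
  connected = T⇒≡ (Conn⇒connectedᵇ n (edges H) (subst (Conn (upTo n)) (links-ones _)
    (cnt₀⇒ (conn? (upTo n)) (ones (map toLink (edges H))) (subst (1 ≤_) (sym (counts 0)) conn₀))))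

-- Counts with weights affine in a parameter

Poly : Set
Poly = List ℕ

⟦_⟧ : Poly → ℕ → ℕ
⟦ [] ⟧    u = 0
⟦ c ∷ p ⟧ u = c + u * ⟦ p ⟧ u

infixl 6 _⊕_
_⊕_ : Poly → Poly → Poly
[]      ⊕ q       = q
(c ∷ p) ⊕ []      = c ∷ p
(c ∷ p) ⊕ (d ∷ q) = (c + d) ∷ (p ⊕ q)

infixr 7 _·_ X+_·_
_·_ : ℕ → Poly → Poly
c · p = map (c *_) p

X+_·_ : ℕ → Poly → Poly
X+ c · p = (c · p) ⊕ (0 ∷ p)

⟦⊕⟧ : ∀ p q u → ⟦ p ⊕ q ⟧ u ≡ ⟦ p ⟧ u + ⟦ q ⟧ u
⟦⊕⟧ []      q       u = refl
⟦⊕⟧ (c ∷ p) []      u = sym (+-identityʳ _)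
⟦⊕⟧ (c ∷ p) (d ∷ q) u = ≡-trans (cong (λ x → c + d + u * x) (⟦⊕⟧ p q u)) (regroup c d u _ _)
  where
  regroup : ∀ c d u x y → c + d + u * (x + y) ≡ c + u * x + (d + u * y)
  regroup = solve-∀

⟦·⟧ : ∀ c p u → ⟦ c · p ⟧ u ≡ c * ⟦ p ⟧ u
⟦·⟧ c []      u = sym (*-zeroʳ c)
⟦·⟧ c (d ∷ p) u = ≡-trans (cong (λ x → c * d + u * x) (⟦·⟧ c p u)) (regroup c d u _)
  where
  regroup : ∀ c d u x → c * d + u * (c * x) ≡ c * (d + u * x)
  regroup = solve-∀

⟦X+·⟧ : ∀ c p u → ⟦ X+ c · p ⟧ u ≡ (u + c) * ⟦ p ⟧ u
⟦X+·⟧ c p u = ≡-trans (⟦⊕⟧ (c · p) (0 ∷ p) u) (≡-trans (cong (_+ u * ⟦ p ⟧ u) (⟦·⟧ c p u)) (regroup c u _))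
  where
  regroup : ∀ c u x → c * x + u * x ≡ (u + c) * x
  regroup = solve-∀

-- Coefficientwise comparison: a condition decided by evaluation that gives the inequality for every
-- natural value of the variable.
_≼_ : Poly → Poly → Bool
[]      ≼ q       = true
(c ∷ p) ≼ []      = false
(c ∷ p) ≼ (d ∷ q) = (c ≤ᵇ d) ∧ (p ≼ q)

≼-sound : ∀ p q → p ≼ q ≡ true → ∀ u → ⟦ p ⟧ u ≤ ⟦ q ⟧ u
≼-sound []      q       _  u = z≤n
≼-sound (c ∷ p) (d ∷ q) ok u with c≤d , p≼q ← ∧-true ok =
  +-mono-≤ (≤ᵇ-true c≤d) (*-monoʳ-≤ u (≼-sound p q p≼q u))

prevₚ : (ℕ → Poly) → ℕ → Poly
prevₚ g zero    = []
prevₚ g (suc i) = g i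

-- The count with weights `u + c`, as a polynomial in the indeterminate u, so that a single
-- evaluation covers all large graphs.
cntₚ : ∀ {A : Set} {P : List A → Set} → Decidable P → ℕ → Weighted A → Poly
cntₚ P? i []            = indicator (P? []) i ∷ []
cntₚ P? i ((e , c) ∷ E) = cntₚ (λ K → P? (e ∷ K)) i E ⊕ (X+ c · prevₚ (λ j → cntₚ P? j E) i)

raise : ∀ {A : Set} → ℕ → Weighted A → Weighted A
raise u = map λ (e , c) → e , u + c

⟦cntₚ⟧ : ∀ {A : Set} {P : List A → Set} (P? : Decidable P) i E u → ⟦ cntₚ P? i E ⟧ u ≡ cnt P? i (raise u E)
⟦cntₚ⟧ P? i []            u = ≡-trans (cong (indicator (P? []) i +_) (*-zeroʳ u)) (+-identityʳ _)
⟦cntₚ⟧ P? i ((e , c) ∷ E) u = begin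
  ⟦ cntₚ _ i E ⊕ (X+ c · prevₚ g i) ⟧ u         ≡⟨ ⟦⊕⟧ (cntₚ _ i E) (X+ c · prevₚ g i) u ⟩
  ⟦ cntₚ _ i E ⟧ u + ⟦ X+ c · prevₚ g i ⟧ u     ≡⟨ cong₂ _+_ (⟦cntₚ⟧ _ i E u) (⟦X+·⟧ c (prevₚ g i) u) ⟩
  cnt _ i (raise u E) + (u + c) * ⟦ prevₚ g i ⟧ u ≡⟨ cong (λ x → cnt _ i (raise u E) + (u + c) * x) (⟦prevₚ⟧ i) ⟩
  cnt P? i (raise u ((e , c) ∷ E))              ∎
  where
  open ≡-Reasoning
  g = λ j → cntₚ P? j E
  ⟦prevₚ⟧ : ∀ i → ⟦ prevₚ g i ⟧ u ≡ prev (λ j → cnt P? j (raise u E)) i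
  ⟦prevₚ⟧ zero    = refl
  ⟦prevₚ⟧ (suc i) = ⟦cntₚ⟧ P? i E u

X+_^_ : ℕ → ℕ → Poly
X+ c ^ zero  = 1 ∷ []
X+ c ^ suc k = X+ c · (X+ c ^ k)

⟦X+^⟧ : ∀ c k u → ⟦ X+ c ^ k ⟧ u ≡ (u + c) ^ k
⟦X+^⟧ c zero    u = cong suc (*-zeroʳ u)
⟦X+^⟧ c (suc k) u = ≡-trans (⟦X+·⟧ c (X+ c ^ k) u) (cong ((u + c) *_) (⟦X+^⟧ c k u))

≼-power : ∀ a c k q → ((1 ∷ []) ⊕ (a · (X+ c ^ k))) ≼ q ≡ true → ∀ u → suc (a * (u + c) ^ k) ≤ ⟦ q ⟧ u
≼-power a c k q ok u = begin
  suc (a * (u + c) ^ k)                   ≡⟨ cong₂ (λ x y → suc (x + y)) (*-zeroʳ u) (cong (a *_) (⟦X+^⟧ c k u)) ⟨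
  ⟦ 1 ∷ [] ⟧ u + a * ⟦ X+ c ^ k ⟧ u       ≡⟨ cong (⟦ 1 ∷ [] ⟧ u +_) (⟦·⟧ a (X+ c ^ k) u) ⟨
  ⟦ 1 ∷ [] ⟧ u + ⟦ a · (X+ c ^ k) ⟧ u     ≡⟨ ⟦⊕⟧ (1 ∷ []) (a · (X+ c ^ k)) u ⟨
  ⟦ (1 ∷ []) ⊕ (a · (X+ c ^ k)) ⟧ u       ≤⟨ ≼-sound ((1 ∷ []) ⊕ (a · (X+ c ^ k))) q ok u ⟩
  ⟦ q ⟧ u                                 ∎
  where open ≤-Reasoning

-- The Wagner graph

rims chords wagner : List Link
rims   = (0 , 1) ∷ (1 , 2) ∷ (2 , 3) ∷ (3 , 4) ∷ (4 , 5) ∷ (5 , 6) ∷ (6 , 7) ∷ (0 , 7) ∷ []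
chords = (0 , 4) ∷ (1 , 5) ∷ (2 , 6) ∷ (3 , 7) ∷ []
wagner = rims ++ chords

wagner-survives₀ : survives (conn? (upTo 8)) 0 wagner ≡ true
wagner-survives₀ = refl

wagner-survives₁ : survives (conn? (upTo 8)) 1 wagner ≡ true
wagner-survives₁ = refl

-- The Wagner graph is 3-edge-connected, which makes `cnt₂-≤` an equality for its subdivisions.
wagner-survives₂ : survives (conn? (upTo 8)) 2 wagner ≡ true
wagner-survives₂ = refl

-- Of the 392 spanning trees, 168 avoid a given chord but only 161 avoid a given rim edge, so
-- lengthening the chords at the expense of the rim gains in first order. The weights are
-- t - 200 and t + 400 at t = 5000, where the gain outweighs the lower-order terms.
skew : Weighted Link
skew = map (_, 4800) rims ++ map (_, 5400) chords

-- The coefficients of `u ^ 5` agree at 392. At `u ^ 4` the surplus is `56 · 200 - 5880 = 5320`, and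
-- the base point 5000 is large enough for the lower coefficients to follow. The summand 1 makes the
-- resulting inequality strict.
skew-beats-cubic : ((1 ∷ []) ⊕ (392 · (X+ 5003 ^ 5))) ≼ cntₚ (conn? (upTo 8)) 5 skew ≡ true
skew-beats-cubic = refl

skew-trees : ∀ u → suc (392 * (u + 5003) ^ 5) ≤ N (upTo 8) 5 (raise u skew)
skew-trees u = subst (suc (392 * (u + 5003) ^ 5) ≤_) (⟦cntₚ⟧ (conn? (upTo 8)) 5 skew u)
  (≼-power 392 5003 5 (cntₚ (conn? (upTo 8)) 5 skew) skew-beats-cubic u)

wagner-unique : Unique wagner
wagner-unique = from-yes (allPairs? (λ e e′ → ¬? (Product.≡-dec _≟_ _≟_ e e′)) wagner)

wagner-ascending : All Ascending wagner
wagner-ascending = from-yes (All.all? (λ (x , y) → x <? y) wagner)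

wagner-below : All (Below 8) wagner
wagner-below = from-yes (All.all? (λ (x , y) → x <? 8 ×-dec y <? 8) wagner)

links-lengthen : ∀ E → links (lengthen E) ≡ links E
links-lengthen []      = refl
links-lengthen (_ ∷ E) = cong (_ ∷_) (links-lengthen E)

realise-wagner : ∀ {n} E → links E ≡ wagner → n ≡ 8 + weight E →
  ∃ λ (H : Graph n) → InC n (n + 4) H × ∀ i → coefficients H i ≡ N (upTo 8) i (lengthen E)
realise-wagner E shape refl =
  let H , (conn , size) , counts = realise 8 E (subst Unique (sym shape) wagner-unique)
        (subst (All Ascending) (sym shape) wagner-ascending) (subst (All (Below 8)) (sym shape) wagner-below)
        (survives₀ (conn? (upTo 8)) (lengthen E) (subst (λ K → survives (conn? (upTo 8)) 0 K ≡ true) (sym (≡-trans (links-lengthen E) shape)) wagner-survives₀))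
  in H , (conn , ≡-trans size (≡-trans (cong (weight E +_) (≡-trans (sym (List.length-map proj₁ E)) (cong length shape))) (regroup (weight E)))) , counts
  where
  regroup : ∀ w → w + 12 ≡ 8 + w + 4
  regroup = solve-∀

-- Evenly subdivided Wagner graphs

balanced : ℕ → ℕ → List Link → Weighted Link
balanced t r       []      = []
balanced t zero    (e ∷ K) = (e , t) ∷ balanced t zero K
balanced t (suc r) (e ∷ K) = (e , suc t) ∷ balanced t r K

links-balanced : ∀ t r K → links (balanced t r K) ≡ K
links-balanced t r       []      = refl
links-balanced t zero    (e ∷ K) = cong (e ∷_) (links-balanced t zero K)
links-balanced t (suc r) (e ∷ K) = cong (e ∷_) (links-balanced t r K)

lengthen-balanced : ∀ t r K → lengthen (balanced t r K) ≡ balanced (suc t) r K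
lengthen-balanced t r       []      = refl
lengthen-balanced t zero    (e ∷ K) = cong (_ ∷_) (lengthen-balanced t zero K)
lengthen-balanced t (suc r) (e ∷ K) = cong (_ ∷_) (lengthen-balanced t r K)

weight-balanced : ∀ t r K → r ≤ length K → weight (balanced t r K) ≡ length K * t + r
weight-balanced t zero    []      _         = refl
weight-balanced t zero    (e ∷ K) _         = ≡-trans (cong (t +_) (weight-balanced t zero K z≤n)) (sym (+-assoc t (length K * t) 0))
weight-balanced t (suc r) (e ∷ K) (s≤s r≤K) = ≡-trans (cong (suc t +_) (weight-balanced t r K r≤K)) (regroup t (length K * t) r)
  where
  regroup : ∀ t x r → suc t + (x + r) ≡ t + x + suc r
  regroup = solve-∀

weight²-balanced : ∀ t r K → r ≤ length K → weight² (balanced t r K) ≡ length K * (t * t) + 2 * t * r + r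
weight²-balanced t zero    []      _         = sym (≡-trans (+-identityʳ _) (*-zeroʳ (2 * t)))
weight²-balanced t zero    (e ∷ K) _         = ≡-trans (cong (t * t +_) (weight²-balanced t zero K z≤n)) (regroup t (length K * (t * t)))
  where
  regroup : ∀ t x → t * t + (x + 2 * t * 0 + 0) ≡ t * t + x + 2 * t * 0 + 0
  regroup = solve-∀
weight²-balanced t (suc r) (e ∷ K) (s≤s r≤K) = ≡-trans (cong (suc t * suc t +_) (weight²-balanced t r K r≤K)) (regroup t (length K * (t * t)) r)
  where
  regroup : ∀ t x r → suc t * suc t + (x + 2 * t * r + r) ≡ t * t + x + 2 * t * suc r + suc r
  regroup = solve-∀

-- Near-optimal second coefficients force near-equal weights

private
  square-gap : ∀ t d → 2 * t * (t + d) + d * d ≡ (t + d) * (t + d) + t * t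
  square-gap = solve-∀
  square-gap′ : ∀ w d → 2 * (w + d) * w + d * d ≡ w * w + (w + d) * (w + d)
  square-gap′ = solve-∀

am-gm : ∀ t w → 2 * t * w ≤ w * w + t * t
am-gm t w with ≤-total t w
... | inj₁ t≤w with d , refl ← m≤n⇒∃[o]m+o≡n t≤w = ≤-trans (m≤m+n _ _) (≤-reflexive (square-gap t d))
... | inj₂ w≤t with d , refl ← m≤n⇒∃[o]m+o≡n w≤t = ≤-trans (m≤m+n _ _) (≤-reflexive (square-gap′ w d))

private
  split-tangent : ∀ t w s → 2 * t * (w + s) ≡ 2 * t * w + 2 * t * s
  split-tangent = solve-∀
  join-tangent : ∀ a b c d → a + b + (c + d) ≡ a + c + (b + d)
  join-tangent = solve-∀

-- The sum of `(w - t)²` over the links is nonnegative, expanded so as to avoid subtraction.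
tangent : ∀ t (E : Weighted Link) → 2 * t * weight E ≤ weight² E + length E * (t * t)
tangent t []            = ≤-reflexive (*-zeroʳ (2 * t))
tangent t ((e , w) ∷ E) = begin
  2 * t * (w + weight E)                                    ≡⟨ split-tangent t w (weight E) ⟩
  2 * t * w + 2 * t * weight E                              ≤⟨ +-mono-≤ (am-gm t w) (tangent t E) ⟩
  w * w + t * t + (weight² E + length E * (t * t))          ≡⟨ join-tangent (w * w) (t * t) (weight² E) _ ⟩
  w * w + weight² E + (t * t + length E * (t * t))          ∎
  where open ≤-Reasoning

-- The same sum with the one term that is at least `d²` retained.
tangent-excess : ∀ t d {E : Weighted Link} {e} → e ∈ E → t + d ≤ proj₂ e → 2 * t * weight E + d * d ≤ weight² E + length E * (t * t)
tangent-excess t d {(e , w) ∷ E} (here refl) t+d≤w with x , refl ← m≤n⇒∃[o]m+o≡n t+d≤w = begin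
  2 * t * (w + weight E) + d * d                            ≡⟨ cong (_+ d * d) (split-tangent t w (weight E)) ⟩
  2 * t * w + 2 * t * weight E + d * d                      ≤⟨ +-monoʳ-≤ (2 * t * w + 2 * t * weight E) (*-mono-≤ (m≤m+n d x) (m≤m+n d x)) ⟩
  2 * t * w + 2 * t * weight E + (d + x) * (d + x)          ≡⟨ swap-last (2 * t * w) (2 * t * weight E) _ ⟩
  2 * t * w + (d + x) * (d + x) + 2 * t * weight E          ≡⟨ cong (λ w → 2 * t * w + (d + x) * (d + x) + 2 * t * weight E) (+-assoc t d x) ⟩
  2 * t * (t + (d + x)) + (d + x) * (d + x) + 2 * t * weight E ≤⟨ +-mono-≤ (≤-reflexive (square-gap t (d + x))) (tangent t E) ⟩
  (t + (d + x)) * (t + (d + x)) + t * t + (weight² E + length E * (t * t)) ≡⟨ cong (λ w → w * w + t * t + (weight² E + length E * (t * t))) (+-assoc t d x) ⟨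
  w * w + t * t + (weight² E + length E * (t * t))          ≡⟨ join-tangent (w * w) (t * t) (weight² E) _ ⟩
  w * w + weight² E + (t * t + length E * (t * t))          ∎
  where
  open ≤-Reasoning
  swap-last : ∀ a b c → a + b + c ≡ a + c + b
  swap-last = solve-∀
tangent-excess t d {(e , w) ∷ E} (there e∈) t+d≤w = begin
  2 * t * (w + weight E) + d * d                            ≡⟨ cong (_+ d * d) (split-tangent t w (weight E)) ⟩
  2 * t * w + 2 * t * weight E + d * d                      ≡⟨ +-assoc (2 * t * w) (2 * t * weight E) (d * d) ⟩
  2 * t * w + (2 * t * weight E + d * d)                    ≤⟨ +-mono-≤ (am-gm t w) (tangent-excess t d e∈ t+d≤w) ⟩
  w * w + t * t + (weight² E + length E * (t * t))          ≡⟨ join-tangent (w * w) (t * t) (weight² E) _ ⟩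
  w * w + weight² E + (t * t + length E * (t * t))          ∎
  where open ≤-Reasoning

module _ {t r : ℕ} (r<12 : r < 12) {E : Weighted Link} (total : weight E ≡ 12 * t + r)
         (near : weight² E ≤ 12 * (t * t) + 2 * t * r + r) where

  private
    lhs : ∀ t r → 2 * t * (12 * t + r) ≡ 24 * (t * t) + 2 * t * r
    lhs = solve-∀

  -- Spreading the total over at most eleven links costs about `t²` in the sum of squares, while
  -- `near` allows a loss of at most r.
  short⇒bounded : length E ≤ 11 → t * t < 12
  short⇒bounded short = ≤-<-trans (+-cancelˡ-≤ (23 * (t * t) + 2 * t * r) (t * t) r (begin
    23 * (t * t) + 2 * t * r + t * t                    ≡⟨ regroup t r ⟩
    24 * (t * t) + 2 * t * r                            ≡⟨ lhs t r ⟨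
    2 * t * (12 * t + r)                                ≡⟨ cong (2 * t *_) total ⟨
    2 * t * weight E                                    ≤⟨ tangent t E ⟩
    weight² E + length E * (t * t)                      ≤⟨ +-mono-≤ near (*-monoˡ-≤ (t * t) short) ⟩
    12 * (t * t) + 2 * t * r + r + 11 * (t * t)         ≡⟨ regroup′ t r ⟩
    23 * (t * t) + 2 * t * r + r                        ∎)) r<12
    where
    open ≤-Reasoning
    regroup : ∀ t r → 23 * (t * t) + 2 * t * r + t * t ≡ 24 * (t * t) + 2 * t * r
    regroup = solve-∀
    regroup′ : ∀ t r → 12 * (t * t) + 2 * t * r + r + 11 * (t * t) ≡ 23 * (t * t) + 2 * t * r + r
    regroup′ = solve-∀

  -- A weight of t + 4 or more would contribute `4² = 16` to the sum of `(w - t)²`, which is at most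
  -- r < 12.
  twelve⇒near-equal : length E ≡ 12 → All (λ e → proj₂ e ≤ t + 3) E
  twelve⇒near-equal twelve = All.tabulate λ {e} e∈ → ≮⇒≥ λ t+3<w → contradiction (+-cancelˡ-≤ (24 * (t * t) + 2 * t * r) 16 r (begin
    24 * (t * t) + 2 * t * r + 16                       ≡⟨ cong (_+ 16) (lhs t r) ⟨
    2 * t * (12 * t + r) + 16                           ≡⟨ cong (λ s → 2 * t * s + 16) total ⟨
    2 * t * weight E + 4 * 4                            ≤⟨ tangent-excess t 4 e∈ (≤-trans (≤-reflexive (+-suc t 3)) t+3<w) ⟩
    weight² E + length E * (t * t)                      ≤⟨ +-mono-≤ near (≤-reflexive (cong (_* (t * t)) twelve)) ⟩
    12 * (t * t) + 2 * t * r + r + 12 * (t * t)         ≡⟨ regroup t r ⟩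
    24 * (t * t) + 2 * t * r + r                        ∎)) (<⇒≱ (<-≤-trans r<12 (m≤m+n 12 4)))
    where
    open ≤-Reasoning
    regroup : ∀ t r → 12 * (t * t) + 2 * t * r + r + 12 * (t * t) ≡ 24 * (t * t) + 2 * t * r + r
    regroup = solve-∀

-- Coefficient bounds for a uniformly most reliable graph

frame-graph : ∀ {n} (G : Graph n) → InC n (n + 4) G → Frame (upTo n) (ones (map toLink (edges G)))
frame-graph {n} G (conn , size) = record
  { unique    = Unique.upTo⁺ n
  ; connected = subst (Conn (upTo n)) (sym (links-ones _)) (connectedᵇ⇒Conn n (edges G) (≡⇒T conn))
  ; within    = subst (All (Within (upTo n))) (sym (links-ones _)) (All.map⁺ (All.universal (λ (i , j) → ∈.∈-upTo⁺ (Fin.toℕ<n i) , ∈.∈-upTo⁺ (Fin.toℕ<n j)) (edges G)))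
  ; corank    = begin
      length (ones (map toLink (edges G)))  ≡⟨ List.length-map (_, 1) (map toLink (edges G)) ⟩
      length (map toLink (edges G))         ≡⟨ List.length-map toLink (edges G) ⟩
      numEdges G                            ≡⟨ size ⟩
      n + 4                                 ≡⟨ cong (_+ 4) (List.length-upTo n) ⟨
      length (upTo n) + 4                   ∎
  }
  where open ≡-Reasoning

cubic-links : ∀ {V E} → Frame V E → All (λ v → deg v (links E) ≡ 3) V → Cubic V (links E)
cubic-links {V} {E} fr degree = record
  { frame  = record
    { unique    = Frame.unique fr
    ; connected = subst (Conn V) (sym (links-ones _)) (Frame.connected fr)
    ; within    = subst (All (Within V)) (sym (links-ones _)) (Frame.within fr)
    ; corank    = ≡-trans (List.length-map (_, 1) (links E)) (≡-trans (List.length-map proj₁ E) (Frame.corank fr))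
    }
  ; degree = degree
  }

module _ {n : ℕ} {G : Graph n} (umrg : UMRG n (n + 4) G) where

  private
    inC = proj₁ umrg
    a = coefficients G
    E₀ = ones (map toLink (edges G))

    weight-E₀ : weight E₀ ≡ n + 4
    weight-E₀ = ≡-trans (weight-ones (map toLink (edges G))) (≡-trans (List.length-map toLink (edges G)) (proj₂ inC))

  module _ {H : Graph n} (inC′ : InC n (n + 4) H) where

    -- The hypotheses say that `H` reaches the largest possible values 1 and `n + 4` of the first
    -- two coefficients, so the comparison for small ρ is decided at index 2.
    second-coefficient : 1 ≤ coefficients H 0 → n + 4 ≤ coefficients H 1 → coefficients H 2 ≤ a 2
    second-coefficient b₀ b₁ = compare-low a (coefficients H) (suc n)
      (subst (λ m → ∀ p q → 0 < p + q → hom (coefficients H) m p q ≤ hom a m p q) (+-comm n 4) (umrg-hom {G = G} {H = H} umrg inC′))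
      (≤-trans (cnt₀-≤ (conn? (upTo n)) E₀) b₀) (≤-trans (cnt₁-≤ (conn? (upTo n)) E₀) (≤-trans (≤-reflexive weight-E₀) b₁))

    -- The coefficients of `G` vanish beyond index 5 by `N-large`, and `2 ≤ n` provides the six
    -- edges that `compare-high` presupposes.
    fifth-coefficient : 2 ≤ n → coefficients H 5 ≤ a 5
    fifth-coefficient 2≤n = compare-high a (coefficients H) (n ∸ 2)
      (subst (λ m → ∀ p q → 0 < p + q → hom (coefficients H) m p q ≤ hom a m p q) (≡-trans (+-comm n 4) (cong (4 +_) (sym (m+[n∸m]≡n 2≤n)))) (umrg-hom {G = G} {H = H} umrg inC′))
      λ i → N-large {upTo n} {E₀} {6 + i} (Unique.upTo⁺ n) (begin-strict
        suc (length E₀)            ≡⟨ cong suc (Frame.corank (frame-graph G inC)) ⟩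
        suc (length (upTo n) + 4)  ≡⟨ +-suc (length (upTo n)) 4 ⟨
        length (upTo n) + 5        <⟨ +-monoʳ-< (length (upTo n)) (s≤s (m≤m+n 5 i)) ⟩
        length (upTo n) + (6 + i)  ∎)
      where open ≤-Reasoning

  -- The last hypothesis says that the second coefficient is at least that of the even Wagner
  -- subdivision, and it bounds the squared weights of the reduced multigraph. Orders below eight
  -- fail because `4 ≤ t` contradicts `t² < 12`.
  spanning-trees-bound : ∀ {t r} → r < 12 → 4 ≤ t → n + 4 ≡ 12 * t + r →
    (12 * t + r) * (12 * t + r) ≤ 2 * a 2 + (12 * (t * t) + 2 * t * r + r) → a 5 ≤ 392 * (t + 3) ^ 5
  spanning-trees-bound {t} {r} r<12 4≤t m≡ optimal₂
    with V , E , fr , cub , dom ← reduce n (List.length-upTo n) (frame-graph G inC) = byOrder (m≤n⇒m<n∨m≡n (order≤8 fr cub))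
    where
    open ≤-Reasoning
    total : weight E ≡ 12 * t + r
    total = ≡-trans (Dominates.weights dom) (≡-trans weight-E₀ m≡)
    near : weight² E ≤ 12 * (t * t) + 2 * t * r + r
    near = +-cancelˡ-≤ (2 * N V 2 E) _ _ (begin
      2 * N V 2 E + weight² E                              ≤⟨ cnt₂-≤ (conn? V) E ⟩
      weight E * weight E                                  ≡⟨ cong (λ s → s * s) total ⟩
      (12 * t + r) * (12 * t + r)                          ≤⟨ optimal₂ ⟩
      2 * a 2 + (12 * (t * t) + 2 * t * r + r)             ≤⟨ +-monoˡ-≤ (12 * (t * t) + 2 * t * r + r) (*-monoʳ-≤ 2 (Dominates.counts dom 2)) ⟩
      2 * N V 2 E + (12 * (t * t) + 2 * t * r + r)         ∎)
    byOrder : length V < 8 ⊎ length V ≡ 8 → a 5 ≤ 392 * (t + 3) ^ 5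
    byOrder (inj₁ lt) = contradiction
      (short⇒bounded {t} {r} r<12 {E} total near (≤-trans (≤-reflexive (Frame.corank fr)) (+-monoˡ-≤ 4 (≤-pred lt))))
      (≤⇒≯ (≤-trans (m≤m+n 12 4) (*-mono-≤ 4≤t 4≤t)))
    byOrder (inj₂ eq) = begin
      a 5                                       ≤⟨ Dominates.counts dom 5 ⟩
      N V 5 E                                   ≤⟨ cnt-bounded (conn? V) (twelve⇒near-equal {t} {r} r<12 {E} total near (≡-trans (Frame.corank fr) (cong (_+ 4) eq))) 5 ⟩
      (t + 3) ^ 5 * N V 5 (ones (links E))      ≤⟨ *-monoʳ-≤ ((t + 3) ^ 5) (cubic-trees eq (cubic-links fr (order8⇒cubic fr cub eq))) ⟩
      (t + 3) ^ 5 * 392                         ≡⟨ *-comm ((t + 3) ^ 5) 392 ⟩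
      392 * (t + 3) ^ 5                         ∎

  optimal-second-coefficient : ∀ {t r} → r < 12 → n + 4 ≡ 12 * suc t + r →
    (12 * suc t + r) * (12 * suc t + r) ≤ 2 * a 2 + (12 * (suc t * suc t) + 2 * suc t * r + r)
  optimal-second-coefficient {t} {r} r<12 m≡ = versus (realise-wagner {n} (balanced t r wagner) (links-balanced t r wagner) order)
    where
    open ≤-Reasoning
    W = balanced (suc t) r wagner
    Q = 12 * (suc t * suc t) + 2 * suc t * r + r
    r≤12 : r ≤ 12
    r≤12 = <⇒≤ r<12
    total : weight W ≡ 12 * suc t + r
    total = weight-balanced (suc t) r wagner r≤12
    onWagner : ∀ i → survives (conn? (upTo 8)) i wagner ≡ true → survives (conn? (upTo 8)) i (links W) ≡ true
    onWagner i = subst (λ K → survives (conn? (upTo 8)) i K ≡ true) (sym (links-balanced (suc t) r wagner))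
    regroup : ∀ t r → 12 * suc t + r ≡ 8 + (12 * t + r) + 4
    regroup = solve-∀
    order : n ≡ 8 + weight (balanced t r wagner)
    order = +-cancelʳ-≡ 4 n _ (≡-trans m≡ (≡-trans (regroup t r) (cong (λ w → 8 + w + 4) (sym (weight-balanced t r wagner r≤12)))))
    versus : (∃ λ (H : Graph n) → InC n (n + 4) H × ∀ i → coefficients H i ≡ N (upTo 8) i (lengthen (balanced t r wagner))) →
      (12 * suc t + r) * (12 * suc t + r) ≤ 2 * a 2 + Q
    versus (H , inC′ , counts) = begin
      (12 * suc t + r) * (12 * suc t + r)        ≡⟨ cong (λ s → s * s) total ⟨
      weight W * weight W                        ≤⟨ survives₂ (conn? (upTo 8)) W (onWagner 2 wagner-survives₂) ⟩
      2 * N (upTo 8) 2 W + weight² W             ≡⟨ cong₂ (λ x y → 2 * x + y) (≡-trans (cong (N (upTo 8) 2) (sym (lengthen-balanced t r wagner))) (sym (counts 2))) (weight²-balanced (suc t) r wagner r≤12) ⟩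
      2 * coefficients H 2 + Q                   ≤⟨ +-monoˡ-≤ Q (*-monoʳ-≤ 2 (second-coefficient {H} inC′
                                                      (subst (1 ≤_) (≡-trans (cong (N (upTo 8) 0) (sym (lengthen-balanced t r wagner))) (sym (counts 0))) (survives₀ (conn? (upTo 8)) W (onWagner 0 wagner-survives₀)))
                                                      (subst₂ _≤_ (≡-trans total (sym m≡)) (≡-trans (cong (N (upTo 8) 1) (sym (lengthen-balanced t r wagner))) (sym (counts 1))) (survives₁ (conn? (upTo 8)) W (onWagner 1 wagner-survives₁))))) ⟩
      2 * a 2 + Q                                ∎

-- The skewed competitor and the contradiction

skewed : ℕ → ℕ → ℕ → Weighted Link
skewed c d r = ((0 , 1) , r + c) ∷ map (_, c) ((1 , 2) ∷ (2 , 3) ∷ (3 , 4) ∷ (4 , 5) ∷ (5 , 6) ∷ (6 , 7) ∷ (0 , 7) ∷ []) ++ map (_, d) chords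

weight-skewed : ∀ c d r → weight (skewed c d r) ≡ 8 * c + 4 * d + r
weight-skewed = regroup
  where
  regroup : ∀ c d r → r + c + (c + (c + (c + (c + (c + (c + (c + (d + (d + (d + (d + 0))))))))))) ≡ 8 * c + 4 * d + r
  regroup = solve-∀

-- The remainder r of the edge number is put on a single rim link. Extra weight only increases
-- counts, so the inequality computed without remainder suffices.
skewed-dominates : ∀ {c d} r u → Pointwise (λ e e′ → proj₁ e ≡ proj₁ e′ × proj₂ e ≤ proj₂ e′)
  (raise u (map (_, suc c) rims ++ map (_, suc d) chords)) (lengthen (skewed (u + c) (u + d) r))
skewed-dominates {c} {d} r u = (refl , ≤-trans rim (s≤s (m≤n+m (u + c) r))) ∷ x ∷ x ∷ x ∷ x ∷ x ∷ x ∷ x ∷ y ∷ y ∷ y ∷ y ∷ []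
  where
  rim : u + suc c ≤ suc (u + c)
  rim = ≤-reflexive (+-suc u c)
  x : ∀ {e : Link} → e ≡ e × u + suc c ≤ suc (u + c)
  x = refl , rim
  y : ∀ {e : Link} → e ≡ e × u + suc d ≤ suc (u + d)
  y = refl , ≤-reflexive (+-suc u d)

-- The large numerals enter as parameters. `balance` says that rim weight `suc c` and chord weight
-- `suc d` have the same total as twelve links of weight `suc k`, and `3 ≤ k` supplies the bound
-- `4 ≤ t` needed above.
no-umrg : ∀ {k c d} → 3 ≤ k → 8 * c + 4 * d + 12 ≡ 12 * suc k →
  (∀ u → suc (392 * (u + (suc k + 3)) ^ 5) ≤ N (upTo 8) 5 (raise u (map (_, suc c) rims ++ map (_, suc d) chords))) →
  ∀ {n} {G : Graph n} u {r} → r < 12 → n + 4 ≡ 12 * (u + suc k) + r → ¬ UMRG n (n + 4) G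
no-umrg {k} {c} {d} 3≤k balance trees {n} {G} u {r} r<12 m≡ umrg = versus (realise-wagner {n} E refl order)
  where
  open ≤-Reasoning
  E = skewed (u + c) (u + d) r
  regroup : ∀ u c d r → 8 + (8 * (u + c) + 4 * (u + d) + r) + 4 ≡ 12 * u + (8 * c + 4 * d + 12) + r
  regroup = solve-∀
  order : n ≡ 8 + weight E
  order = +-cancelʳ-≡ 4 n (8 + weight E) (begin-equality
    n + 4                                             ≡⟨ m≡ ⟩
    12 * (u + suc k) + r                              ≡⟨ cong (_+ r) (*-distribˡ-+ 12 u (suc k)) ⟩
    12 * u + 12 * suc k + r                           ≡⟨ cong (λ x → 12 * u + x + r) balance ⟨
    12 * u + (8 * c + 4 * d + 12) + r                 ≡⟨ regroup u c d r ⟨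
    8 + (8 * (u + c) + 4 * (u + d) + r) + 4           ≡⟨ cong (λ w → 8 + w + 4) (weight-skewed (u + c) (u + d) r) ⟨
    8 + weight E + 4                                  ∎)
  m≡′ : n + 4 ≡ 12 * suc (u + k) + r
  m≡′ = ≡-trans m≡ (cong (λ t → 12 * t + r) (+-suc u k))
  versus : (∃ λ (H : Graph n) → InC n (n + 4) H × ∀ i → coefficients H i ≡ N (upTo 8) i (lengthen E)) → ⊥
  versus (H , inC , counts) = <-irrefl refl (begin-strict
    coefficients G 5                         ≤⟨ spanning-trees-bound {G = G} umrg r<12 (s≤s (≤-trans 3≤k (m≤n+m k u))) m≡′ (optimal-second-coefficient {G = G} umrg r<12 m≡′) ⟩
    392 * (suc (u + k) + 3) ^ 5              ≡⟨ cong (λ t → 392 * t ^ 5) (≡-trans (cong (_+ 3) (sym (+-suc u k))) (+-assoc u (suc k) 3)) ⟩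
    392 * (u + (suc k + 3)) ^ 5              <⟨ trees u ⟩
    N (upTo 8) 5 (raise u (map (_, suc c) rims ++ map (_, suc d) chords))
      ≤⟨ cnt-mono (conn? (upTo 8)) (conn? (upTo 8)) (λ K≡K′ → subst (Conn (upTo 8)) (Pointwise.Pointwise-≡⇒≡ K≡K′)) (skewed-dominates r u) 5 ⟩
    N (upTo 8) 5 (lengthen E)                ≡⟨ counts 5 ⟨
    coefficients H 5                         ≤⟨ fifth-coefficient {G = G} umrg {H} inC (subst (2 ≤_) (sym order) (s≤s (s≤s z≤n))) ⟩
    coefficients G 5                         ∎)

no-large-umrg : ∀ {n} {G : Graph n} → 60000 ≤ n → ¬ UMRG n (n + 4) G
-- The threshold is `60000 = 12 · 5000`: it makes the quotient t at least 5000, so t can be written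
-- as 5000 plus the parameter u of `skew-trees`. The numerals 4799 and 5399 count inner vertices,
-- one less than the weights of `skew`.
no-large-umrg {n} {G} large = no-umrg {4999} {4799} {5399} (m≤m+n 3 4996) refl skew-trees {n} {G} (t ∸ 5000) (m%n<n (n + 4) 12) (begin-equality
  n + 4                          ≡⟨ m≡m%n+[m/n]*n (n + 4) 12 ⟩
  (n + 4) % 12 + t * 12          ≡⟨ +-comm ((n + 4) % 12) (t * 12) ⟩
  t * 12 + (n + 4) % 12          ≡⟨ cong (_+ (n + 4) % 12) (*-comm t 12) ⟩
  12 * t + (n + 4) % 12          ≡⟨ cong (λ t → 12 * t + (n + 4) % 12) (m∸n+n≡m (/-monoˡ-≤ 12 (≤-trans large (m≤m+n n 4)))) ⟨
  12 * (t ∸ 5000 + 5000) + (n + 4) % 12 ∎)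
  where
  open ≤-Reasoning
  t = (n + 4) / 12

-- Finitely many small graphs

functions : ∀ {A : Set} n → List A → List (Fin n → A)
functions zero    as = (λ ()) ∷ []
functions (suc n) as = concatMap (λ a → map (λ f → λ { Fin.zero → a ; (Fin.suc i) → f i }) (functions n as)) as

-- Functions are matched only pointwise up to `R`. The parameter allows nesting: rows are matched by
-- equality of entries, and matrices by pointwise equality of rows.
functions-complete : ∀ {A : Set} (R : A → A → Set) n {as} (f : Fin n → A) → (∀ i → Any (R (f i)) as) →
  Any (λ g → ∀ i → R (f i) (g i)) (functions n as)
functions-complete R zero    f covered = here λ ()
functions-complete R (suc n) f covered = Any.concatMap⁺ _ (Any.map
  (λ r → Any.map⁺ (Any.map (λ rs → λ { Fin.zero → r ; (Fin.suc i) → rs i }) (functions-complete R n (f ∘ Fin.suc) (covered ∘ Fin.suc))))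
  (covered Fin.zero))

-- Symmetrising and clearing the diagonal turns every Boolean matrix into a graph and leaves
-- adjacency matrices unchanged, so it suffices to enumerate matrices.
fromMatrix : ∀ {n} → (Fin n → Fin n → Bool) → Graph n
fromMatrix M = record
  { adj    = λ i j → (M i j ∧ M j i) ∧ not (i == j)
  ; sym    = λ i j → cong₂ _∧_ (Bool.∧-comm (M i j) (M j i)) (cong not (==-sym i j))
  ; irrefl = λ i → ≡-trans (cong (λ b → (M i i ∧ M i i) ∧ not b) (==-refl i)) (Bool.∧-zeroʳ (M i i ∧ M i i))
  }
  where
  ==-refl : ∀ {n} (i : Fin n) → (i == i) ≡ true
  ==-refl i with i Fin.≟ i
  ... | yes _  = refl
  ... | no i≢i = contradiction refl i≢i
  ==-sym : ∀ {n} (i j : Fin n) → (i == j) ≡ (j == i)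
  ==-sym i j with i Fin.≟ j | j Fin.≟ i
  ... | yes _    | yes _   = refl
  ... | no _     | no _    = refl
  ... | yes refl | no j≢i  = contradiction refl j≢i
  ... | no i≢j   | yes refl = contradiction refl i≢j

fromMatrix-adj : ∀ {n} (G : Graph n) M → (∀ i j → adj G i j ≡ M i j) → ∀ i j → adj G i j ≡ adj (fromMatrix M) i j
fromMatrix-adj G M eq i j with i Fin.≟ j
... | yes refl = ≡-trans (irrefl G i) (sym (Bool.∧-zeroʳ (M i i ∧ M i i)))
... | no _     = begin
  adj G i j                      ≡⟨ Bool.∧-idem (adj G i j) ⟨
  adj G i j ∧ adj G i j          ≡⟨ cong₂ _∧_ (eq i j) (≡-trans (adj-sym G i j) (eq j i)) ⟩
  M i j ∧ M j i                  ≡⟨ Bool.∧-identityʳ (M i j ∧ M j i) ⟨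
  (M i j ∧ M j i) ∧ true         ∎
  where open ≡-Reasoning

smallGraphs : ℕ → List AnyGraph
smallGraphs k = concatMap (λ n → map (λ M → n , fromMatrix M) (functions n (functions n (true ∷ false ∷ [])))) (upTo k)

smallGraphs-complete : ∀ {k n} (G : Graph n) → n < k → Any (λ H → Iso G (proj₂ H)) (smallGraphs k)
smallGraphs-complete {k} {n} G n<k = Any.concatMap⁺ _ (lose (∈.∈-upTo⁺ n<k) (Any.map⁺ (Any.map
  (λ {M} eq → ↔-id (Fin n) , fromMatrix-adj G M eq)
  (functions-complete (λ f g → ∀ j → f j ≡ g j) n (adj G) λ i → functions-complete _≡_ n (adj G i) λ j → bool (adj G i j)))))
  where
  bool : ∀ b → Any (b ≡_) (true ∷ false ∷ [])
  bool true  = here refl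
  bool false = there (here refl)

theorem4 : Σ (List AnyGraph) λ L →
    (n : ℕ) → 0 < n → (G : Graph n) → UMRG n (n + 4) G →
    Any (λ H → Iso G (proj₂ H)) L
theorem4 = smallGraphs 60000 , λ n _ G umrg → case n <? 60000 of λ
  { (yes n<k) → smallGraphs-complete G n<k
  ; (no n≮k)  → contradiction umrg (no-large-umrg {G = G} (≮⇒≥ n≮k)) }
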